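{- Let $G$ be a 3-uniform hypergraph with $m\ge 211$ edges. Then there exists a partition of its vertex set into three parts such that each part meets at least $\frac{3}{5}m$ edges.
   Context: A 3-uniform hypergraph has a finite vertex set and edges that are distinct 3-element subsets of it. A set meets an edge if it has nonempty intersection with it. -}

module Defs where

open import Data.Nat using (ℕ; _*_; _≤_)
open import Data.Fin using (Fin)
open import Data.Fin.Subset using (Subset; ∣_∣; _∈_)
open import Data.List using (List; length; filter)
open import Data.List.Relation.Unary.Unique.Propositional using (Unique)
open import Data.List.Relation.Unary.All using (All)
open import Data.Product using (∃; _×_; _,_)
open import Relation.Binary.PropositionalEquality using (_≡_)
open import Relation.Nullary using (Dec)
open import Data.Fin.Properties using (any?)
open import Data.Fin.Subset.Properties using (_∈?_)
open import Data.Fin using () renaming (_≟_ to _≟F_)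
open import Relation.Nullary.Decidable using (_×-dec_)

record Hypergraph3 (n : ℕ) : Set where
  field
    edges    : List (Subset n)
    uniform  : All (λ e → ∣ e ∣ ≡ 3) edges
    distinct : Unique edges

open Hypergraph3 public

numEdges : ∀ {n} → Hypergraph3 n → ℕ
numEdges G = length (edges G)

Partition3 : ℕ → Set
Partition3 n = Fin n → Fin 3

Meets : ∀ {n} → Partition3 n → Fin 3 → Subset n → Set
Meets P i e = ∃ λ v → v ∈ e × P v ≡ i

meets? : ∀ {n} (P : Partition3 n) (i : Fin 3) (e : Subset n) → Dec (Meets P i e)
meets? P i e = any? (λ v → (v ∈? e) ×-dec (P v ≟F i))

metCount : ∀ {n} → Hypergraph3 n → Partition3 n → Fin 3 → ℕ
metCount G P i = length (filter (meets? P i) (edges G))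

{-# OPTIONS --safe #-}
module Submission where

open import Defs
open import Data.Nat using (ℕ; _*_; _≤_; zero; suc; _+_; _∸_; _<_; z≤n; s≤s; _⊓_)
open import Data.Fin using (Fin; zero; suc; _≟_)
open import Data.Product using (∃; _×_; _,_; proj₁; proj₂; Σ)
open import Data.Bool using (Bool; true; false; if_then_else_; _∧_; _∨_; not)
open import Data.Empty using (⊥; ⊥-elim)
open import Data.Sum using (_⊎_; inj₁; inj₂)
open import Data.Fin.Subset using (Subset; ∣_∣; inside; outside)
open import Data.Vec as Vec using (Vec; []; _∷_; lookup; tabulate)
open import Data.List as List using (List; []; _∷_; length; filter)
open import Data.List.Relation.Unary.All as All using (All; []; _∷_)
open import Data.List.Relation.Unary.AllPairs using ([]; _∷_)
open import Data.List.Relation.Unary.Unique.Propositional using (Unique)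
open import Data.Integer using (ℤ; +_; -[1+_]; +≤+; -≤+; -≤-; 0ℤ; 1ℤ; _⊔_)
  renaming (_+_ to _+ᶻ_; _*_ to _*ᶻ_; _-_ to _-ᶻ_; -_ to neg; _≤_ to _≤ᶻ_)
open import Data.Integer.Tactic.RingSolver using (solve-∀)
open import Data.Nat.Combinatorics using () renaming (_C_ to _choose_)
open import Relation.Binary.PropositionalEquality
open import Relation.Nullary using (¬_; Dec; yes; no; does; contradiction)
open import Function using (_∘_; id; case_of_)
import Data.Nat.Properties as ℕₚ
import Data.Integer.Properties as ℤₚ
import Data.Fin as Fin
import Data.Vec.Properties as Vecₚ
import Data.Nat.Combinatorics as Comb
import Data.Nat.Tactic.RingSolver as ℕR
import Data.List.Properties as Listₚ

-- Call a part bad if it misses more than 2m/5 of the m edges, and let P minimise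
-- Φ = 10 ΣMᵢ + Σ max(0, 5Mᵢ - 2m), where Mᵢ is the number of edges missing the part i.
-- If no partition is free of bad parts, then every recolouring of one or two vertices (or of
-- one of several disjoint blocks of vertices) raises Φ or leaves a bad part.  Once the vertices
-- are sorted into a few classes by the recolourings available to them, summing these
-- inequalities over a class turns them into inequalities Σₑ F(κ e) ≥ 0, where κ e counts the
-- vertices of e in each class; distinctness of the edges adds upper bounds on the number of
-- edges inside a small set.  In each case a nonnegative combination of these inequalities is
-- pointwise nonpositive and contains a positive quantity: a Farkas certificate, found by linear
-- programming and checked here by computation along a case tree on the sizes of the classes.

-- The ratio 3/5 is attained by the ten triples on five vertices: some part has at most one vertex
-- and so meets at most six of them. A random colouring leaves a given part out of only 8/27 of the
-- edges on average; the obstacle is a few vertices of large degree, whose recolouring overshoots.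
-- Vertices are therefore sorted by whether one of them alone repairs a bad part or endangers a good
-- one, and the case trees branch only on the numbers of such heavy vertices. The hinge in Φ alone
-- would say nothing about moves between parts that stay good, and the linear term alone would not
-- reward repairing a bad part. With the weights chosen, one more missed edge costs 15 at a bad part
-- and 10 at a good one; this is the source of the ratios 3:2, 1:1 and 2:3 between losses and gains.
-- The bound N choose 3 on the edges inside N vertices does not grow with m. Comparing it with 211 ≤
-- m makes it a sum over edges like all other inequalities, so that a certificate need only be
-- checked on the finitely many ways in which a triple can be distributed over the classes.

NN : ℤ → Set
NN x = 0ℤ ≤ᶻ x

infixl 6 _⊞_
infixr 7 _⊡_
infixl 5 _by_

_⊞_ : ∀ {x y} → NN x → NN y → NN (x +ᶻ y)
p ⊞ q = ℤₚ.+-mono-≤ p q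

_⊡_ : ∀ (k : ℕ) {x} → NN x → NN (+ k *ᶻ x)
_⊡_ k {x} p = subst (_≤ᶻ + k *ᶻ x) (ℤₚ.*-zeroʳ (+ k)) (ℤₚ.*-monoˡ-≤-nonNeg (+ k) p)

_by_ : ∀ {x y} → NN x → x ≡ y → NN y
p by refl = p

NN-cancel : ∀ k {x} → NN (+ suc k *ᶻ x) → NN x
NN-cancel k {x} p = ℤₚ.*-cancelˡ-≤-pos 0ℤ x (+ suc k) (subst (_≤ᶻ + suc k *ᶻ x) (sym (ℤₚ.*-zeroʳ (+ suc k))) p)

NN-prod : ∀ {x y} → NN x → NN y → NN (x *ᶻ y)
NN-prod {+ k} p q = k ⊡ q

≤⇒NN : ∀ {x y} → x ≤ᶻ y → NN (y -ᶻ x)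
≤⇒NN = ℤₚ.i≤j⇒0≤j-i

NN⇒≤ : ∀ {x y} → NN (y -ᶻ x) → x ≤ᶻ y
NN⇒≤ = ℤₚ.0≤i-j⇒j≤i

NN+ : ∀ k → NN (+ k)
NN+ k = +≤+ z≤n

-- Integrality turns a strict inequality into a gap of 1, so both outcomes are nonstrict and can
-- enter the same sums.
dichotomy : ∀ x y → NN (y -ᶻ x) ⊎ NN (x -ᶻ y -ᶻ 1ℤ)
dichotomy x y with ℤₚ.≤-total x y
... | inj₁ p = inj₁ (≤⇒NN p)
... | inj₂ q with x ℤₚ.≟ y
...   | yes refl = inj₁ (≤⇒NN q)
...   | no ne = inj₂ (≤⇒NN (ℤₚ.i<j⇒suc[i]≤j (ℤₚ.≤∧≢⇒< q (ne ∘ sym))) by lem x y)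
  where lem : ∀ x y → x -ᶻ (1ℤ +ᶻ y) ≡ x -ᶻ y -ᶻ 1ℤ
        lem = solve-∀

weaken1 : ∀ {x y} → NN (x -ᶻ y -ᶻ 1ℤ) → NN (x -ᶻ y)
weaken1 {x} {y} p = p ⊞ NN+ 1 by lem x y
  where lem : ∀ x y → x -ᶻ y -ᶻ 1ℤ +ᶻ 1ℤ ≡ x -ᶻ y
        lem = solve-∀

-- Finite sums over edges and over vertices

∑ : ∀ {A : Set} → List A → (A → ℤ) → ℤ
∑ [] f = 0ℤ
∑ (x ∷ xs) f = f x +ᶻ ∑ xs f

∑-cong : ∀ {A : Set} (xs : List A) {f g : A → ℤ} → (∀ x → f x ≡ g x) → ∑ xs f ≡ ∑ xs g
∑-cong [] h = refl
∑-cong (x ∷ xs) h = cong₂ _+ᶻ_ (h x) (∑-cong xs h)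

∑-+ : ∀ {A : Set} (xs : List A) (f g : A → ℤ) → ∑ xs (λ x → f x +ᶻ g x) ≡ ∑ xs f +ᶻ ∑ xs g
∑-+ [] f g = refl
∑-+ (x ∷ xs) f g = trans (cong (f x +ᶻ g x +ᶻ_) (∑-+ xs f g)) (lem (f x) (g x) (∑ xs f) (∑ xs g))
  where lem : ∀ a b c d → a +ᶻ b +ᶻ (c +ᶻ d) ≡ a +ᶻ c +ᶻ (b +ᶻ d)
        lem = solve-∀

∑-* : ∀ {A : Set} (xs : List A) (k : ℤ) (f : A → ℤ) → ∑ xs (λ x → k *ᶻ f x) ≡ k *ᶻ ∑ xs f
∑-* [] k f = sym (ℤₚ.*-zeroʳ k)
∑-* (x ∷ xs) k f = trans (cong (k *ᶻ f x +ᶻ_) (∑-* xs k f)) (sym (ℤₚ.*-distribˡ-+ k (f x) (∑ xs f)))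

∑-- : ∀ {A : Set} (xs : List A) (f g : A → ℤ) → ∑ xs (λ x → f x -ᶻ g x) ≡ ∑ xs f -ᶻ ∑ xs g
∑-- [] f g = refl
∑-- (x ∷ xs) f g = trans (cong (f x -ᶻ g x +ᶻ_) (∑-- xs f g)) (lem (f x) (g x) (∑ xs f) (∑ xs g))
  where lem : ∀ a b c d → a -ᶻ b +ᶻ (c -ᶻ d) ≡ a +ᶻ c -ᶻ (b +ᶻ d)
        lem = solve-∀

∑-NN : ∀ {A : Set} (xs : List A) (f : A → ℤ) → (∀ x → NN (f x)) → NN (∑ xs f)
∑-NN [] f h = NN+ 0
∑-NN (x ∷ xs) f h = h x ⊞ ∑-NN xs f h

∑-mono : ∀ {A : Set} (xs : List A) (f g : A → ℤ) → (∀ x → NN (g x -ᶻ f x)) → NN (∑ xs g -ᶻ ∑ xs f)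
∑-mono xs f g h = ∑-NN xs (λ x → g x -ᶻ f x) h by ∑-- xs g f

∑-const : ∀ {A : Set} (xs : List A) (k : ℤ) → ∑ xs (λ _ → k) ≡ + length xs *ᶻ k
∑-const [] k = refl
∑-const (x ∷ xs) k = trans (cong (k +ᶻ_) (∑-const xs k)) (lem k (+ length xs))
  where lem : ∀ k l → k +ᶻ l *ᶻ k ≡ (1ℤ +ᶻ l) *ᶻ k
        lem = solve-∀

∑ᵛ : ∀ {n} → (Fin n → ℤ) → ℤ
∑ᵛ {zero} f = 0ℤ
∑ᵛ {suc n} f = f zero +ᶻ ∑ᵛ (f ∘ suc)

∑ᵛ-cong : ∀ {n} {f g : Fin n → ℤ} → (∀ v → f v ≡ g v) → ∑ᵛ f ≡ ∑ᵛ g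
∑ᵛ-cong {zero} h = refl
∑ᵛ-cong {suc n} h = cong₂ _+ᶻ_ (h zero) (∑ᵛ-cong (h ∘ suc))

∑ᵛ-NN : ∀ {n} {f : Fin n → ℤ} → (∀ v → NN (f v)) → NN (∑ᵛ f)
∑ᵛ-NN {zero} h = NN+ 0
∑ᵛ-NN {suc n} h = h zero ⊞ ∑ᵛ-NN (h ∘ suc)

∑ᵛ-∑ : ∀ {n} {A : Set} (xs : List A) (f : Fin n → A → ℤ) →
  ∑ᵛ (λ v → ∑ xs (f v)) ≡ ∑ xs (λ x → ∑ᵛ (λ v → f v x))
∑ᵛ-∑ {zero} xs f = sym (trans (∑-const xs 0ℤ) (ℤₚ.*-zeroʳ (+ length xs)))
∑ᵛ-∑ {suc n} xs f = trans (cong (∑ xs (f zero) +ᶻ_) (∑ᵛ-∑ xs (f ∘ suc)))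
  (sym (∑-+ xs (f zero) (λ x → ∑ᵛ (λ v → f (suc v) x))))

∑ᵛ-+ : ∀ {n} (f g : Fin n → ℤ) → ∑ᵛ (λ v → f v +ᶻ g v) ≡ ∑ᵛ f +ᶻ ∑ᵛ g
∑ᵛ-+ {zero} f g = refl
∑ᵛ-+ {suc n} f g = trans (cong (f zero +ᶻ g zero +ᶻ_) (∑ᵛ-+ (f ∘ suc) (g ∘ suc))) (lem (f zero) (g zero) _ _)
  where lem : ∀ a b c d → a +ᶻ b +ᶻ (c +ᶻ d) ≡ a +ᶻ c +ᶻ (b +ᶻ d)
        lem = solve-∀

∑ᵛ-* : ∀ {n} (k : ℤ) (f : Fin n → ℤ) → ∑ᵛ (λ v → k *ᶻ f v) ≡ k *ᶻ ∑ᵛ f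
∑ᵛ-* {zero} k f = sym (ℤₚ.*-zeroʳ k)
∑ᵛ-* {suc n} k f = trans (cong (k *ᶻ f zero +ᶻ_) (∑ᵛ-* k (f ∘ suc))) (sym (ℤₚ.*-distribˡ-+ k (f zero) _))

-- Weights of edges and indicator functions

wt : ∀ {n} → (Fin n → ℕ) → Subset n → ℕ
wt φ [] = 0
wt φ (b ∷ e) = (if b then φ zero else 0) + wt (φ ∘ suc) e

wt-cong : ∀ {n} {φ ψ : Fin n → ℕ} (e : Subset n) → (∀ v → φ v ≡ ψ v) → wt φ e ≡ wt ψ e
wt-cong [] h = refl
wt-cong (true ∷ e) h = cong₂ _+_ (h zero) (wt-cong e (h ∘ suc))
wt-cong (false ∷ e) h = wt-cong e (h ∘ suc)

wt-+ : ∀ {n} (φ ψ : Fin n → ℕ) (e : Subset n) → wt (λ v → φ v + ψ v) e ≡ wt φ e + wt ψ e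
wt-+ φ ψ [] = refl
wt-+ φ ψ (false ∷ e) = wt-+ (φ ∘ suc) (ψ ∘ suc) e
wt-+ φ ψ (true ∷ e) = trans (cong (λ k → φ zero + ψ zero + k) (wt-+ (φ ∘ suc) (ψ ∘ suc) e))
  (lem (φ zero) (ψ zero) (wt (φ ∘ suc) e) (wt (ψ ∘ suc) e))
  where lem : ∀ a b c d → a + b + (c + d) ≡ a + c + (b + d)
        lem = ℕR.solve-∀

wt-mono : ∀ {n} {φ ψ : Fin n → ℕ} (e : Subset n) → (∀ v → φ v ≤ ψ v) → wt φ e ≤ wt ψ e
wt-mono [] h = z≤n
wt-mono (true ∷ e) h = ℕₚ.+-mono-≤ (h zero) (wt-mono e (h ∘ suc))
wt-mono (false ∷ e) h = wt-mono e (h ∘ suc)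

wt-one : ∀ {n} (e : Subset n) → wt (λ _ → 1) e ≡ ∣ e ∣
wt-one [] = refl
wt-one (true ∷ e) = cong suc (wt-one e)
wt-one (false ∷ e) = wt-one e

wt-zero : ∀ {n} (e : Subset n) → wt (λ _ → 0) e ≡ 0
wt-zero [] = refl
wt-zero (true ∷ e) = wt-zero e
wt-zero (false ∷ e) = wt-zero e

inc : ∀ {n} → Fin n → Subset n → ℕ
inc v e = if lookup e v then 1 else 0

wt-∑ᵛ : ∀ {n} (φ : Fin n → ℕ) (e : Subset n) → + wt φ e ≡ ∑ᵛ (λ v → + φ v *ᶻ + inc v e)
wt-∑ᵛ φ [] = refl
wt-∑ᵛ φ (true ∷ e) = cong₂ _+ᶻ_ (sym (ℤₚ.*-identityʳ (+ φ zero))) (wt-∑ᵛ (φ ∘ suc) e)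
wt-∑ᵛ φ (false ∷ e) = trans (wt-∑ᵛ (φ ∘ suc) e) (trans (sym (ℤₚ.+-identityˡ _)) (cong₂ _+ᶻ_ (sym (ℤₚ.*-zeroʳ (+ φ zero))) refl))

bit : Bool → ℕ
bit true = 1
bit false = 0

δ : ∀ {k} → Fin k → Fin k → ℕ
δ zero zero = 1
δ zero (suc j) = 0
δ (suc i) zero = 0
δ (suc i) (suc j) = δ i j

δ-refl : ∀ {k} (i : Fin k) → δ i i ≡ 1
δ-refl zero = refl
δ-refl (suc i) = δ-refl i

δ-≢ : ∀ {k} {i j : Fin k} → ¬ i ≡ j → δ i j ≡ 0
δ-≢ {i = zero} {zero} h = contradiction refl h
δ-≢ {i = zero} {suc j} h = refl
δ-≢ {i = suc i} {zero} h = refl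
δ-≢ {i = suc i} {suc j} h = δ-≢ (h ∘ cong suc)

δ-≡ : ∀ {k} {i j : Fin k} {m} → δ i j ≡ suc m → i ≡ j
δ-≡ {i = i} {j} h with i ≟ j
... | yes p = p
... | no p = contradiction (trans (sym h) (δ-≢ p)) λ ()

wt-δ : ∀ {n} (v : Fin n) (e : Subset n) → wt (δ v) e ≡ inc v e
wt-δ zero (true ∷ e) = cong suc (wt-zero e)
wt-δ zero (false ∷ e) = wt-zero e
wt-δ (suc v) (true ∷ e) = wt-δ v e
wt-δ (suc v) (false ∷ e) = wt-δ v e

z : ℕ → ℤ
z zero = 1ℤ
z (suc _) = 0ℤ

z-NN : ∀ a → NN (z a)
z-NN zero = NN+ 1
z-NN (suc _) = NN+ 0

z-anti : ∀ {a b} → a ≤ b → NN (z a -ᶻ z b)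
z-anti {zero} {zero} h = NN+ 0
z-anti {zero} {suc b} h = NN+ 1
z-anti {suc a} {suc b} h = NN+ 0

-- By truncation this is the indicator of `a = 1`: an edge with one vertex in a part is the one that
-- misses the part once that vertex leaves.
w : ℕ → ℤ
w a = z (a ∸ 1) -ᶻ z a

w-NN : ∀ a → NN (w a)
w-NN a = z-anti (ℕₚ.m∸n≤m a 1)

∧-true : ∀ {a b} → a ∧ b ≡ true → a ≡ true × b ≡ true
∧-true {true} h = refl , h

-- Recolouring a set of vertices

module _ {n : ℕ} where

  Colouring : Set
  Colouring = Fin n → Fin 3

  Part : Set
  Part = Fin n → Bool

  ∣_∣ᵇ : Part → Subset n → ℕ
  ∣ B ∣ᵇ = wt (bit ∘ B)

  ct : Colouring → Fin 3 → Subset n → ℕ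
  ct P i = wt (λ v → δ (P v) i)

  recol : Part → Fin 3 → Colouring → Colouring
  recol B j P v = if B v then j else P v

  single : Fin n → Part
  single u v = does (u ≟ v)

  bit-single : ∀ u v → bit (single u v) ≡ δ u v
  bit-single u v with u ≟ v
  ... | yes refl = sym (δ-refl u)
  ... | no p = sym (δ-≢ p)

  single-wt : ∀ u e → ∣ single u ∣ᵇ e ≡ inc u e
  single-wt u e = trans (wt-cong e (bit-single u)) (wt-δ u e)

  single-≡ : ∀ {u v} → single u v ≡ true → u ≡ v
  single-≡ {u} {v} h with u ≟ v
  single-≡ {u} {v} h | yes p = p

  _⊂[_,_] : Part → Colouring → Fin 3 → Set
  B ⊂[ P , i ] = ∀ v → B v ≡ true → P v ≡ i

  single⊂ : ∀ {P : Colouring} {i u} → P u ≡ i → single u ⊂[ P , i ]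
  single⊂ {P} {u = u} h v s = trans (cong P (sym (single-≡ {u} {v} s))) h

  module _ (P : Colouring) {i j : Fin 3} (i≢j : ¬ i ≡ j) (B : Part) (B⊂ : B ⊂[ P , i ]) where

    ct-from : ∀ e → ct P i e ≡ ct (recol B j P) i e + ∣ B ∣ᵇ e
    ct-from e = trans (wt-cong e lem) (wt-+ _ _ e)
      where
      lem : ∀ v → δ (P v) i ≡ δ (recol B j P v) i + bit (B v)
      lem v with B v | B⊂ v
      ... | true | h = trans (cong (λ x → δ x i) (h refl)) (trans (δ-refl i) (cong (_+ 1) (sym (δ-≢ (i≢j ∘ sym)))))
      ... | false | h = sym (ℕₚ.+-identityʳ _)

    ct-to : ∀ e → ct (recol B j P) j e ≡ ct P j e + ∣ B ∣ᵇ e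
    ct-to e = trans (wt-cong e lem) (wt-+ _ _ e)
      where
      lem : ∀ v → δ (recol B j P v) j ≡ δ (P v) j + bit (B v)
      lem v with B v | B⊂ v
      ... | true | h = trans (δ-refl j) (cong (_+ 1) (sym (trans (cong (λ x → δ x j) (h refl)) (δ-≢ i≢j))))
      ... | false | h = sym (ℕₚ.+-identityʳ _)

    ct-other : ∀ {k} → ¬ k ≡ i → ¬ k ≡ j → ∀ e → ct (recol B j P) k e ≡ ct P k e
    ct-other {k} k≢i k≢j e = wt-cong e lem
      where
      lem : ∀ v → δ (recol B j P v) k ≡ δ (P v) k
      lem v with B v | B⊂ v
      ... | true | h = trans (δ-≢ (k≢j ∘ sym)) (sym (trans (cong (λ x → δ x k) (h refl)) (δ-≢ (k≢i ∘ sym))))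
      ... | false | h = refl

  part≤ct : ∀ {P : Colouring} {i} (B : Part) → B ⊂[ P , i ] → ∀ e → ∣ B ∣ᵇ e ≤ ct P i e
  part≤ct {P} {i} B B⊂ e = wt-mono e lem
    where
    lem : ∀ v → bit (B v) ≤ δ (P v) i
    lem v with B v | B⊂ v
    ... | true | h = ℕₚ.≤-reflexive (sym (trans (cong (λ x → δ x i) (h refl)) (δ-refl i)))
    ... | false | h = z≤n

-- The hinge and the three labels

pos : ℤ → ℤ
pos x = x ⊔ 0ℤ

pos-NN : ∀ x → NN (pos x)
pos-NN x = ℤₚ.i≤j⊔i x 0ℤ

pos-≥ : ∀ x → NN (pos x -ᶻ x)
pos-≥ x = ≤⇒NN (ℤₚ.i≤i⊔j x 0ℤ)

pos-≤ : ∀ {u} x → NN u → NN (u -ᶻ x) → NN (u -ᶻ pos x)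
pos-≤ x a b = ≤⇒NN (ℤₚ.⊔-lub (NN⇒≤ b) a)

record Distinct (i j k : Fin 3) : Set where
  constructor distinct₃
  field
    i≢j : ¬ i ≡ j
    i≢k : ¬ i ≡ k
    j≢k : ¬ j ≡ k

rot : ∀ {i j k} → Distinct i j k → Distinct i k j
rot (distinct₃ a b c) = distinct₃ b a (c ∘ sym)

turn : ∀ {i j k} → Distinct i j k → Distinct j k i
turn (distinct₃ a b c) = distinct₃ c (a ∘ sym) (b ∘ sym)

sum₃ : (Fin 3 → ℤ) → ℤ
sum₃ f = f zero +ᶻ f (suc zero) +ᶻ f (suc (suc zero))

sum₃-distinct : ∀ {i j k} → Distinct i j k → ∀ f → sum₃ f ≡ f i +ᶻ f j +ᶻ f k
sum₃-distinct {zero} {zero} d f = contradiction refl (Distinct.i≢j d)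
sum₃-distinct {zero} {suc zero} {zero} d f = contradiction refl (Distinct.i≢k d)
sum₃-distinct {zero} {suc zero} {suc zero} d f = contradiction refl (Distinct.j≢k d)
sum₃-distinct {zero} {suc zero} {suc (suc zero)} d f = refl
sum₃-distinct {zero} {suc (suc zero)} {zero} d f = contradiction refl (Distinct.i≢k d)
sum₃-distinct {zero} {suc (suc zero)} {suc zero} d f = lem (f zero) (f (suc zero)) (f (suc (suc zero)))
  where lem : ∀ a b c → a +ᶻ b +ᶻ c ≡ a +ᶻ c +ᶻ b
        lem = solve-∀
sum₃-distinct {zero} {suc (suc zero)} {suc (suc zero)} d f = contradiction refl (Distinct.j≢k d)
sum₃-distinct {suc zero} {zero} {zero} d f = contradiction refl (Distinct.j≢k d)
sum₃-distinct {suc zero} {zero} {suc zero} d f = contradiction refl (Distinct.i≢k d)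
sum₃-distinct {suc zero} {zero} {suc (suc zero)} d f = lem (f zero) (f (suc zero)) (f (suc (suc zero)))
  where lem : ∀ a b c → a +ᶻ b +ᶻ c ≡ b +ᶻ a +ᶻ c
        lem = solve-∀
sum₃-distinct {suc zero} {suc zero} d f = contradiction refl (Distinct.i≢j d)
sum₃-distinct {suc zero} {suc (suc zero)} {zero} d f = lem (f zero) (f (suc zero)) (f (suc (suc zero)))
  where lem : ∀ a b c → a +ᶻ b +ᶻ c ≡ b +ᶻ c +ᶻ a
        lem = solve-∀
sum₃-distinct {suc zero} {suc (suc zero)} {suc zero} d f = contradiction refl (Distinct.i≢k d)
sum₃-distinct {suc zero} {suc (suc zero)} {suc (suc zero)} d f = contradiction refl (Distinct.j≢k d)
sum₃-distinct {suc (suc zero)} {zero} {zero} d f = contradiction refl (Distinct.j≢k d)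
sum₃-distinct {suc (suc zero)} {zero} {suc zero} d f = lem (f zero) (f (suc zero)) (f (suc (suc zero)))
  where lem : ∀ a b c → a +ᶻ b +ᶻ c ≡ c +ᶻ a +ᶻ b
        lem = solve-∀
sum₃-distinct {suc (suc zero)} {zero} {suc (suc zero)} d f = contradiction refl (Distinct.i≢k d)
sum₃-distinct {suc (suc zero)} {suc zero} {zero} d f = lem (f zero) (f (suc zero)) (f (suc (suc zero)))
  where lem : ∀ a b c → a +ᶻ b +ᶻ c ≡ c +ᶻ b +ᶻ a
        lem = solve-∀
sum₃-distinct {suc (suc zero)} {suc zero} {suc zero} d f = contradiction refl (Distinct.j≢k d)
sum₃-distinct {suc (suc zero)} {suc zero} {suc (suc zero)} d f = contradiction refl (Distinct.i≢k d)
sum₃-distinct {suc (suc zero)} {suc (suc zero)} d f = contradiction refl (Distinct.i≢j d)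

one-sum : ∀ l → sum₃ (λ x → + δ l x) ≡ 1ℤ
one-sum zero = refl
one-sum (suc zero) = refl
one-sum (suc (suc zero)) = refl

-- If `l` were none of the three, its indicator summed over all labels would be 1 by `one-sum` and 0
-- by `sum₃-distinct`.
third : ∀ {i j k} → Distinct i j k → ∀ l → l ≡ i ⊎ l ≡ j ⊎ l ≡ k
third {i} {j} {k} d l with l ≟ i | l ≟ j | l ≟ k
... | yes p | _ | _ = inj₁ p
... | no _ | yes p | _ = inj₂ (inj₁ p)
... | no _ | no _ | yes p = inj₂ (inj₂ p)
... | no a | no b | no c = contradiction (trans (sym s₁) s₂) λ ()
  where
  one : Fin 3 → ℤ
  one x = + δ l x
  s₁ : sum₃ one ≡ 1ℤ
  s₁ = one-sum l
  s₂ : sum₃ one ≡ 0ℤ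
  s₂ = trans (sum₃-distinct d one) (cong₂ _+ᶻ_ (cong₂ _+ᶻ_ (cong +_ (δ-≢ a)) (cong +_ (δ-≢ b))) (cong +_ (δ-≢ c)))

-- The potential and the inequalities at its minimum

module Extremal {n : ℕ} (E : List (Subset n)) where

  m : ℤ
  m = + length E

  M : Colouring {n} → Fin 3 → ℤ
  M P i = ∑ E (λ e → z (ct P i e))

  -- Five times the amount by which the missed edges exceed the allowed 2m/5; the part is bad
  -- exactly when this is positive.
  ξ : Colouring {n} → Fin 3 → ℤ
  ξ P i = + 5 *ᶻ M P i -ᶻ + 2 *ᶻ m

  cost : Colouring {n} → Fin 3 → ℤ
  cost P i = + 10 *ᶻ M P i +ᶻ pos (ξ P i)

  Φ : Colouring {n} → ℤ
  Φ P = sum₃ (cost P)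

  Balanced : Colouring {n} → Set
  Balanced P = ∀ i → NN (neg (ξ P i))

  record Optimal (P : Colouring {n}) : Set where
    field
      minimal : ∀ Q → Φ P ≤ᶻ Φ Q
      unbalanced : ∀ Q → ¬ Balanced Q

  -- The number of edges that begin to miss the part when `B` leaves it.
  p : Colouring {n} → Fin 3 → Part → ℤ
  p P i B = ∑ E (λ e → z (ct P i e ∸ ∣ B ∣ᵇ e) -ᶻ z (ct P i e))

  -- The number of edges that cease to miss the part when `B` joins it.
  q : Colouring {n} → Fin 3 → Part → ℤ
  q P j B = ∑ E (λ e → z (ct P j e) -ᶻ z (ct P j e + ∣ B ∣ᵇ e))

  p-NN : ∀ P i B → NN (p P i B)
  p-NN P i B = ∑-NN E _ (λ e → z-anti (ℕₚ.m∸n≤m (ct P i e) (∣ B ∣ᵇ e)))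

  module _ (P : Colouring {n}) {i j : Fin 3} (i≢j : ¬ i ≡ j) (B : Part) (B⊂ : B ⊂[ P , i ]) where

    M-from : M (recol B j P) i ≡ M P i +ᶻ p P i B
    M-from = trans (∑-cong E lem) (∑-+ E _ _)
      where
      lem₁ : ∀ x y → x ≡ y +ᶻ (x -ᶻ y)
      lem₁ = solve-∀
      lem : ∀ e → z (ct (recol B j P) i e) ≡ z (ct P i e) +ᶻ (z (ct P i e ∸ ∣ B ∣ᵇ e) -ᶻ z (ct P i e))
      lem e rewrite ct-from P i≢j B B⊂ e | ℕₚ.m+n∸n≡m (ct (recol B j P) i e) (∣ B ∣ᵇ e) =
        lem₁ (z (ct (recol B j P) i e)) (z (ct (recol B j P) i e + ∣ B ∣ᵇ e))

    M-to : M (recol B j P) j ≡ M P j -ᶻ q P j B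
    M-to = trans (∑-cong E lem) (∑-- E _ _)
      where
      lem₁ : ∀ x y → x ≡ y -ᶻ (y -ᶻ x)
      lem₁ = solve-∀
      lem : ∀ e → z (ct (recol B j P) j e) ≡ z (ct P j e) -ᶻ (z (ct P j e) -ᶻ z (ct P j e + ∣ B ∣ᵇ e))
      lem e rewrite ct-to P i≢j B B⊂ e = lem₁ (z (ct P j e + ∣ B ∣ᵇ e)) (z (ct P j e))

    M-other : ∀ {k} → ¬ k ≡ i → ¬ k ≡ j → M (recol B j P) k ≡ M P k
    M-other a b = ∑-cong E (λ e → cong z (ct-other P i≢j B B⊂ a b e))

  balanced₃ : ∀ {i j k} → Distinct i j k → ∀ Q → NN (neg (ξ Q i)) → NN (neg (ξ Q j)) → NN (neg (ξ Q k)) → Balanced Q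
  balanced₃ d Q a b c l with third d l
  ... | inj₁ refl = a
  ... | inj₂ (inj₁ refl) = b
  ... | inj₂ (inj₂ refl) = c

  module Moves {P : Colouring {n}} (opt : Optimal P) where
    open Optimal opt

    -- The change of Φ when B leaves the part i for the part j; U and W bound the new
    -- hinge terms from above, X and Y the old ones from below.
    move : ∀ {i j k} → Distinct i j k → ∀ {B} → B ⊂[ P , i ] → ∀ {U W X Y} →
      NN U → NN (U -ᶻ (ξ P i +ᶻ + 5 *ᶻ p P i B)) →
      NN W → NN (W -ᶻ (ξ P j -ᶻ + 5 *ᶻ q P j B)) →
      NN (pos (ξ P i) -ᶻ X) → NN (pos (ξ P j) -ᶻ Y) →
      NN (+ 10 *ᶻ p P i B -ᶻ + 10 *ᶻ q P j B +ᶻ (U -ᶻ X) +ᶻ (W -ᶻ Y))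
    move {i} {j} {k} d {B} B⊂ {U} {W} {X} {Y} u₀ u w₀ w' x y =
      ≤⇒NN (subst₂ _≤ᶻ_ (sum₃-distinct d (cost P)) e₄ (minimal P'))
        ⊞ pos-≤ (ξ P' i) u₀ (u by cong (λ r → U -ᶻ r) (sym e₁)) ⊞ pos-≤ (ξ P' j) w₀ (w' by cong (λ r → W -ᶻ r) (sym e₂)) ⊞ x ⊞ y
        by lem (M P i) (M P j) (p P i B) (q P j B) (pos (ξ P' i)) (pos (ξ P' j)) (pos (ξ P i)) (pos (ξ P j)) (cost P k) U W X Y
      where
      open Distinct d
      P' = recol B j P
      lem₁ : ∀ a b c → + 5 *ᶻ (a +ᶻ b) -ᶻ c ≡ + 5 *ᶻ a -ᶻ c +ᶻ + 5 *ᶻ b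
      lem₁ = solve-∀
      lem₂ : ∀ a b c → + 5 *ᶻ (a -ᶻ b) -ᶻ c ≡ + 5 *ᶻ a -ᶻ c -ᶻ + 5 *ᶻ b
      lem₂ = solve-∀
      e₁ : ξ P' i ≡ ξ P i +ᶻ + 5 *ᶻ p P i B
      e₁ = trans (cong (λ r → + 5 *ᶻ r -ᶻ + 2 *ᶻ m) (M-from P i≢j B B⊂)) (lem₁ (M P i) (p P i B) (+ 2 *ᶻ m))
      e₂ : ξ P' j ≡ ξ P j -ᶻ + 5 *ᶻ q P j B
      e₂ = trans (cong (λ r → + 5 *ᶻ r -ᶻ + 2 *ᶻ m) (M-to P i≢j B B⊂)) (lem₂ (M P j) (q P j B) (+ 2 *ᶻ m))
      e₃ : cost P' k ≡ cost P k
      e₃ = cong (λ r → + 10 *ᶻ r +ᶻ pos (+ 5 *ᶻ r -ᶻ + 2 *ᶻ m)) (M-other P i≢j B B⊂ (i≢k ∘ sym) (j≢k ∘ sym))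
      e₄ : Φ P' ≡ (+ 10 *ᶻ (M P i +ᶻ p P i B) +ᶻ pos (ξ P' i)) +ᶻ (+ 10 *ᶻ (M P j -ᶻ q P j B) +ᶻ pos (ξ P' j)) +ᶻ cost P k
      e₄ = trans (sum₃-distinct d (cost P')) (cong₂ _+ᶻ_ (cong₂ _+ᶻ_
        (cong (λ r → + 10 *ᶻ r +ᶻ pos (ξ P' i)) (M-from P i≢j B B⊂)) (cong (λ r → + 10 *ᶻ r +ᶻ pos (ξ P' j)) (M-to P i≢j B B⊂))) e₃)
      lem : ∀ a b x y hi' hj' hi hj c U W X Y →
        (+ 10 *ᶻ (a +ᶻ x) +ᶻ hi') +ᶻ (+ 10 *ᶻ (b -ᶻ y) +ᶻ hj') +ᶻ c -ᶻ (+ 10 *ᶻ a +ᶻ hi +ᶻ (+ 10 *ᶻ b +ᶻ hj) +ᶻ c)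
          +ᶻ (U -ᶻ hi') +ᶻ (W -ᶻ hj') +ᶻ (hi -ᶻ X) +ᶻ (hj -ᶻ Y)
        ≡ + 10 *ᶻ x -ᶻ + 10 *ᶻ y +ᶻ (U -ᶻ X) +ᶻ (W -ᶻ Y)
      lem = solve-∀

    -- After the move `j` is repaired and `k` is as good as before, so only `i` can account for the
    -- imbalance.
    move-balanced : ∀ {i j k} → Distinct i j k → ∀ {B} → B ⊂[ P , i ] →
      NN (+ 5 *ᶻ q P j B -ᶻ ξ P j) → NN (neg (ξ P k)) → NN (+ 5 *ᶻ p P i B +ᶻ ξ P i -ᶻ 1ℤ)
    move-balanced {i} {j} {k} d {B} B⊂ a c with dichotomy (+ 5 *ᶻ p P i B +ᶻ ξ P i) 0ℤ
    ... | inj₂ h = h by lem (+ 5 *ᶻ p P i B +ᶻ ξ P i)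
      where lem : ∀ x → x -ᶻ 0ℤ -ᶻ 1ℤ ≡ x -ᶻ 1ℤ
            lem = solve-∀
    ... | inj₁ h = ⊥-elim (unbalanced (recol B j P) (balanced₃ d (recol B j P)
            (h by trans (lem₁ (p P i B) (M P i) (+ 2 *ᶻ m)) (cong (λ r → neg (+ 5 *ᶻ r -ᶻ + 2 *ᶻ m)) (sym (M-from P i≢j B B⊂))))
            (a by trans (lem₂ (q P j B) (M P j) (+ 2 *ᶻ m)) (cong (λ r → neg (+ 5 *ᶻ r -ᶻ + 2 *ᶻ m)) (sym (M-to P i≢j B B⊂))))
            (c by cong (λ r → neg (+ 5 *ᶻ r -ᶻ + 2 *ᶻ m)) (sym (M-other P i≢j B B⊂ (i≢k ∘ sym) (j≢k ∘ sym))))))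
      where
      open Distinct d
      lem₁ : ∀ x a c → 0ℤ -ᶻ (+ 5 *ᶻ x +ᶻ (+ 5 *ᶻ a -ᶻ c)) ≡ neg (+ 5 *ᶻ (a +ᶻ x) -ᶻ c)
      lem₁ = solve-∀
      lem₂ : ∀ x a c → + 5 *ᶻ x -ᶻ (+ 5 *ᶻ a -ᶻ c) ≡ neg (+ 5 *ᶻ (a -ᶻ x) -ᶻ c)
      lem₂ = solve-∀

    -- The loss at the part `i` when `B` and `C` leave it together. It can exceed the sum of the two
    -- separate losses.
    p₂ : Fin 3 → Part → Part → ℤ
    p₂ i B C = ∑ E (λ e → z (ct P i e ∸ (∣ B ∣ᵇ e + ∣ C ∣ᵇ e)) -ᶻ z (ct P i e))

    -- `B` goes to `j` and `C` to `k`. Both receiving parts end up good, so the part `i` that gave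
    -- up both sets must be bad afterwards.
    pair-balanced : ∀ {i j k} → Distinct i j k → ∀ {B C} → B ⊂[ P , i ] → C ⊂[ P , i ] → (∀ v → C v ≡ true → B v ≡ false) →
      NN (+ 5 *ᶻ q P j B -ᶻ ξ P j) → NN (+ 5 *ᶻ q P k C -ᶻ ξ P k) → NN (+ 5 *ᶻ p₂ i B C +ᶻ ξ P i -ᶻ 1ℤ)
    pair-balanced {i} {j} {k} d {B} {C} B⊂ C⊂ disj a c with dichotomy (+ 5 *ᶻ p₂ i B C +ᶻ ξ P i) 0ℤ
    ... | inj₂ h = h by lem (+ 5 *ᶻ p₂ i B C +ᶻ ξ P i)
      where lem : ∀ x → x -ᶻ 0ℤ -ᶻ 1ℤ ≡ x -ᶻ 1ℤ
            lem = solve-∀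
    ... | inj₁ h = ⊥-elim (unbalanced Q (balanced₃ d Q
            (h by trans (lem₁ (p₂ i B C) (M P i) (+ 2 *ᶻ m)) (cong neg′ (sym Mi)))
            (a by trans (lem₂ (q P j B) (M P j) (+ 2 *ᶻ m)) (cong neg′ (sym (trans (M-other P' i≢k C C⊂' (i≢j ∘ sym) j≢k) (M-to P i≢j B B⊂)))))
            (c by trans (lem₂ (q P k C) (M P k) (+ 2 *ᶻ m)) (cong neg′ (sym (trans (M-to P' i≢k C C⊂')
               (cong₂ _-ᶻ_ (∑-cong E (λ e → cong z (ctk e))) (∑-cong E (λ e → cong (λ r → z r -ᶻ z (r + ∣ C ∣ᵇ e)) (ctk e))))))))))
      where
      open Distinct d
      P' = recol B j P
      Q = recol C k P'
      neg′ : ℤ → ℤ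
      neg′ r = neg (+ 5 *ᶻ r -ᶻ + 2 *ᶻ m)
      -- Disjointness keeps `C` in the part `i` while `B` leaves.
      C⊂' : C ⊂[ P' , i ]
      C⊂' v s rewrite disj v s = C⊂ v s
      ctk : ∀ e → ct P' k e ≡ ct P k e
      ctk = ct-other P i≢j B B⊂ (i≢k ∘ sym) (j≢k ∘ sym)
      lem₀ : ∀ x y → x ≡ y +ᶻ (x -ᶻ y)
      lem₀ = solve-∀
      ctQ : ∀ e → ct Q i e ≡ ct P i e ∸ (∣ B ∣ᵇ e + ∣ C ∣ᵇ e)
      ctQ e = sym (trans (cong (λ r → r ∸ (∣ B ∣ᵇ e + ∣ C ∣ᵇ e)) (trans (ct-from P i≢j B B⊂ e) (trans (cong (λ r → r + ∣ B ∣ᵇ e) (ct-from P' i≢k C C⊂' e))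
          (trans (ℕₚ.+-assoc (ct Q i e) (∣ C ∣ᵇ e) (∣ B ∣ᵇ e)) (cong (λ r → ct Q i e + r) (ℕₚ.+-comm (∣ C ∣ᵇ e) (∣ B ∣ᵇ e)))))))
                   (ℕₚ.m+n∸n≡m (ct Q i e) (∣ B ∣ᵇ e + ∣ C ∣ᵇ e)))
      Mi : M Q i ≡ M P i +ᶻ p₂ i B C
      Mi = trans (∑-cong E (λ e → trans (cong z (ctQ e)) (lem₀ (z (ct P i e ∸ (∣ B ∣ᵇ e + ∣ C ∣ᵇ e))) (z (ct P i e))))) (∑-+ E _ _)
      lem₁ : ∀ x a c → 0ℤ -ᶻ (+ 5 *ᶻ x +ᶻ (+ 5 *ᶻ a -ᶻ c)) ≡ neg (+ 5 *ᶻ (a +ᶻ x) -ᶻ c)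
      lem₁ = solve-∀
      lem₂ : ∀ x a c → + 5 *ᶻ x -ᶻ (+ 5 *ᶻ a -ᶻ c) ≡ neg (+ 5 *ᶻ (a -ᶻ x) -ᶻ c)
      lem₂ = solve-∀

    -- `B` goes from `i` to `j` and then `C` from `j` to `k`. The part `i` can spare `B` and `k` is
    -- repaired by `C`, so `j` is bad at the end, even though it gained `B`.
    chain-balanced : ∀ {i j k} → Distinct i j k → ∀ {B C} → B ⊂[ P , i ] → C ⊂[ P , j ] →
      NN (neg (ξ P i +ᶻ + 5 *ᶻ p P i B)) → NN (+ 5 *ᶻ q P k C -ᶻ ξ P k) →
      NN (+ 5 *ᶻ p P j C +ᶻ ξ P j -ᶻ + 5 *ᶻ q P j B -ᶻ 1ℤ)
    chain-balanced {i} {j} {k} d {B} {C} B⊂ C⊂ a c with dichotomy (+ 5 *ᶻ p P j C +ᶻ ξ P j -ᶻ + 5 *ᶻ q P j B) 0ℤ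
    ... | inj₂ h = h by lem (+ 5 *ᶻ p P j C +ᶻ ξ P j -ᶻ + 5 *ᶻ q P j B)
      where lem : ∀ x → x -ᶻ 0ℤ -ᶻ 1ℤ ≡ x -ᶻ 1ℤ
            lem = solve-∀
    ... | inj₁ h = ⊥-elim (unbalanced Q (balanced₃ d Q
            (a by trans (lem₁ (p P i B) (M P i) (+ 2 *ᶻ m)) (cong neg′ (sym (trans (M-other P' j≢k C C⊂' i≢j i≢k) (M-from P i≢j B B⊂)))))
            (h ⊞ 5 ⊡ p-less by trans (lem₃ (p P j C) (q P j B) (M P j) (p P' j C) (+ 2 *ᶻ m)) (cong neg′ (sym (trans (M-from P' j≢k C C⊂') (cong (λ r → r +ᶻ p P' j C) (M-to P i≢j B B⊂))))))
            (c by trans (lem₂ (q P k C) (M P k) (+ 2 *ᶻ m)) (cong neg′ (sym (trans (M-to P' j≢k C C⊂')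
               (cong₂ _-ᶻ_ (∑-cong E (λ e → cong z (ctk e))) (∑-cong E (λ e → cong (λ r → z r -ᶻ z (r + ∣ C ∣ᵇ e)) (ctk e))))))))))
      where
      open Distinct d
      P' = recol B j P
      Q = recol C k P'
      neg′ : ℤ → ℤ
      neg′ r = neg (+ 5 *ᶻ r -ᶻ + 2 *ᶻ m)
      C⊂' : C ⊂[ P' , j ]
      C⊂' v s with B v
      ... | true = refl
      ... | false = C⊂ v s
      ctk : ∀ e → ct P' k e ≡ ct P k e
      ctk = ct-other P i≢j B B⊂ (i≢k ∘ sym) (j≢k ∘ sym)
      pointwise : ∀ a b c → c ≤ a → NN (z (a ∸ c) -ᶻ z a -ᶻ (z (a + b ∸ c) -ᶻ z (a + b)))
      pointwise zero b zero h = NN+ 0 by sym (lem₄ 1ℤ (z b))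
        where lem₄ : ∀ x y → x -ᶻ x -ᶻ (y -ᶻ y) ≡ 0ℤ
              lem₄ = solve-∀
      pointwise (suc a) b c h = z-anti {suc a ∸ c} (ℕₚ.∸-monoˡ-≤ c (ℕₚ.m≤m+n (suc a) b)) by lem₄ (z (suc a ∸ c)) (z (suc a + b ∸ c))
        where lem₄ : ∀ x y → x -ᶻ y ≡ x -ᶻ 0ℤ -ᶻ (y -ᶻ 0ℤ)
              lem₄ = solve-∀
      -- The vertices of `B` that have arrived in `j` can only save edges that the departure of `C`
      -- would otherwise leave without `j`, so the loss computed in the original colouring is an
      -- upper bound.
      p-less : NN (p P j C -ᶻ p P' j C)
      p-less = ∑-mono E _ _ (λ e → subst (λ r → NN (z (ct P j e ∸ ∣ C ∣ᵇ e) -ᶻ z (ct P j e) -ᶻ (z (r ∸ ∣ C ∣ᵇ e) -ᶻ z r)))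
                 (sym (ct-to P i≢j B B⊂ e)) (pointwise (ct P j e) (∣ B ∣ᵇ e) (∣ C ∣ᵇ e) (part≤ct C C⊂ e)))
      lem₁ : ∀ x a c → neg (+ 5 *ᶻ a -ᶻ c +ᶻ + 5 *ᶻ x) ≡ neg (+ 5 *ᶻ (a +ᶻ x) -ᶻ c)
      lem₁ = solve-∀
      lem₂ : ∀ x a c → + 5 *ᶻ x -ᶻ (+ 5 *ᶻ a -ᶻ c) ≡ neg (+ 5 *ᶻ (a -ᶻ x) -ᶻ c)
      lem₂ = solve-∀
      lem₃ : ∀ p q a p' c → 0ℤ -ᶻ (+ 5 *ᶻ p +ᶻ (+ 5 *ᶻ a -ᶻ c) -ᶻ + 5 *ᶻ q) +ᶻ + 5 *ᶻ (p -ᶻ p') ≡ neg (+ 5 *ᶻ (a -ᶻ q +ᶻ p') -ᶻ c)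
      lem₃ = solve-∀

-- Cutting a set into disjoint blocks that each repair a part

module Blocks {n : ℕ} (E : List (Subset n)) (P : Colouring {n}) where
  open Extremal E

  -- An edge newly met through `D` has a vertex in `B` or in `C`. Only a domination of indicators is
  -- assumed, so `B` and `C` may overlap and may be larger than `D`.
  q-sub : ∀ j {B C D : Part {n}} → (∀ v → bit (D v) ≤ bit (B v) + bit (C v)) → NN (q P j B +ᶻ q P j C -ᶻ q P j D)
  q-sub j {B} {C} {D} h = ∑-mono E _ _ point by cong (λ r → r -ᶻ q P j D) (∑-+ E _ _)
    where
    alg : ∀ a x y d → a -ᶻ x +ᶻ (a -ᶻ y) -ᶻ (a -ᶻ d) ≡ a -ᶻ x +ᶻ (d -ᶻ y)
    alg = solve-∀
    key : ∀ c b r d → d ≤ b + r → NN (z c -ᶻ z (c + b) +ᶻ (z c -ᶻ z (c + r)) -ᶻ (z c -ᶻ z (c + d)))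
    key (suc c) b r d le = NN+ 0
    key zero zero r d le = z-anti le by sym (trans (alg 1ℤ 1ℤ (z r) (z d)) (ℤₚ.+-identityˡ _))
    key zero (suc b) zero zero le = NN+ 1
    key zero (suc b) zero (suc d) le = NN+ 0
    key zero (suc b) (suc r) zero le = NN+ 2
    key zero (suc b) (suc r) (suc d) le = NN+ 1
    point : ∀ e → NN (z (ct P j e) -ᶻ z (ct P j e + ∣ B ∣ᵇ e) +ᶻ (z (ct P j e) -ᶻ z (ct P j e + ∣ C ∣ᵇ e)) -ᶻ (z (ct P j e) -ᶻ z (ct P j e + ∣ D ∣ᵇ e)))
    point e = key (ct P j e) _ _ _ (ℕₚ.≤-trans (wt-mono e h) (ℕₚ.≤-reflexive (wt-+ _ _ e)))

  none : ∀ {j} → NN (0ℤ -ᶻ q P j (λ _ → false))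
  none {j} = NN+ 0 by cong (0ℤ -ᶻ_) (sym (trans (∑-cong E zero-term) (trans (∑-const E 0ℤ) (ℤₚ.*-zeroʳ m))))
    where
    zero-term : ∀ e → z (ct P j e) -ᶻ z (ct P j e + ∣ (λ _ → false) ∣ᵇ e) ≡ 0ℤ
    zero-term e rewrite wt-zero e | ℕₚ.+-identityʳ (ct P j e) = ℤₚ.+-inverseʳ (z (ct P j e))

  _∖_ : Part {n} → Part {n} → Part {n}
  (A ∖ B) v = A v ∧ not (B v)

  _⊑_ : Part {n} → Part {n} → Set
  A ⊑ B = ∀ v → A v ≡ true → B v ≡ true

  ∖⊑ : ∀ A B → (A ∖ B) ⊑ A
  ∖⊑ A B v h = proj₁ (∧-true {A v} h)

  ∖-disj : ∀ A B v → (A ∖ B) v ≡ true → B v ≡ false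
  ∖-disj A B v h with A v | B v | h
  ... | _ | false | _ = refl
  ... | true | true | ()
  ... | false | true | ()

  ∖-bit : ∀ {A B} → B ⊑ A → ∀ v → bit (A v) ≡ bit (B v) + bit ((A ∖ B) v)
  ∖-bit {A} {B} h v with A v | B v | h v
  ... | true | true | _ = refl
  ... | true | false | _ = refl
  ... | false | false | _ = refl
  ... | false | true | k = contradiction (k refl) λ ()

  ∖-≤ : ∀ A B v → bit (A v) ≤ bit (B v) + bit ((A ∖ B) v)
  ∖-≤ A B v with A v | B v
  ... | true | true = ℕₚ.≤-refl
  ... | true | false = ℕₚ.≤-refl
  ... | false | _ = z≤n

  -- The intermediate sets of a greedy construction: `W` restricted to a growing list of vertices.
  prefix : Part {n} → List (Fin n) → Part {n}
  prefix W [] v = false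
  prefix W (x ∷ xs) v = (W v ∧ does (x ≟ v)) ∨ prefix W xs v

  prefix⊑ : ∀ W xs → prefix W xs ⊑ W
  prefix⊑ W [] v ()
  prefix⊑ W (x ∷ xs) v h with W v | prefix⊑ W xs v
  ... | true | _ = refl
  ... | false | ih = ih h

  module _ (j : Fin 3) {W : Part {n}} (ξ≥0 : NN (ξ P j)) (small : ∀ v → W v ≡ true → NN (ξ P j -ᶻ + 5 *ᶻ q P j (single v))) where

    -- By subadditivity a new vertex of `W` raises `5q` by no more than its own share, which `small`
    -- bounds by ξ; a vertex outside `W` changes nothing.
    step : ∀ x xs → NN (+ 5 *ᶻ q P j (prefix W xs) +ᶻ ξ P j -ᶻ + 5 *ᶻ q P j (prefix W (x ∷ xs)))
    step x xs = go (W x) refl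
      where
      alg₁ : ∀ a b c x → + 5 *ᶻ (a +ᶻ b -ᶻ c) +ᶻ (x -ᶻ + 5 *ᶻ b) ≡ + 5 *ᶻ a +ᶻ x -ᶻ + 5 *ᶻ c
      alg₁ = solve-∀
      alg₂ : ∀ a b c x → + 5 *ᶻ (a +ᶻ b -ᶻ c) +ᶻ x +ᶻ + 5 *ᶻ (0ℤ -ᶻ b) ≡ + 5 *ᶻ a +ᶻ x -ᶻ + 5 *ᶻ c
      alg₂ = solve-∀
      le₁ : ∀ v → bit (prefix W (x ∷ xs) v) ≤ bit (prefix W xs v) + bit (single x v)
      le₁ v with W v | does (x ≟ v) | prefix W xs v
      ... | true | true | true = s≤s z≤n
      ... | true | true | false = s≤s z≤n
      ... | true | false | b = ℕₚ.m≤m+n (bit b) 0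
      ... | false | c | b = ℕₚ.m≤m+n (bit b) (bit c)
      le₂ : W x ≡ false → ∀ v → bit (prefix W (x ∷ xs) v) ≤ bit (prefix W xs v) + 0
      le₂ eq v with x ≟ v
      ... | yes refl rewrite eq = ℕₚ.m≤m+n _ 0
      ... | no _ with W v
      ...   | true = ℕₚ.m≤m+n _ 0
      ...   | false = ℕₚ.m≤m+n _ 0
      go : ∀ b → W x ≡ b → NN (+ 5 *ᶻ q P j (prefix W xs) +ᶻ ξ P j -ᶻ + 5 *ᶻ q P j (prefix W (x ∷ xs)))
      go true eq = subst NN (alg₁ (q P j (prefix W xs)) (q P j (single x)) (q P j (prefix W (x ∷ xs))) (ξ P j)) (5 ⊡ sub ⊞ small x eq)
        where
        sub : NN (q P j (prefix W xs) +ᶻ q P j (single x) -ᶻ q P j (prefix W (x ∷ xs)))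
        sub = q-sub j {prefix W xs} {single x} {prefix W (x ∷ xs)} le₁
      go false eq = subst NN (alg₂ (q P j (prefix W xs)) (q P j (λ _ → false)) (q P j (prefix W (x ∷ xs))) (ξ P j)) (5 ⊡ sub ⊞ ξ≥0 ⊞ 5 ⊡ none {j})
        where
        sub : NN (q P j (prefix W xs) +ᶻ q P j (λ _ → false) -ᶻ q P j (prefix W (x ∷ xs)))
        sub = q-sub j {prefix W xs} {λ _ → false} {prefix W (x ∷ xs)} (le₂ eq)

    -- The lower bound says that the block repairs `j` by itself; the upper bound limits the waste,
    -- so that several blocks fit into one set.
    Block : Part {n} → Set
    Block B = B ⊑ W × NN (+ 5 *ᶻ q P j B -ᶻ ξ P j) × NN (+ 2 *ᶻ ξ P j -ᶻ + 5 *ᶻ q P j B)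

    -- Adding the vertices one at a time, the first initial segment to reach ξ cannot exceed 2ξ.
    cut : ∀ xs → NN (+ 5 *ᶻ q P j (prefix W xs) -ᶻ ξ P j) → ∃ Block
    cut [] h = prefix W [] , (λ v ()) , h , (2 ⊡ ξ≥0 ⊞ 5 ⊡ none {j} by alg (ξ P j) (q P j (λ _ → false)))
      where
      alg : ∀ x b → + 2 *ᶻ x +ᶻ + 5 *ᶻ (0ℤ -ᶻ b) ≡ + 2 *ᶻ x -ᶻ + 5 *ᶻ b
      alg = solve-∀
    cut (x ∷ xs) h with dichotomy (ξ P j) (+ 5 *ᶻ q P j (prefix W xs))
    ... | inj₁ g = cut xs g
    ... | inj₂ g = prefix W (x ∷ xs) , prefix⊑ W (x ∷ xs) , h , (step x xs ⊞ weaken1 {ξ P j} {+ 5 *ᶻ q P j (prefix W xs)} g by alg (+ 5 *ᶻ q P j (prefix W xs)) (ξ P j) (+ 5 *ᶻ q P j (prefix W (x ∷ xs))))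
      where
      alg : ∀ a x c → a +ᶻ x -ᶻ c +ᶻ (x -ᶻ a) ≡ + 2 *ᶻ x -ᶻ c
      alg = solve-∀

    block : NN (+ 5 *ᶻ q P j W -ᶻ ξ P j) → ∃ Block
    block h = cut (List.allFin n) (h ⊞ 5 ⊡ q-sub j {prefix W (List.allFin n)} {λ _ → false} {W} le ⊞ 5 ⊡ none {j} by alg (q P j W) (ξ P j) (q P j (prefix W (List.allFin n))) (q P j (λ _ → false)))
      where
      open import Data.List.Membership.Propositional using (_∈_)
      open import Data.List.Membership.Propositional.Properties using (∈-allFin)
      open import Data.List.Relation.Unary.Any using (here; there)
      alg : ∀ a x b c → + 5 *ᶻ a -ᶻ x +ᶻ + 5 *ᶻ (b +ᶻ c -ᶻ a) +ᶻ + 5 *ᶻ (0ℤ -ᶻ c) ≡ + 5 *ᶻ b -ᶻ x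
      alg = solve-∀
      full : ∀ xs v → v ∈ xs → W v ≡ true → prefix W xs v ≡ true
      full (x ∷ xs) v (here refl) h with v ≟ v
      ... | yes _ rewrite h = refl
      ... | no ne = contradiction refl ne
      full (x ∷ xs) v (there m) h rewrite full xs v m h with W v ∧ does (x ≟ v)
      ... | true = refl
      ... | false = refl
      le : ∀ v → bit (W v) ≤ bit (prefix W (List.allFin n) v) + 0
      le v with W v in eq
      ... | false = z≤n
      ... | true rewrite full (List.allFin n) v (∈-allFin v) eq = ℕₚ.≤-refl

  -- Each further block is taken from what the earlier ones leave over, so disjointness is built
  -- into the nesting.
  data Disjoint (j : Fin 3) : ℕ → Part {n} → Set where
    [] : ∀ {W} → Disjoint j 0 W
    cons : ∀ {k W} B → B ⊑ W → NN (+ 5 *ᶻ q P j B -ᶻ ξ P j) → Disjoint j k (W ∖ B) → Disjoint j (suc k) W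

  -- A block uses at most 2ξ of the total `5q`, and subadditivity leaves everything else to the
  -- remainder. Thus (1 + 2k)ξ pays for `k` blocks and still has the ξ required for a last one.
  blocks : ∀ k j {W} → NN (ξ P j) → (∀ v → W v ≡ true → NN (ξ P j -ᶻ + 5 *ᶻ q P j (single v))) →
    NN (+ 5 *ᶻ q P j W -ᶻ + (1 + 2 * k) *ᶻ ξ P j) → Disjoint j (suc k) W
  blocks zero j {W} ξ≥0 small h = go (block j ξ≥0 small (h by cong (λ r → + 5 *ᶻ q P j W -ᶻ r) (ℤₚ.*-identityˡ (ξ P j))))
    where
    go : ∃ (Block j ξ≥0 small) → Disjoint j 1 W
    go (B , B⊑ , g , _) = cons B B⊑ g []
  blocks (suc k) j {W} ξ≥0 small h = go (block j ξ≥0 small (h ⊞ (2 * suc k) ⊡ ξ≥0 by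
      trans (cong (λ r → Q -ᶻ r *ᶻ ξ P j +ᶻ K *ᶻ ξ P j) (ℤₚ.pos-+ 1 (2 * suc k))) (alg₁ Q (ξ P j) K)))
    where
    Q K K′ : ℤ
    Q = + 5 *ᶻ q P j W
    K = + (2 * suc k)
    K′ = + (1 + 2 * k)
    alg₁ : ∀ a x c → a -ᶻ (1ℤ +ᶻ c) *ᶻ x +ᶻ c *ᶻ x ≡ a -ᶻ x
    alg₁ = solve-∀
    alg₂ : ∀ a x b d c → + 5 *ᶻ a -ᶻ (+ 2 +ᶻ c) *ᶻ x +ᶻ (+ 2 *ᶻ x -ᶻ + 5 *ᶻ b) +ᶻ + 5 *ᶻ (b +ᶻ d -ᶻ a) ≡ + 5 *ᶻ d -ᶻ c *ᶻ x
    alg₂ = solve-∀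
    K≡ : + (1 + 2 * suc k) ≡ + 2 +ᶻ K′
    K≡ = trans (cong (λ r → + suc r) (ℕₚ.*-suc 2 k)) (ℤₚ.pos-+ 2 (1 + 2 * k))
    go : ∃ (Block j ξ≥0 small) → Disjoint j (suc (suc k)) W
    go (B , B⊑ , g , u) = cons B B⊑ g (blocks k j {W ∖ B} ξ≥0 (λ v s → small v (∖⊑ W B v s)) rest)
      where
      rest : NN (+ 5 *ᶻ q P j (W ∖ B) -ᶻ K′ *ᶻ ξ P j)
      rest = (h by cong (λ r → Q -ᶻ r *ᶻ ξ P j) K≡) ⊞ u ⊞ 5 ⊡ q-sub j {B} {W ∖ B} {W} (∖-≤ W B)
        by alg₂ (q P j W) (ξ P j) (q P j B) (q P j (W ∖ B)) K′

-- Counting the edges inside a vertex set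

full : ∀ {n} → Subset n
full {n} = Vec.replicate n true

-- The link of the first vertex for `true`, and the edges avoiding it for `false`. Cutting off the
-- common first entry keeps distinct edges distinct.
tails : ∀ {n} → Bool → List (Subset (suc n)) → List (Subset n)
tails b [] = []
tails true ((true ∷ e) ∷ E) = e ∷ tails true E
tails true ((false ∷ e) ∷ E) = tails true E
tails false ((true ∷ e) ∷ E) = tails false E
tails false ((false ∷ e) ∷ E) = e ∷ tails false E

tails-length : ∀ {n} (E : List (Subset (suc n))) → length E ≡ length (tails true E) + length (tails false E)
tails-length [] = refl
tails-length ((true ∷ e) ∷ E) = cong suc (tails-length E)
tails-length ((false ∷ e) ∷ E) = trans (cong suc (tails-length E)) (sym (ℕₚ.+-suc _ _))

tails-All : ∀ {n} b {R : Subset (suc n) → Set} {E} → All R E → All (λ e → R (b ∷ e)) (tails b E)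
tails-All b [] = []
tails-All true {E = (true ∷ e) ∷ E} (r ∷ rs) = r ∷ tails-All true rs
tails-All true {E = (false ∷ e) ∷ E} (r ∷ rs) = tails-All true rs
tails-All false {E = (true ∷ e) ∷ E} (r ∷ rs) = tails-All false rs
tails-All false {E = (false ∷ e) ∷ E} (r ∷ rs) = r ∷ tails-All false rs

tails-Unique : ∀ {n} b {E : List (Subset (suc n))} → Unique E → Unique (tails b E)
tails-Unique b [] = []
tails-Unique true {(true ∷ e) ∷ E} (r ∷ u) = All.map (λ ne eq → ne (cong (true ∷_) eq)) (tails-All true r) ∷ tails-Unique true u
tails-Unique true {(false ∷ e) ∷ E} (r ∷ u) = tails-Unique true u
tails-Unique false {(true ∷ e) ∷ E} (r ∷ u) = tails-Unique false u
tails-Unique false {(false ∷ e) ∷ E} (r ∷ u) = All.map (λ ne eq → ne (cong (false ∷_) eq)) (tails-All false r) ∷ tails-Unique false u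

empty-if : ∀ {A : Set} {R : A → Set} {xs} → All R xs → (∀ x → ¬ R x) → length xs ≡ 0
empty-if [] h = refl
empty-if {xs = x ∷ xs} (r ∷ rs) h = contradiction r (h x)

wt≤size : ∀ {n} (D : Part {n}) e → ∣ D ∣ᵇ e ≤ ∣ e ∣
wt≤size D [] = z≤n
wt≤size D (false ∷ e) = wt≤size (D ∘ suc) e
wt≤size D (true ∷ e) with D zero
... | true = s≤s (wt≤size (D ∘ suc) e)
... | false = ℕₚ.m≤n⇒m≤1+n (wt≤size (D ∘ suc) e)

-- Induction on the vertices with Pascal's rule: if the first vertex is in `D`, its link and the
-- edges avoiding it contribute the two terms. That an edge lies inside `D` is expressed by the
-- equality of the two counts.
subsets-bound : ∀ {n} (D : Part {n}) k (E : List (Subset n)) → Unique E → All (λ e → ∣ e ∣ ≡ k × ∣ D ∣ᵇ e ≡ k) E →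
  length E ≤ ∣ D ∣ᵇ full choose k
subsets-bound {zero} D k [] u a = z≤n
subsets-bound {zero} D zero ([] ∷ []) u a = s≤s z≤n
subsets-bound {zero} D zero ([] ∷ [] ∷ E) ((ne ∷ _) ∷ u) a = contradiction refl ne
subsets-bound {zero} D (suc k) ([] ∷ E) u ((() , _) ∷ a)
subsets-bound {suc n} D k E u a with D zero in eq
subsets-bound {suc n} D k E u a | false = ℕₚ.≤-trans (ℕₚ.≤-reflexive (trans (tails-length E) (cong (λ r → r + length (tails false E)) no-true)))
  (subsets-bound (D ∘ suc) k (tails false E) (tails-Unique false u) (tails-All false a))
  where
  -- An edge through a vertex outside `D` would have fewer than `k` vertices in `D`.
  no-true : length (tails true E) ≡ 0
  no-true = empty-if (tails-All true a) λ e (p , q) → ℕₚ.1+n≰n (ℕₚ.≤-trans (ℕₚ.≤-reflexive (trans p (sym (trans (cong (λ b → bit b + ∣ D ∘ suc ∣ᵇ e) (sym eq)) q)))) (wt≤size (D ∘ suc) e))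
subsets-bound {suc n} D zero E u a | true = ℕₚ.≤-trans (ℕₚ.≤-reflexive (trans (tails-length E) (cong (λ r → r + length (tails false E)) no-true)))
  (subsets-bound (D ∘ suc) zero (tails false E) (tails-Unique false u) (tails-All false a))
  where
  no-true : length (tails true E) ≡ 0
  no-true = empty-if (tails-All true a) λ { e (() , _) }
subsets-bound {suc n} D (suc k) E u a | true = ℕₚ.≤-trans (ℕₚ.≤-reflexive (tails-length E))
  (ℕₚ.≤-trans (ℕₚ.+-mono-≤
     (subsets-bound (D ∘ suc) k (tails true E) (tails-Unique true u)
       (All.map (λ {e} (p , q) → ℕₚ.suc-injective p , ℕₚ.suc-injective (trans (cong (λ b → bit b + ∣ D ∘ suc ∣ᵇ e) (sym eq)) q)) (tails-All true a)))
     (subsets-bound (D ∘ suc) (suc k) (tails false E) (tails-Unique false u) (tails-All false a)))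
   (ℕₚ.≤-reflexive (Comb.nCk+nC[k+1]≡[n+1]C[k+1] (∣ D ∘ suc ∣ᵇ full) k)))

-- For a triple the truncated difference vanishes exactly when the triple lies inside `D`, so the
-- sum counts a filtered list, which inherits distinctness.
inside-bound : ∀ {n} (D : Part {n}) (E : List (Subset n)) → Unique E → All (λ e → ∣ e ∣ ≡ 3) E →
  NN (+ (∣ D ∣ᵇ full choose 3) -ᶻ ∑ E (λ e → z (3 ∸ ∣ D ∣ᵇ e)))
inside-bound D E u a = ≤⇒NN (subst (_≤ᶻ + (∣ D ∣ᵇ full choose 3)) (sym (count E a))
  (+≤+ (subsets-bound D 3 (filter D? E) (filter⁺ D? u) (All.zip (Allₚ.filter⁺ D? a , Allₚ.all-filter D? E)))))
  where
  open import Data.List.Relation.Unary.Unique.Propositional.Properties using (filter⁺)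
  import Data.List.Relation.Unary.All.Properties as Allₚ
  D? : ∀ e → Dec (∣ D ∣ᵇ e ≡ 3)
  D? e = ∣ D ∣ᵇ e ℕₚ.≟ 3
  lt : ∀ {k} → k ≤ 3 → ¬ k ≡ 3 → z (3 ∸ k) ≡ 0ℤ
  lt {zero} h ne = refl
  lt {suc zero} h ne = refl
  lt {suc (suc zero)} h ne = refl
  lt {suc (suc (suc zero))} h ne = contradiction refl ne
  lt {suc (suc (suc (suc k)))} (s≤s (s≤s (s≤s ()))) ne
  count : ∀ E → All (λ e → ∣ e ∣ ≡ 3) E → ∑ E (λ e → z (3 ∸ ∣ D ∣ᵇ e)) ≡ + length (filter D? E)
  count [] a = refl
  count (e ∷ E) (p ∷ a) = step (D? e)
    where
    step : Dec (∣ D ∣ᵇ e ≡ 3) → z (3 ∸ ∣ D ∣ᵇ e) +ᶻ ∑ E (λ e → z (3 ∸ ∣ D ∣ᵇ e)) ≡ + length (filter D? (e ∷ E))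
    step (yes h) = trans (cong₂ (λ k r → z (3 ∸ k) +ᶻ r) h (count E a)) (cong (λ r → + length r) (sym (Listₚ.filter-accept D? {x = e} {xs = E} h)))
    step (no h) = trans (cong₂ _+ᶻ_ (lt (subst (∣ D ∣ᵇ e ≤_) p (wt≤size D e)) h) (count E a))
                 (trans (ℤₚ.+-identityˡ _) (cong (λ r → + length r) (sym (Listₚ.filter-reject D? {x = e} {xs = E} h))))

wt≤full : ∀ {n} (φ : Fin n → ℕ) e → wt φ e ≤ wt φ full
wt≤full φ [] = z≤n
wt≤full φ (true ∷ e) = ℕₚ.+-monoʳ-≤ (φ zero) (wt≤full (φ ∘ suc) e)
wt≤full φ (false ∷ e) = ℕₚ.≤-trans (wt≤full (φ ∘ suc) e) (ℕₚ.m≤n+m _ (φ zero))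

-- Types of edges and the finite check over them

dot : ∀ {c} → (Fin c → ℕ) → Vec ℕ c → ℕ
dot f [] = 0
dot f (x ∷ t) = f zero * x + dot (f ∘ suc) t

dot-cong : ∀ {c} (f : Fin c → ℕ) {g h : Fin c → ℕ} → (∀ j → g j ≡ h j) → dot f (tabulate g) ≡ dot f (tabulate h)
dot-cong {zero} f e = refl
dot-cong {suc c} f e = cong₂ (λ x y → f zero * x + y) (e zero) (dot-cong (f ∘ suc) (e ∘ suc))

dot-+ : ∀ {c} (f g h : Fin c → ℕ) → dot f (tabulate (λ j → g j + h j)) ≡ dot f (tabulate g) + dot f (tabulate h)
dot-+ {zero} f g h = refl
dot-+ {suc c} f g h = trans (cong (λ r → f zero * (g zero + h zero) + r) (dot-+ (f ∘ suc) (g ∘ suc) (h ∘ suc)))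
  (lem (f zero) (g zero) (h zero) (dot (f ∘ suc) (tabulate (g ∘ suc))) (dot (f ∘ suc) (tabulate (h ∘ suc))))
  where lem : ∀ a b c d e → a * (b + c) + (d + e) ≡ a * b + d + (a * c + e)
        lem = ℕR.solve-∀

dot-0 : ∀ {c} (f : Fin c → ℕ) → dot f (tabulate (λ _ → 0)) ≡ 0
dot-0 {zero} f = refl
dot-0 {suc c} f = cong₂ _+_ (ℕₚ.*-zeroʳ (f zero)) (dot-0 (f ∘ suc))

dot-δ : ∀ {c} (f : Fin c → ℕ) x → dot f (tabulate (δ x)) ≡ f x
dot-δ f zero = trans (cong₂ _+_ (ℕₚ.*-identityʳ (f zero)) (dot-0 (f ∘ suc))) (ℕₚ.+-identityʳ _)
dot-δ f (suc x) = trans (cong₂ _+_ (ℕₚ.*-zeroʳ (f zero)) (dot-δ (f ∘ suc) x)) refl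

class : ∀ {n c} → (Fin n → Fin c) → Fin c → Part {n}
class cl j v = does (cl v ≟ j)

κ : ∀ {n c} → (Fin n → Fin c) → Subset n → Vec ℕ c
κ cl e = tabulate (λ j → ∣ class cl j ∣ᵇ e)

bit-≟ : ∀ {c} (x j : Fin c) → bit (does (x ≟ j)) ≡ δ x j
bit-≟ x j with x ≟ j
... | yes refl = sym (δ-refl x)
... | no p = sym (δ-≢ p)

-- Weights that are constant on classes can be read off from the type alone; this is what lets a sum
-- over edges be checked type by type.
dot-κ : ∀ {n c} (cl : Fin n → Fin c) (f : Fin c → ℕ) e → dot f (κ cl e) ≡ wt (f ∘ cl) e
dot-κ cl f [] = dot-0 f
dot-κ cl f (false ∷ e) = dot-κ (cl ∘ suc) f e
dot-κ cl f (true ∷ e) = trans (dot-+ f (λ j → bit (class cl j zero)) (λ j → ∣ class (cl ∘ suc) j ∣ᵇ e))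
  (cong₂ _+_ (trans (dot-cong f (bit-≟ (cl zero))) (dot-δ f (cl zero))) (dot-κ (cl ∘ suc) f e))

below : ℕ → (ℕ → Bool) → Bool
below zero f = f 0
below (suc b) f = f (suc b) ∧ below b f

below-sound : ∀ b f → below b f ≡ true → ∀ {a} → a ≤ b → f a ≡ true
below-sound zero f h z≤n = h
below-sound (suc b) f h {a} le with ℕₚ.m≤n⇒m<n∨m≡n le
... | inj₂ refl = proj₁ (∧-true h)
... | inj₁ (s≤s lt) = below-sound b f (proj₂ (∧-true {f (suc b)} h)) lt

forTypes : ∀ {c} → Vec ℕ c → ℕ → (Vec ℕ c → Bool) → Bool
forTypes [] zero f = f []
-- Vertices are left over but no class is: no edge has such a type, and there is nothing to check.
forTypes [] (suc k) f = true
forTypes (u ∷ us) k f = below (u ⊓ k) (λ a → forTypes us (k ∸ a) (λ t → f (a ∷ t)))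

forTypes-sound : ∀ {c} (us : Vec ℕ c) k f → forTypes us k f ≡ true → ∀ t → (∀ j → lookup t j ≤ lookup us j) → dot (λ _ → 1) t ≡ k → f t ≡ true
forTypes-sound [] zero f h [] le e = h
forTypes-sound (u ∷ us) k f h (a ∷ t) le e = forTypes-sound us (k ∸ a) (λ t → f (a ∷ t))
  (below-sound (u ⊓ k) _ h (ℕₚ.⊓-glb (le zero) (subst (a ≤_) e′ (ℕₚ.m≤m+n a _)))) t (le ∘ suc)
  (sym (trans (cong (_∸ a) (sym e′)) (ℕₚ.m+n∸m≡n a _)))
  where e′ : a + dot (λ _ → 1) t ≡ k
        e′ = trans (cong (λ r → r + dot (λ _ → 1) t) (sym (ℕₚ.*-identityˡ a))) e

nonPos : ℤ → Bool
nonPos (+ zero) = true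
nonPos (+ suc _) = false
nonPos -[1+ _ ] = true

nonPos-sound : ∀ {x} → nonPos x ≡ true → NN (0ℤ -ᶻ x)
nonPos-sound {+ zero} h = NN+ 0
nonPos-sound { -[1+ k ]} h = NN+ (suc k)

-- What is known of the size of each class: it equals the number if the flag is `true`, and is at
-- least the number otherwise.
State : ℕ → Set
State c = Vec (ℕ × Bool) c

Feature : ℕ → Set
Feature c = Vec ℕ c → ℤ

-- A leaf holds the multipliers of the available inequalities and those of the inside bounds for
-- chosen unions of classes. A `branch` asks whether a class has exactly its current lower bound or
-- more; a `dich` splits on a proven alternative.
data Tree (c : ℕ) : Set where
  leaf : List ℕ → List (ℕ × Vec Bool c) → Tree c
  branch : Fin c → Tree c → Tree c → Tree c
  dich : ℕ → Tree c → Tree c → Tree c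

total : ∀ {c} → State c → Vec Bool c → ℕ × Bool
total [] [] = 0 , true
total ((k , ex) ∷ st) (true ∷ f) with total st f
... | r , ok = k + r , ex ∧ ok
total (_ ∷ st) (false ∷ f) = total st f

-- Summed over the edges this is m(N choose 3) minus 211 times the number of edges inside the union.
-- It is nonnegative because that number is at most N choose 3 and m is at least 211.
insideF : ∀ {c} → State c → Vec Bool c → Feature c
insideF st f with total st f
... | N , true = λ t → + (N choose 3) -ᶻ + 211 *ᶻ z (3 ∸ dot (bit ∘ lookup f) t)
-- When some size in the union is only bounded below, there is no N to use, and the feature is made
-- neutral.
... | N , false = λ t → 0ℤ

combine : ∀ {c} → List ℕ → List (Feature c) → Feature c
combine [] fs t = 0ℤ
combine (k ∷ ks) [] t = 0ℤ
combine (zero ∷ ks) (f ∷ fs) t = combine ks fs t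
combine (suc k ∷ ks) (f ∷ fs) t = + suc k *ᶻ f t +ᶻ combine ks fs t

combineI : ∀ {c} → State c → List (ℕ × Vec Bool c) → Feature c
combineI st [] t = 0ℤ
combineI st ((k , f) ∷ fs) t = + k *ᶻ insideF st f t +ᶻ combineI st fs t

-- An edge meets a class in no more vertices than the class has, if that is known, and in at most
-- three in any case.
bounds : ∀ {c} → State c → Vec ℕ c
bounds = Vec.map (λ (k , ex) → if ex then k else 3)

-- Soundness of the certificates

module Certificate {n} (E : List (Subset n)) (uniform : All (λ e → ∣ e ∣ ≡ 3) E) (unique : Unique E) (large : 211 ≤ length E)
  {c} (cl : Fin n → Fin c) where

  S : Feature c → ℤ
  S F = ∑ E (λ e → F (κ cl e))

  Holds : Feature c → Set
  Holds F = NN (S F)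

  size : Fin c → ℕ
  size j = ∣ class cl j ∣ᵇ full

  SatAt : ℕ × Bool → ℕ → Set
  SatAt (k , true) s = s ≡ k
  SatAt (k , false) s = k ≤ s

  Sat : State c → Set
  Sat st = ∀ j → SatAt (lookup st j) (size j)

  start-sat : Sat (Vec.replicate c (0 , false))
  start-sat j = subst (λ kx → SatAt kx (size j)) (sym (Vecₚ.lookup-replicate j (0 , false))) z≤n

  SatAt-≤ : ∀ kx {s} → SatAt kx s → proj₁ kx ≤ s
  SatAt-≤ (k , true) h = ℕₚ.≤-reflexive (sym h)
  SatAt-≤ (k , false) h = h

  total-sound : ∀ {d} (st : State d) (f : Vec Bool d) (g : Fin d → ℕ) → (∀ j → SatAt (lookup st j) (g j)) →
    proj₂ (total st f) ≡ true → dot (bit ∘ lookup f) (tabulate g) ≡ proj₁ (total st f)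
  total-sound [] [] g h ok = refl
  total-sound ((k , true) ∷ st) (true ∷ f) g h ok = cong₂ _+_ (trans (ℕₚ.*-identityˡ (g zero)) (h zero)) (total-sound st f (g ∘ suc) (h ∘ suc) ok)
  total-sound (_ ∷ st) (false ∷ f) g h ok = total-sound st f (g ∘ suc) (h ∘ suc) ok

  inside-holds : ∀ st f → Sat st → Holds (insideF st f)
  inside-holds st f sat with total st f | total-sound st f size sat
  ... | N , false | _ = ∑-NN E _ (λ _ → NN+ 0)
  ... | N , true | h = NN-prod (≤⇒NN (+≤+ large)) (NN+ (N choose 3)) ⊞ 211 ⊡ bound by
        trans (alg (+ length E) (+ (N choose 3)) I (+ 211)) (sym (trans (∑-- E _ _) (cong₂ _-ᶻ_ (∑-const E _) (∑-* E (+ 211) _))))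
    where
    D : Part
    D v = lookup f (cl v)
    I = ∑ E (λ e → z (3 ∸ dot (bit ∘ lookup f) (κ cl e)))
    bound : NN (+ (N choose 3) -ᶻ I)
    bound = inside-bound D E unique uniform by cong₂ (λ r s → + (r choose 3) -ᶻ s) (trans (sym (dot-κ cl (bit ∘ lookup f) full)) (h refl))
      (∑-cong E (λ e → cong (λ r → z (3 ∸ r)) (sym (dot-κ cl (bit ∘ lookup f) e))))
    alg : ∀ l N I k → (l -ᶻ k) *ᶻ N +ᶻ k *ᶻ (N -ᶻ I) ≡ l *ᶻ N -ᶻ k *ᶻ I
    alg = solve-∀

  combine-holds : ∀ ks fs → All Holds fs → Holds (combine ks fs)
  combine-holds [] fs h = ∑-NN E _ (λ _ → NN+ 0)
  combine-holds (k ∷ ks) [] h = ∑-NN E _ (λ _ → NN+ 0)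
  combine-holds (zero ∷ ks) (f ∷ fs) (p ∷ h) = combine-holds ks fs h
  combine-holds (suc k ∷ ks) (f ∷ fs) (p ∷ h) = suc k ⊡ p ⊞ combine-holds ks fs h
    by sym (trans (∑-+ E _ _) (cong (_+ᶻ S (combine ks fs)) (∑-* E (+ suc k) _)))

  combineI-holds : ∀ st fs → Sat st → Holds (combineI st fs)
  combineI-holds st [] h = ∑-NN E _ (λ _ → NN+ 0)
  combineI-holds st ((k , f) ∷ fs) h = k ⊡ inside-holds st f h ⊞ combineI-holds st fs h
    by sym (trans (∑-+ E _ _) (cong (_+ᶻ S (combineI st fs)) (∑-* E (+ k) _)))

  import Data.List.Relation.Unary.All.Properties as Allₚ

  module Search (base : State c → List (Feature c)) (base-holds : ∀ st → Sat st → All Holds (base st))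
    (alt : ℕ → State c → List (Feature c) × List (Feature c))
    (alt-holds : ∀ i st → Sat st → All Holds (proj₁ (alt i st)) ⊎ All Holds (proj₂ (alt i st)))
    (goal : Feature c) (goal-holds : NN (S goal -ᶻ 1ℤ)) where

    check : State c → List (Feature c) → Tree c → Bool
    -- The multipliers `ks` go first to the alternatives chosen along the path, the latest ahead,
    -- and then to the basic inequalities.
    check st fs (leaf ks is) = forTypes (bounds st) 3 (λ t → nonPos (goal t +ᶻ (combine ks (fs List.++ base st) t +ᶻ combineI st is t)))
    check st fs (branch j l r) = check (st Vec.[ j ]≔ (proj₁ (lookup st j) , true)) fs l ∧ check (st Vec.[ j ]≔ (suc (proj₁ (lookup st j)) , false)) fs r
    check st fs (dich i l r) = check st (proj₁ (alt i st) List.++ fs) l ∧ check st (proj₂ (alt i st) List.++ fs) r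

    κ-bounds : ∀ st → Sat st → ∀ e → ∣ e ∣ ≡ 3 → ∀ j → lookup (κ cl e) j ≤ lookup (bounds st) j
    κ-bounds st sat e h j rewrite Vecₚ.lookup∘tabulate (λ j → ∣ class cl j ∣ᵇ e) j | Vecₚ.lookup-map j (λ (k , ex) → if ex then k else 3) st
      with lookup st j | sat j
    ... | k , true | s = subst (∣ class cl j ∣ᵇ e ≤_) s (wt≤full (bit ∘ class cl j) e)
    ... | k , false | s = subst (∣ class cl j ∣ᵇ e ≤_) h (wt≤size (class cl j) e)

    update : ∀ st j kx → Sat st → SatAt kx (size j) → Sat (st Vec.[ j ]≔ kx)
    update st j kx sat h l with l ≟ j
    ... | yes refl rewrite Vecₚ.lookup∘updateAt l {λ _ → kx} st = h
    ... | no ne rewrite Vecₚ.lookup∘updateAt′ l j {λ _ → kx} ne st = sat l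

    -- At a leaf the goal sums to at least 1 and the combination to at least 0, although their sum
    -- is nonpositive on every type. Inequalities collected in `fs` survive later refinements of the
    -- state, since `Holds` speaks of the actual edges and not of the state.
    sound : ∀ st fs T → check st fs T ≡ true → Sat st → All Holds fs → ⊥
    sound st fs (leaf ks is) ch sat h = absurd (goal-holds ⊞ rest-holds ⊞ below0 E uniform by trans
      (cong (λ r → S goal -ᶻ 1ℤ +ᶻ S rest +ᶻ (0ℤ -ᶻ r)) (∑-+ E (λ e → goal (κ cl e)) (λ e → rest (κ cl e)))) (alg (S goal) (S rest)))
      where
      f₁ f₂ rest tot : Feature c
      f₁ = combine ks (fs List.++ base st)
      f₂ = combineI st is
      rest t = f₁ t +ᶻ f₂ t
      tot t = goal t +ᶻ rest t
      rest-holds : Holds rest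
      rest-holds = combine-holds ks (fs List.++ base st) (Allₚ.++⁺ h (base-holds st sat)) ⊞ combineI-holds st is sat
        by sym (∑-+ E (λ e → f₁ (κ cl e)) (λ e → f₂ (κ cl e)))
      alg : ∀ g r → g -ᶻ 1ℤ +ᶻ r +ᶻ (0ℤ -ᶻ (g +ᶻ r)) ≡ -[1+ 0 ]
      alg = solve-∀
      absurd : NN -[1+ 0 ] → ⊥
      absurd ()
      below0 : ∀ E → All (λ e → ∣ e ∣ ≡ 3) E → NN (0ℤ -ᶻ ∑ E (λ e → tot (κ cl e)))
      below0 [] u = NN+ 0
      below0 (e ∷ E) (p ∷ u) = nonPos-sound (forTypes-sound (bounds st) 3 (λ t → nonPos (tot t)) ch (κ cl e) (κ-bounds st sat e p)
          (trans (dot-κ cl (λ _ → 1) e) (trans (wt-one e) p))) ⊞ below0 E u by alg′ (tot (κ cl e)) (∑ E (λ e → tot (κ cl e)))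
        where alg′ : ∀ a b → 0ℤ -ᶻ a +ᶻ (0ℤ -ᶻ b) ≡ 0ℤ -ᶻ (a +ᶻ b)
              alg′ = solve-∀
    sound st fs (branch j l r) ch sat h = go (lookup st j) refl (sat j)
      where
      both = ∧-true {check (st Vec.[ j ]≔ (proj₁ (lookup st j) , true)) fs l} ch
      left : size j ≡ proj₁ (lookup st j) → ⊥
      left e = sound (st Vec.[ j ]≔ (proj₁ (lookup st j) , true)) fs l (proj₁ both) (update st j (proj₁ (lookup st j) , true) sat e) h
      right : proj₁ (lookup st j) < size j → ⊥
      right e = sound (st Vec.[ j ]≔ (suc (proj₁ (lookup st j)) , false)) fs r (proj₂ both) (update st j (suc (proj₁ (lookup st j)) , false) sat e) h
      go : ∀ kx → lookup st j ≡ kx → SatAt kx (size j) → ⊥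
      go (k , true) eq s = left (trans s (cong proj₁ (sym eq)))
      go (k , false) eq s with ℕₚ.m≤n⇒m<n∨m≡n s
      ... | inj₁ lt = right (subst (λ r → proj₁ r < size j) (sym eq) lt)
      ... | inj₂ e = left (trans (sym e) (cong proj₁ (sym eq)))
    sound st fs (dich i l r) ch sat h = go (alt-holds i st sat)
      where
      both = ∧-true {check st (proj₁ (alt i st) List.++ fs) l} ch
      go : All Holds (proj₁ (alt i st)) ⊎ All Holds (proj₂ (alt i st)) → ⊥
      go (inj₁ g) = sound st (proj₁ (alt i st) List.++ fs) l (proj₁ both) sat (Allₚ.++⁺ g h)
      go (inj₂ g) = sound st (proj₂ (alt i st) List.++ fs) r (proj₂ both) sat (Allₚ.++⁺ g h)

-- Double counting of incidences

w₂ : ℕ → ℤ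
w₂ a = z (a ∸ 2) -ᶻ z a

w₂-NN : ∀ a → NN (w₂ a)
w₂-NN a = z-anti (ℕₚ.m∸n≤m a 2)

inc≤1 : ∀ {n} (v : Fin n) e → inc v e ≤ 1
inc≤1 v e with lookup e v
... | true = ℕₚ.≤-refl
... | false = z≤n

size-∑ᵛ : ∀ {n} (U : Part {n}) → + ∣ U ∣ᵇ full ≡ ∑ᵛ (λ v → + bit (U v))
size-∑ᵛ U = trans (wt-∑ᵛ (bit ∘ U) full) (∑ᵛ-cong λ v → trans (cong (λ b → + bit (U v) *ᶻ + (if b then 1 else 0)) (Vecₚ.lookup-replicate v true)) (ℤₚ.*-identityʳ _))

-- Class sizes are mostly known only from below. Passing to a subset of exactly `k` vertices makes
-- the factors in a sum over the class explicit numbers.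
pick : ∀ {n} (D : Part {n}) k → k ≤ ∣ D ∣ᵇ full → ∃ λ (U : Part {n}) → (∀ v → U v ≡ true → D v ≡ true) × ∣ U ∣ᵇ full ≡ k
pick {n} D zero h = (λ _ → false) , (λ v ()) , wt-zero (full {n})
pick {suc n} D (suc k) h with D zero in eq
... | false with pick (D ∘ suc) (suc k) h
...   | U , a , b = (λ { zero → false ; (suc v) → U v }) , (λ { (suc v) p → a v p }) , b
pick {suc n} D (suc k) (s≤s h) | true with pick (D ∘ suc) k h
...   | U , a , b = (λ { zero → true ; (suc v) → U v }) , (λ { zero p → eq ; (suc v) p → a v p }) , cong suc b

module Counting {n : ℕ} (E : List (Subset n)) where

  -- Double counting of the incidences between the vertices of U and the edges.
  csum : ∀ (U : Part {n}) (g : Subset n → ℤ) α → (∀ u → U u ≡ true → NN (α +ᶻ ∑ E (λ e → g e *ᶻ + inc u e))) →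
    NN (+ ∣ U ∣ᵇ full *ᶻ α +ᶻ ∑ E (λ e → g e *ᶻ + ∣ U ∣ᵇ e))
  csum U g α h = ∑ᵛ-NN term by trans (∑ᵛ-cong (λ u → ℤₚ.*-distribˡ-+ (+ bit (U u)) α (G u)))
      (trans (∑ᵛ-+ (λ u → + bit (U u) *ᶻ α) (λ u → + bit (U u) *ᶻ G u)) (cong₂ _+ᶻ_ left right))
    where
    G : Fin n → ℤ
    G u = ∑ E (λ e → g e *ᶻ + inc u e)
    term : ∀ u → NN (+ bit (U u) *ᶻ (α +ᶻ G u))
    term u with U u | h u
    ... | true | k = 1 ⊡ k refl
    ... | false | k = NN+ 0
    left : ∑ᵛ (λ u → + bit (U u) *ᶻ α) ≡ + ∣ U ∣ᵇ full *ᶻ α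
    left = trans (∑ᵛ-cong (λ u → ℤₚ.*-comm (+ bit (U u)) α)) (trans (∑ᵛ-* α (λ v → + bit (U v))) (trans (cong (α *ᶻ_) (sym (size-∑ᵛ U))) (ℤₚ.*-comm α (+ ∣ U ∣ᵇ full))))
    comm : ∀ a b c → a *ᶻ (b *ᶻ c) ≡ b *ᶻ (a *ᶻ c)
    comm = solve-∀
    right : ∑ᵛ (λ u → + bit (U u) *ᶻ G u) ≡ ∑ E (λ e → g e *ᶻ + ∣ U ∣ᵇ e)
    right = trans (∑ᵛ-cong (λ u → sym (∑-* E (+ bit (U u)) (λ e → g e *ᶻ + inc u e)))) (trans (∑ᵛ-∑ E (λ u e → + bit (U u) *ᶻ (g e *ᶻ + inc u e)))
      (∑-cong E (λ e → trans (∑ᵛ-cong (λ u → comm (+ bit (U u)) (g e) (+ inc u e)))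
        (trans (∑ᵛ-* (g e) (λ v → + bit (U v) *ᶻ + inc v e)) (cong (g e *ᶻ_) (sym (wt-∑ᵛ (bit ∘ U) e)))))))

  ∑-lin : ∀ (a b : ℤ) (f g : Subset n → ℤ) → ∑ E (λ e → a *ᶻ f e +ᶻ b *ᶻ g e) ≡ a *ᶻ ∑ E f +ᶻ b *ᶻ ∑ E g
  ∑-lin a b f g = trans (∑-+ E (λ e → a *ᶻ f e) (λ e → b *ᶻ g e)) (cong₂ _+ᶻ_ (∑-* E a f) (∑-* E b g))

-- Inequalities summed over one class

module Facts {n} (E : List (Subset n)) (uniform : All (λ e → ∣ e ∣ ≡ 3) E) (unique : Unique E) (large : 211 ≤ length E)
  {P : Colouring {n}} (opt : Extremal.Optimal E P) {c} (cl : Fin n → Fin c) (part : Fin c → Fin 3) (P≡ : ∀ v → P v ≡ part (cl v)) where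
  open Extremal E
  open Moves opt
  open Blocks E P
  open Counting E
  open Certificate E uniform unique large cl

  pc : Fin 3 → Vec ℕ c → ℕ
  pc i = dot (λ j → δ (part j) i)

  pc-κ : ∀ i e → pc i (κ cl e) ≡ ct P i e
  pc-κ i e = trans (dot-κ cl (λ j → δ (part j) i) e) (wt-cong e (λ v → cong (λ x → δ x i) (sym (P≡ v))))

  -- The first three are indicators on types: the edge misses part `i`, meets it in exactly one
  -- vertex, or in one or two. In `ξᶠ` the term 2m is spread evenly over the edges.
  μ ω ω₂ ξᶠ : Fin 3 → Feature c
  μ i t = z (pc i t)
  ω i t = w (pc i t)
  ω₂ i t = w₂ (pc i t)
  ξᶠ i t = + 5 *ᶻ μ i t -ᶻ + 2

  S-ξ : ∀ i → S (ξᶠ i) ≡ ξ P i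
  S-ξ i = trans (∑-- E (λ e → + 5 *ᶻ μ i (κ cl e)) (λ _ → + 2)) (cong₂ _-ᶻ_
    (trans (∑-* E (+ 5) (λ e → μ i (κ cl e))) (cong (+ 5 *ᶻ_) (∑-cong E (λ e → cong z (pc-κ i e))))) (trans (∑-const E (+ 2)) (ℤₚ.*-comm m (+ 2))))

  count : ∀ j e → lookup (κ cl e) j ≡ ∣ class cl j ∣ᵇ e
  count j e = Vecₚ.lookup∘tabulate _ j

  class-≡ : ∀ {j v} → class cl j v ≡ true → cl v ≡ j
  class-≡ {j} {v} h with cl v ≟ j
  class-≡ {j} {v} h | yes p = p

  class-P : ∀ {j v} → class cl j v ≡ true → P v ≡ part j
  class-P h = trans (P≡ _) (cong part (class-≡ h))

  single-P : ∀ {j v} → class cl j v ≡ true → single v ⊂[ P , part j ]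
  single-P h = single⊂ {P = P} (class-P h)

  -- The departure of one vertex affects only the edges through it, and of these only those with no
  -- other vertex in the part; hence the loss is linear in the incidences of `v`.
  p-inc : ∀ i v → p P i (single v) ≡ ∑ E (λ e → ω i (κ cl e) *ᶻ + inc v e)
  p-inc i v = ∑-cong E (λ e → trans (cong (λ b → z (ct P i e ∸ b) -ᶻ z (ct P i e)) (single-wt v e))
    (trans (key (ct P i e) (inc≤1 v e)) (cong (λ a → w a *ᶻ + inc v e) (sym (pc-κ i e)))))
    where
    key : ∀ a {b} → b ≤ 1 → z (a ∸ b) -ᶻ z a ≡ w a *ᶻ + b
    key a {zero} h = trans (ℤₚ.+-inverseʳ (z a)) (sym (ℤₚ.*-zeroʳ (w a)))
    key a {suc zero} h = sym (ℤₚ.*-identityʳ (w a))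
    key a {suc (suc b)} (s≤s ())

  q-inc : ∀ i v → q P i (single v) ≡ ∑ E (λ e → μ i (κ cl e) *ᶻ + inc v e)
  q-inc i v = ∑-cong E (λ e → trans (cong (λ b → z (ct P i e) -ᶻ z (ct P i e + b)) (single-wt v e))
    (trans (key (ct P i e) (inc≤1 v e)) (cong (λ a → z a *ᶻ + inc v e) (sym (pc-κ i e)))))
    where
    key : ∀ a {b} → b ≤ 1 → z a -ᶻ z (a + b) ≡ z a *ᶻ + b
    key zero {zero} h = refl
    key zero {suc zero} h = refl
    key zero {suc (suc b)} (s≤s ())
    key (suc a) {b} h = refl

  csumᶜ : ∀ j (G : Feature c) α → (∀ u → class cl j u ≡ true → NN (α +ᶻ ∑ E (λ e → G (κ cl e) *ᶻ + inc u e))) →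
    NN (+ size j *ᶻ α +ᶻ S (λ t → G t *ᶻ + lookup t j))
  csumᶜ j G α h = csum (class cl j) (λ e → G (κ cl e)) α h by cong (λ r → + size j *ᶻ α +ᶻ r)
    (∑-cong E (λ e → cong (λ r → G (κ cl e) *ᶻ + r) (sym (count j e))))

  I : Fin n → Feature c → ℤ
  I v F = ∑ E (λ e → F (κ cl e) *ᶻ + inc v e)

  -- What the incidence sums of `F` at single vertices add up to over the class `j`: each edge is
  -- counted once for each of its vertices in the class.
  L : Fin c → Feature c → Feature c
  L j F t = F t *ᶻ + lookup t j

  S-- : ∀ F G → S (λ t → F t -ᶻ G t) ≡ S F -ᶻ S G
  S-- F G = ∑-- E (λ e → F (κ cl e)) (λ e → G (κ cl e))

  S-+ : ∀ F G → S (λ t → F t +ᶻ G t) ≡ S F +ᶻ S G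
  S-+ F G = ∑-+ E (λ e → F (κ cl e)) (λ e → G (κ cl e))

  S-* : ∀ k F → S (λ t → k *ᶻ F t) ≡ k *ᶻ S F
  S-* k F = ∑-* E k (λ e → F (κ cl e))

  I-* : ∀ v k F → I v (λ t → k *ᶻ F t) ≡ k *ᶻ I v F
  I-* v k F = trans (∑-cong E (λ e → ℤₚ.*-assoc k (F (κ cl e)) (+ inc v e))) (∑-* E k (λ e → F (κ cl e) *ᶻ + inc v e))

  I-- : ∀ v F G → I v (λ t → F t -ᶻ G t) ≡ I v F -ᶻ I v G
  I-- v F G = trans (∑-cong E (λ e → alg (F (κ cl e)) (G (κ cl e)) (+ inc v e)))
    (∑-- E (λ e → F (κ cl e) *ᶻ + inc v e) (λ e → G (κ cl e) *ᶻ + inc v e))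
    where alg : ∀ a b i → (a -ᶻ b) *ᶻ i ≡ a *ᶻ i -ᶻ b *ᶻ i
          alg = solve-∀

  L-* : ∀ j k F → S (L j (λ t → k *ᶻ F t)) ≡ k *ᶻ S (L j F)
  L-* j k F = trans (∑-cong E (λ e → ℤₚ.*-assoc k (F (κ cl e)) (+ lookup (κ cl e) j))) (S-* k (L j F))

  trade-gain : ℕ → ℕ → Fin 3 → Fin 3 → Feature c
  trade-gain a b i l t = + a *ᶻ ω i t -ᶻ + b *ᶻ μ l t

  trade : ℕ → ℕ → Fin 3 → ℕ → Feature c → Fin c → Feature c
  trade a b l k γ j t = L j (trade-gain a b (part j) l) t -ᶻ + k *ᶻ γ t

  -- Summing the hypothesis over the class gives `γ` once for each vertex; as `γ` has a nonnegative
  -- sum, the unknown size may be lowered to the known bound `k`.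
  trade-holds : ∀ a b l k γ j → k ≤ size j → Holds γ →
    (∀ v → class cl j v ≡ true → NN (+ a *ᶻ p P (part j) (single v) -ᶻ + b *ᶻ q P l (single v) -ᶻ S γ)) → Holds (trade a b l k γ j)
  trade-holds a b l k γ j k≤ γ≥0 h = csumᶜ j G (0ℤ -ᶻ S γ) (λ v s → h v s by trans (alg₁ (+ a *ᶻ p P (part j) (single v) -ᶻ + b *ᶻ q P l (single v)) (S γ)) (cong (λ r → 0ℤ -ᶻ S γ +ᶻ r) (pq v)))
      ⊞ NN-prod (≤⇒NN (+≤+ k≤)) γ≥0
    by trans (alg₂ (+ size j) (S γ) (+ k) (S (L j G))) (sym (trans (S-- (L j G) (λ t → + k *ᶻ γ t)) (cong (λ r → S (L j G) -ᶻ r) (S-* (+ k) γ))))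
    where
    G : Feature c
    G = trade-gain a b (part j) l
    alg₁ : ∀ x y → x -ᶻ y ≡ 0ℤ -ᶻ y +ᶻ x
    alg₁ = solve-∀
    alg₂ : ∀ s g k x → s *ᶻ (0ℤ -ᶻ g) +ᶻ x +ᶻ (s -ᶻ k) *ᶻ g ≡ x -ᶻ k *ᶻ g
    alg₂ = solve-∀
    pq : ∀ v → + a *ᶻ p P (part j) (single v) -ᶻ + b *ᶻ q P l (single v) ≡ I v G
    pq v = trans (cong₂ (λ x y → + a *ᶻ x -ᶻ + b *ᶻ y) (p-inc (part j) v) (q-inc l v))
      (trans (cong₂ _-ᶻ_ (sym (I-* v (+ a) (ω (part j)))) (sym (I-* v (+ b) (μ l))))
        (sym (I-- v (λ t → + a *ᶻ ω (part j) t) (λ t → + b *ᶻ μ l t))))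

  -- The amount 5q - ξ by which moving the vertices of the class j lowers the missing count of l below the target.
  gain : ℕ → Fin 3 → Fin c → Feature c
  gain k l j t = L j (λ t → + 5 *ᶻ μ l t) t -ᶻ + k *ᶻ ξᶠ l t

  gain-S : ∀ k l j → S (gain k l j) ≡ S (L j (λ t → + 5 *ᶻ μ l t)) -ᶻ + k *ᶻ ξ P l
  gain-S k l j = trans (S-- (L j (λ t → + 5 *ᶻ μ l t)) (λ t → + k *ᶻ ξᶠ l t))
    (cong (λ r → S (L j (λ t → + 5 *ᶻ μ l t)) -ᶻ r) (trans (S-* (+ k) (ξᶠ l)) (cong (+ k *ᶻ_) (S-ξ l))))

  gain-bounds : ∀ l j v → (∀ u → class cl j u ≡ true → NN (v +ᶻ ξ P l -ᶻ + 5 *ᶻ q P l (single u))) → NN (+ size j *ᶻ v -ᶻ S (gain (size j) l j))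
  gain-bounds l j v h = csumᶜ j (λ t → -[1+ 4 ] *ᶻ μ l t) (v +ᶻ ξ P l) (λ u s → h u s by trans (alg₁ (v +ᶻ ξ P l) (q P l (single u))) (cong (λ r → v +ᶻ ξ P l +ᶻ r) (trans (cong (-[1+ 4 ] *ᶻ_) (q-inc l u)) (sym (I-* u -[1+ 4 ] (μ l))))))
    by trans (cong (λ r → + size j *ᶻ (v +ᶻ ξ P l) +ᶻ r) (L-* j -[1+ 4 ] (μ l)))
      (trans (alg₂ (+ size j) v (ξ P l) (S (L j (μ l)))) (cong (λ r → + size j *ᶻ v -ᶻ r)
        (sym (trans (gain-S (size j) l j) (cong (λ r → r -ᶻ + size j *ᶻ ξ P l) (L-* j (+ 5) (μ l)))))))
    where
    alg₁ : ∀ x y → x -ᶻ + 5 *ᶻ y ≡ x +ᶻ -[1+ 4 ] *ᶻ y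
    alg₁ = solve-∀
    alg₂ : ∀ s v x y → s *ᶻ (v +ᶻ x) +ᶻ -[1+ 4 ] *ᶻ y ≡ s *ᶻ v -ᶻ (+ 5 *ᶻ y -ᶻ s *ᶻ x)
    alg₂ = solve-∀

  gain-holds : ∀ l j → (∀ u → class cl j u ≡ true → NN (+ 5 *ᶻ q P l (single u) -ᶻ ξ P l)) → Holds (gain (size j) l j)
  gain-holds l j h = csumᶜ j (λ t → + 5 *ᶻ μ l t) (neg (ξ P l)) (λ u s → h u s by trans (alg₁ (q P l (single u)) (ξ P l)) (cong (λ r → neg (ξ P l) +ᶻ r)
        (trans (cong (+ 5 *ᶻ_) (q-inc l u)) (sym (I-* u (+ 5) (μ l))))))
    by trans (alg₂ (+ size j) (ξ P l) (S (L j (λ t → + 5 *ᶻ μ l t)))) (sym (gain-S (size j) l j))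
    where
    alg₁ : ∀ y x → + 5 *ᶻ y -ᶻ x ≡ neg x +ᶻ + 5 *ᶻ y
    alg₁ = solve-∀
    alg₂ : ∀ s x y → s *ᶻ neg x +ᶻ y ≡ y -ᶻ s *ᶻ x
    alg₂ = solve-∀

  part-bound : ∀ {U : Part {n}} {j} → U ⊑ class cl j → ∀ e → ∣ U ∣ᵇ e ≤ lookup (κ cl e) j
  part-bound {U} {j} U⊑ e = subst (∣ U ∣ᵇ e ≤_) (sym (count j e)) (wt-mono e (λ v → lem v (U v) refl))
    where
    lem : ∀ v b → U v ≡ b → bit b ≤ bit (class cl j v)
    lem v true h rewrite U⊑ v h = ℕₚ.≤-refl
    lem v false h = z≤n

  -- An upper bound that is linear in each of the two incidences, so that pairs can be summed. If
  -- the edge contains both vertices, `ω₂` is the exact contribution and the `ω` terms are slack; if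
  -- it contains one, `ω` is exact.
  p₂-bound : ∀ i u v e → NN (ω i (κ cl e) *ᶻ + inc u e +ᶻ (ω i (κ cl e) +ᶻ ω₂ i (κ cl e) *ᶻ + inc u e) *ᶻ + inc v e
    -ᶻ (z (ct P i e ∸ (∣ single u ∣ᵇ e + ∣ single v ∣ᵇ e)) -ᶻ z (ct P i e)))
  p₂-bound i u v e = subst₂ (λ a r → NN (w a *ᶻ + inc u e +ᶻ (w a +ᶻ w₂ a *ᶻ + inc u e) *ᶻ + inc v e -ᶻ r)) (sym (pc-κ i e))
    (cong₂ (λ b c → z (ct P i e ∸ (b + c)) -ᶻ z (ct P i e)) (sym (single-wt u e)) (sym (single-wt v e))) (key (ct P i e) (inc≤1 u e) (inc≤1 v e))
    where
    h₀ : ∀ W Y r → r ≡ 0ℤ → NN (W *ᶻ + 0 +ᶻ (W +ᶻ Y *ᶻ + 0) *ᶻ + 0 -ᶻ r)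
    h₀ W Y r refl = NN+ 0 by alg W Y
      where alg : ∀ W Y → 0ℤ ≡ W *ᶻ + 0 +ᶻ (W +ᶻ Y *ᶻ + 0) *ᶻ + 0 -ᶻ 0ℤ
            alg = solve-∀
    h₁ : ∀ W Y r → r ≡ W → NN (W *ᶻ + 0 +ᶻ (W +ᶻ Y *ᶻ + 0) *ᶻ + 1 -ᶻ r)
    h₁ W Y r refl = NN+ 0 by alg W Y
      where alg : ∀ W Y → 0ℤ ≡ W *ᶻ + 0 +ᶻ (W +ᶻ Y *ᶻ + 0) *ᶻ + 1 -ᶻ W
            alg = solve-∀
    h₂ : ∀ W Y r → r ≡ W → NN (W *ᶻ + 1 +ᶻ (W +ᶻ Y *ᶻ + 1) *ᶻ + 0 -ᶻ r)
    h₂ W Y r refl = NN+ 0 by alg W Y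
      where alg : ∀ W Y → 0ℤ ≡ W *ᶻ + 1 +ᶻ (W +ᶻ Y *ᶻ + 1) *ᶻ + 0 -ᶻ W
            alg = solve-∀
    h₃ : ∀ W Y r → NN W → r ≡ Y → NN (W *ᶻ + 1 +ᶻ (W +ᶻ Y *ᶻ + 1) *ᶻ + 1 -ᶻ r)
    h₃ W Y r W≥0 refl = W≥0 ⊞ W≥0 by alg W Y
      where alg : ∀ W Y → W +ᶻ W ≡ W *ᶻ + 1 +ᶻ (W +ᶻ Y *ᶻ + 1) *ᶻ + 1 -ᶻ Y
            alg = solve-∀
    key : ∀ a {b c} → b ≤ 1 → c ≤ 1 → NN (w a *ᶻ + b +ᶻ (w a +ᶻ w₂ a *ᶻ + b) *ᶻ + c -ᶻ (z (a ∸ (b + c)) -ᶻ z a))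
    key a {zero} {zero} h k = h₀ (w a) (w₂ a) (z (a ∸ (0 + 0)) -ᶻ z a) (ℤₚ.+-inverseʳ (z a))
    key a {zero} {suc zero} h k = h₁ (w a) (w₂ a) (z (a ∸ (0 + 1)) -ᶻ z a) refl
    key a {suc zero} {zero} h k = h₂ (w a) (w₂ a) (z (a ∸ (1 + 0)) -ᶻ z a) refl
    key a {suc zero} {suc zero} h k = h₃ (w a) (w₂ a) (z (a ∸ (1 + 1)) -ᶻ z a) (w-NN a) refl
    key a {suc (suc b)} (s≤s ()) k
    key a {suc zero} {suc (suc c)} h (s≤s ())
    key a {zero} {suc (suc c)} h (s≤s ())

-- Sums over pairs of vertices and over disjoint blocks

module Facts₂ {n} (E : List (Subset n)) (uniform : All (λ e → ∣ e ∣ ≡ 3) E) (unique : Unique E) (large : 211 ≤ length E)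
  {P : Colouring {n}} (opt : Extremal.Optimal E P) {c} (cl : Fin n → Fin c) (part : Fin c → Fin 3) (P≡ : ∀ v → P v ≡ part (cl v)) where
  open Extremal E
  open Moves opt
  open Blocks E P
  open Counting E
  open Certificate E uniform unique large cl
  open Facts E uniform unique large opt cl part P≡

  inc-idem : ∀ v e → + inc v e *ᶻ + inc v e ≡ + inc {n} v e
  inc-idem v e with lookup e v
  ... | true = refl
  ... | false = refl

  module PairSum (i : Fin 3) (U : Part {n}) (V : Fin n → Part {n}) (β : Subset n → ℤ) (ε kv : ℤ)
    (V-size : ∀ u → U u ≡ true → + ∣ V u ∣ᵇ full ≡ kv)
    (V-count : ∀ u → U u ≡ true → ∀ e → + ∣ V u ∣ᵇ e ≡ β e -ᶻ ε *ᶻ + inc u e)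
    (far : ∀ u → U u ≡ true → ∀ v → V u v ≡ true → NN (+ 5 *ᶻ p₂ i (single u) (single v) +ᶻ ξ P i)) where


    A D : Fin n → ℤ
    A u = ∑ E (λ e → ω i (κ cl e) *ᶻ + inc u e)
    D u = ∑ E (λ e → ω₂ i (κ cl e) *ᶻ (β e -ᶻ ε) *ᶻ + inc u e)
    B : ℤ
    B = ∑ E (λ e → ω i (κ cl e) *ᶻ β e)

    row : ∀ u → U u ≡ true → NN (kv *ᶻ ξ P i +ᶻ + 5 *ᶻ B +ᶻ ∑ E (λ e → (+ 5 *ᶻ (kv -ᶻ ε) *ᶻ ω i (κ cl e) +ᶻ + 5 *ᶻ (ω₂ i (κ cl e) *ᶻ (β e -ᶻ ε))) *ᶻ + inc u e))
    row u uU = csum (V u) (λ e → + 5 *ᶻ (ω i (κ cl e) +ᶻ ω₂ i (κ cl e) *ᶻ + inc u e)) (ξ P i +ᶻ + 5 *ᶻ A u) cell by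
      trans (cong₂ (λ k s → k *ᶻ (ξ P i +ᶻ + 5 *ᶻ A u) +ᶻ s) (V-size u uU) sum₁)
        (trans (alg₃ kv (ξ P i) (A u) B (D u) ε) (cong (λ r → kv *ᶻ ξ P i +ᶻ + 5 *ᶻ B +ᶻ r) (sym sum₂)))
      where
      X : Fin n → ℤ
      X v = ∑ E (λ e → ω i (κ cl e) *ᶻ + inc u e +ᶻ (ω i (κ cl e) +ᶻ ω₂ i (κ cl e) *ᶻ + inc u e) *ᶻ + inc v e)
      X-split : ∀ v → + 5 *ᶻ X v ≡ + 5 *ᶻ A u +ᶻ ∑ E (λ e → + 5 *ᶻ (ω i (κ cl e) +ᶻ ω₂ i (κ cl e) *ᶻ + inc u e) *ᶻ + inc v e)
      X-split v = trans (cong (+ 5 *ᶻ_) (∑-+ E (λ e → ω i (κ cl e) *ᶻ + inc u e) (λ e → (ω i (κ cl e) +ᶻ ω₂ i (κ cl e) *ᶻ + inc u e) *ᶻ + inc v e)))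
        (trans (ℤₚ.*-distribˡ-+ (+ 5) (A u) (∑ E (λ e → (ω i (κ cl e) +ᶻ ω₂ i (κ cl e) *ᶻ + inc u e) *ᶻ + inc v e))) (cong (+ 5 *ᶻ A u +ᶻ_)
          (sym (trans (∑-cong E (λ e → ℤₚ.*-assoc (+ 5) (ω i (κ cl e) +ᶻ ω₂ i (κ cl e) *ᶻ + inc u e) (+ inc v e))) (∑-* E (+ 5) (λ e → (ω i (κ cl e) +ᶻ ω₂ i (κ cl e) *ᶻ + inc u e) *ᶻ + inc v e))))))
      alg₁ : ∀ p x s r a → s ≡ a +ᶻ r → + 5 *ᶻ p +ᶻ x +ᶻ (s -ᶻ + 5 *ᶻ p) ≡ x +ᶻ a +ᶻ r
      alg₁ p x s r a refl = alg p x r a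
        where alg : ∀ p x r a → + 5 *ᶻ p +ᶻ x +ᶻ (a +ᶻ r -ᶻ + 5 *ᶻ p) ≡ x +ᶻ a +ᶻ r
              alg = solve-∀
      dist : ∀ a b → + 5 *ᶻ (a -ᶻ b) ≡ + 5 *ᶻ a -ᶻ + 5 *ᶻ b
      dist = solve-∀
      cell : ∀ v → V u v ≡ true → NN (ξ P i +ᶻ + 5 *ᶻ A u +ᶻ ∑ E (λ e → + 5 *ᶻ (ω i (κ cl e) +ᶻ ω₂ i (κ cl e) *ᶻ + inc u e) *ᶻ + inc v e))
      cell v vV = far u uU v vV ⊞ (5 ⊡ ∑-mono E (λ e → z (ct P i e ∸ (∣ single u ∣ᵇ e + ∣ single v ∣ᵇ e)) -ᶻ z (ct P i e)) (λ e → ω i (κ cl e) *ᶻ + inc u e +ᶻ (ω i (κ cl e) +ᶻ ω₂ i (κ cl e) *ᶻ + inc u e) *ᶻ + inc v e) (λ e → p₂-bound i u v e) by dist (X v) (p₂ i (single u) (single v)))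
        by alg₁ (p₂ i (single u) (single v)) (ξ P i) (+ 5 *ᶻ X v) (∑ E (λ e → + 5 *ᶻ (ω i (κ cl e) +ᶻ ω₂ i (κ cl e) *ᶻ + inc u e) *ᶻ + inc v e)) (+ 5 *ᶻ A u) (X-split v)
      -- Incidences are 0 or 1, so the square that arises when the partner count is corrected at `u`
      -- collapses.
      pt₁ : ∀ o o₂ b ε i → i *ᶻ i ≡ i → + 5 *ᶻ (o +ᶻ o₂ *ᶻ i) *ᶻ (b -ᶻ ε *ᶻ i) ≡ + 5 *ᶻ (o *ᶻ b) +ᶻ + 5 *ᶻ (o₂ *ᶻ (b -ᶻ ε) *ᶻ i -ᶻ ε *ᶻ (o *ᶻ i))
      pt₁ o o₂ b ε i h = trans (alg o o₂ b ε i) (trans (cong (λ r → + 5 *ᶻ (o *ᶻ b) +ᶻ + 5 *ᶻ (o₂ *ᶻ b *ᶻ i -ᶻ o₂ *ᶻ ε *ᶻ r -ᶻ ε *ᶻ (o *ᶻ i))) h) (alg′ o o₂ b ε i))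
        where
        alg : ∀ o o₂ b ε i → + 5 *ᶻ (o +ᶻ o₂ *ᶻ i) *ᶻ (b -ᶻ ε *ᶻ i) ≡ + 5 *ᶻ (o *ᶻ b) +ᶻ + 5 *ᶻ (o₂ *ᶻ b *ᶻ i -ᶻ o₂ *ᶻ ε *ᶻ (i *ᶻ i) -ᶻ ε *ᶻ (o *ᶻ i))
        alg = solve-∀
        alg′ : ∀ o o₂ b ε i → + 5 *ᶻ (o *ᶻ b) +ᶻ + 5 *ᶻ (o₂ *ᶻ b *ᶻ i -ᶻ o₂ *ᶻ ε *ᶻ i -ᶻ ε *ᶻ (o *ᶻ i)) ≡ + 5 *ᶻ (o *ᶻ b) +ᶻ + 5 *ᶻ (o₂ *ᶻ (b -ᶻ ε) *ᶻ i -ᶻ ε *ᶻ (o *ᶻ i))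
        alg′ = solve-∀
      sum₁ : ∑ E (λ e → + 5 *ᶻ (ω i (κ cl e) +ᶻ ω₂ i (κ cl e) *ᶻ + inc u e) *ᶻ + ∣ V u ∣ᵇ e) ≡ + 5 *ᶻ B +ᶻ + 5 *ᶻ (D u -ᶻ ε *ᶻ A u)
      sum₁ = trans (∑-cong E (λ e → trans (cong (+ 5 *ᶻ (ω i (κ cl e) +ᶻ ω₂ i (κ cl e) *ᶻ + inc u e) *ᶻ_) (V-count u uU e)) (pt₁ (ω i (κ cl e)) (ω₂ i (κ cl e)) (β e) ε (+ inc u e) (inc-idem u e))))
        (trans (∑-lin (+ 5) (+ 5) (λ e → ω i (κ cl e) *ᶻ β e) (λ e → ω₂ i (κ cl e) *ᶻ (β e -ᶻ ε) *ᶻ + inc u e -ᶻ ε *ᶻ (ω i (κ cl e) *ᶻ + inc u e)))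
          (cong (λ r → + 5 *ᶻ B +ᶻ + 5 *ᶻ r) (trans (∑-- E (λ e → ω₂ i (κ cl e) *ᶻ (β e -ᶻ ε) *ᶻ + inc u e) (λ e → ε *ᶻ (ω i (κ cl e) *ᶻ + inc u e))) (cong (λ r → D u -ᶻ r) (∑-* E ε (λ e → ω i (κ cl e) *ᶻ + inc u e))))))
      pt₂ : ∀ k o x i → (k *ᶻ o +ᶻ + 5 *ᶻ x) *ᶻ i ≡ k *ᶻ (o *ᶻ i) +ᶻ + 5 *ᶻ (x *ᶻ i)
      pt₂ = solve-∀
      sum₂ : ∑ E (λ e → (+ 5 *ᶻ (kv -ᶻ ε) *ᶻ ω i (κ cl e) +ᶻ + 5 *ᶻ (ω₂ i (κ cl e) *ᶻ (β e -ᶻ ε))) *ᶻ + inc u e) ≡ + 5 *ᶻ (kv -ᶻ ε) *ᶻ A u +ᶻ + 5 *ᶻ D u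
      sum₂ = trans (∑-cong E (λ e → pt₂ (+ 5 *ᶻ (kv -ᶻ ε)) (ω i (κ cl e)) (ω₂ i (κ cl e) *ᶻ (β e -ᶻ ε)) (+ inc u e)))
        (∑-lin (+ 5 *ᶻ (kv -ᶻ ε)) (+ 5) (λ e → ω i (κ cl e) *ᶻ + inc u e) (λ e → ω₂ i (κ cl e) *ᶻ (β e -ᶻ ε) *ᶻ + inc u e))
      alg₃ : ∀ k x a b d ε → k *ᶻ (x +ᶻ + 5 *ᶻ a) +ᶻ (+ 5 *ᶻ b +ᶻ + 5 *ᶻ (d -ᶻ ε *ᶻ a)) ≡ k *ᶻ x +ᶻ + 5 *ᶻ b +ᶻ (+ 5 *ᶻ (k -ᶻ ε) *ᶻ a +ᶻ + 5 *ᶻ d)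
      alg₃ = solve-∀

    -- `row` adds the pair inequalities over the partners of a fixed `u`, and this adds the rows.
    -- The form of `V-count` covers two uses at once: a fixed set of partners (ε = 0), and all
    -- vertices of `U` other than `u` itself (ε = 1).
    pair-sum : NN (+ ∣ U ∣ᵇ full *ᶻ (kv *ᶻ ξ P i +ᶻ + 5 *ᶻ B) +ᶻ (+ 5 *ᶻ (kv -ᶻ ε) *ᶻ ∑ E (λ e → ω i (κ cl e) *ᶻ + ∣ U ∣ᵇ e) +ᶻ + 5 *ᶻ ∑ E (λ e → ω₂ i (κ cl e) *ᶻ (β e -ᶻ ε) *ᶻ + ∣ U ∣ᵇ e)))
    pair-sum = csum U (λ e → + 5 *ᶻ (kv -ᶻ ε) *ᶻ ω i (κ cl e) +ᶻ + 5 *ᶻ (ω₂ i (κ cl e) *ᶻ (β e -ᶻ ε))) (kv *ᶻ ξ P i +ᶻ + 5 *ᶻ B) row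
      by cong (λ r → + ∣ U ∣ᵇ full *ᶻ (kv *ᶻ ξ P i +ᶻ + 5 *ᶻ B) +ᶻ r)
        (trans (∑-cong E (λ e → pt (+ 5 *ᶻ (kv -ᶻ ε)) (ω i (κ cl e)) (ω₂ i (κ cl e) *ᶻ (β e -ᶻ ε)) (+ ∣ U ∣ᵇ e)))
          (∑-lin (+ 5 *ᶻ (kv -ᶻ ε)) (+ 5) (λ e → ω i (κ cl e) *ᶻ + ∣ U ∣ᵇ e) (λ e → ω₂ i (κ cl e) *ᶻ (β e -ᶻ ε) *ᶻ + ∣ U ∣ᵇ e)))
      where
      pt : ∀ k o x i → (k *ᶻ o +ᶻ + 5 *ᶻ x) *ᶻ i ≡ k *ᶻ (o *ᶻ i) +ᶻ + 5 *ᶻ (x *ᶻ i)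
      pt = solve-∀

  -- Edge by edge: an edge that loses the part with `B` and `C`, or with `R` and `C`, loses it with
  -- `W` and `C`. If it does both, then, `B` and `R` being disjoint, its vertices in the part all
  -- lie in `C`, and `p P i C` pays for the second count.
  p₂-super : ∀ i {B R W C : Part {n}} → (∀ v → bit (W v) ≡ bit (B v) + bit (R v)) → (∀ e → ∣ W ∣ᵇ e + ∣ C ∣ᵇ e ≤ ct P i e) →
    NN (p₂ i W C +ᶻ p P i C -ᶻ (p₂ i B C +ᶻ p₂ i R C))
  p₂-super i {B} {R} {W} {C} bits le = ∑-mono E _ _ (λ e → subst (λ r → r + ∣ C ∣ᵇ e ≤ ct P i e → NN (z (ct P i e ∸ (r + ∣ C ∣ᵇ e)) -ᶻ z (ct P i e) +ᶻ (z (ct P i e ∸ ∣ C ∣ᵇ e) -ᶻ z (ct P i e))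
        -ᶻ (z (ct P i e ∸ (∣ B ∣ᵇ e + ∣ C ∣ᵇ e)) -ᶻ z (ct P i e) +ᶻ (z (ct P i e ∸ (∣ R ∣ᵇ e + ∣ C ∣ᵇ e)) -ᶻ z (ct P i e)))))
        (sym (trans (wt-cong e bits) (wt-+ _ _ e))) (key (ct P i e) (∣ B ∣ᵇ e) (∣ R ∣ᵇ e) (∣ C ∣ᵇ e)) (le e))
    by cong₂ _-ᶻ_ (∑-+ E (λ e → z (ct P i e ∸ (∣ W ∣ᵇ e + ∣ C ∣ᵇ e)) -ᶻ z (ct P i e)) (λ e → z (ct P i e ∸ ∣ C ∣ᵇ e) -ᶻ z (ct P i e)))
                  (∑-+ E (λ e → z (ct P i e ∸ (∣ B ∣ᵇ e + ∣ C ∣ᵇ e)) -ᶻ z (ct P i e)) (λ e → z (ct P i e ∸ (∣ R ∣ᵇ e + ∣ C ∣ᵇ e)) -ᶻ z (ct P i e)))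
    where
    alg : ∀ u v x y a → u -ᶻ x +ᶻ (v -ᶻ y) ≡ u -ᶻ a +ᶻ (v -ᶻ a) -ᶻ (x -ᶻ a +ᶻ (y -ᶻ a))
    alg = solve-∀
    alg′ : ∀ u v x y a → u -ᶻ y +ᶻ (v -ᶻ x) ≡ u -ᶻ a +ᶻ (v -ᶻ a) -ᶻ (x -ᶻ a +ᶻ (y -ᶻ a))
    alg′ = solve-∀
    key : ∀ a b r k → b + r + k ≤ a → NN (z (a ∸ (b + r + k)) -ᶻ z a +ᶻ (z (a ∸ k) -ᶻ z a) -ᶻ (z (a ∸ (b + k)) -ᶻ z a +ᶻ (z (a ∸ (r + k)) -ᶻ z a)))
    key a zero r k h = z-anti {a ∸ (r + k)} ℕₚ.≤-refl ⊞ z-anti {a ∸ k} ℕₚ.≤-refl by alg′ (z (a ∸ (r + k))) (z (a ∸ k)) (z (a ∸ k)) (z (a ∸ (r + k))) (z a)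
    key a (suc b) zero k h rewrite ℕₚ.+-identityʳ b = z-anti {a ∸ (suc b + k)} ℕₚ.≤-refl ⊞ z-anti {a ∸ k} ℕₚ.≤-refl by alg (z (a ∸ (suc b + k))) (z (a ∸ k)) (z (a ∸ (suc b + k))) (z (a ∸ k)) (z a)
    key a (suc b) (suc r) k h = z-anti {a ∸ (suc b + suc r + k)} {a ∸ (suc b + k)} (ℕₚ.∸-monoʳ-≤ a (ℕₚ.+-monoˡ-≤ k (ℕₚ.m≤m+n (suc b) (suc r)))) ⊞ rest
        by alg (z (a ∸ (suc b + suc r + k))) (z (a ∸ k)) (z (a ∸ (suc b + k))) (z (a ∸ (suc r + k))) (z a)
      where
      lt : suc r + k < a
      lt = ℕₚ.≤-trans (s≤s (ℕₚ.+-monoˡ-≤ k (ℕₚ.m≤n+m (suc r) b))) h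
      rest : NN (z (a ∸ k) -ᶻ z (a ∸ (suc r + k)))
      rest with a ∸ (suc r + k) | ℕₚ.m<n⇒0<n∸m lt
      ... | suc x | _ = z-NN (a ∸ k) by sym (ℤₚ.+-identityʳ _)

  -- The inequalities of the single blocks are added, and `p₂-super` merges their losses into that
  -- of `W`; every merger after the first block costs one further `p P i C`.
  blocks-sum : ∀ i j C {k W} → Disjoint j k W → (∀ e → ∣ W ∣ᵇ e + ∣ C ∣ᵇ e ≤ ct P i e) →
    (∀ B → B ⊑ W → NN (+ 5 *ᶻ q P j B -ᶻ ξ P j) → NN (+ 5 *ᶻ p₂ i B C +ᶻ ξ P i)) →
    NN (+ k *ᶻ ξ P i +ᶻ + 5 *ᶻ p₂ i W C +ᶻ + 5 *ᶻ ((+ k -ᶻ 1ℤ) *ᶻ p P i C))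
  blocks-sum i j C {W = W} [] le h = 5 ⊡ ∑-mono E _ _ (λ e → z-anti′ (ct P i e) (∣ W ∣ᵇ e) (∣ C ∣ᵇ e)) by alg (ξ P i) (p₂ i W C) (p P i C)
    where
    alg : ∀ x a b → + 5 *ᶻ (a -ᶻ b) ≡ + 0 *ᶻ x +ᶻ + 5 *ᶻ a +ᶻ + 5 *ᶻ ((+ 0 -ᶻ 1ℤ) *ᶻ b)
    alg = solve-∀
    alg′ : ∀ x y a → x -ᶻ y ≡ x -ᶻ a -ᶻ (y -ᶻ a)
    alg′ = solve-∀
    z-anti′ : ∀ a w c → NN (z (a ∸ (w + c)) -ᶻ z a -ᶻ (z (a ∸ c) -ᶻ z a))
    z-anti′ a w c = z-anti {a ∸ (w + c)} (ℕₚ.∸-monoʳ-≤ a (ℕₚ.m≤n+m c w)) by alg′ (z (a ∸ (w + c))) (z (a ∸ c)) (z a)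
  blocks-sum i j C {suc k} {W} (cons B B⊑ big rest) le h =
    subst NN (alg (+ suc k) (+ k) (ξ P i) (p₂ i (W ∖ B) C) (p₂ i B C) (p₂ i W C) (p P i C) refl) (step₁ ⊞ h B B⊑ big ⊞ 5 ⊡ step₂)
    where
    step₁ : NN (+ k *ᶻ ξ P i +ᶻ + 5 *ᶻ p₂ i (W ∖ B) C +ᶻ + 5 *ᶻ ((+ k -ᶻ 1ℤ) *ᶻ p P i C))
    step₁ = blocks-sum i j C {k} {W ∖ B} rest (λ e → ℕₚ.≤-trans (ℕₚ.+-monoˡ-≤ (∣ C ∣ᵇ e) (wt-mono e smaller)) (le e)) (λ B′ s → h B′ (λ v t → ∖⊑ W B v (s v t)))
      where
      smaller : ∀ v → bit ((W ∖ B) v) ≤ bit (W v)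
      smaller v = subst (bit ((W ∖ B) v) ≤_) (sym (∖-bit {W} {B} B⊑ v)) (ℕₚ.m≤n+m _ (bit (B v)))
    step₂ : NN (p₂ i W C +ᶻ p P i C -ᶻ (p₂ i B C +ᶻ p₂ i (W ∖ B) C))
    step₂ = p₂-super i {B} {W ∖ B} {W} {C} (∖-bit {W} {B} B⊑) le
    alg : ∀ s k x r b w c → s ≡ 1ℤ +ᶻ k → k *ᶻ x +ᶻ + 5 *ᶻ r +ᶻ + 5 *ᶻ ((k -ᶻ 1ℤ) *ᶻ c) +ᶻ (+ 5 *ᶻ b +ᶻ x) +ᶻ + 5 *ᶻ (w +ᶻ c -ᶻ (b +ᶻ r))
      ≡ s *ᶻ x +ᶻ + 5 *ᶻ w +ᶻ + 5 *ᶻ ((s -ᶻ 1ℤ) *ᶻ c)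
    alg s k x r b w c refl = alg₀ k x r b w c
      where
      alg₀ : ∀ k x r b w c → k *ᶻ x +ᶻ + 5 *ᶻ r +ᶻ + 5 *ᶻ ((k -ᶻ 1ℤ) *ᶻ c) +ᶻ (+ 5 *ᶻ b +ᶻ x) +ᶻ + 5 *ᶻ (w +ᶻ c -ᶻ (b +ᶻ r))
        ≡ (1ℤ +ᶻ k) *ᶻ x +ᶻ + 5 *ᶻ w +ᶻ + 5 *ᶻ ((1ℤ +ᶻ k -ᶻ 1ℤ) *ᶻ c)
      alg₀ = solve-∀

-- The features that enter the certificates

module Facts₃ {n} (E : List (Subset n)) (uniform : All (λ e → ∣ e ∣ ≡ 3) E) (unique : Unique E) (large : 211 ≤ length E)
  {P : Colouring {n}} (opt : Extremal.Optimal E P) {c} (cl : Fin n → Fin c) (part : Fin c → Fin 3) (P≡ : ∀ v → P v ≡ part (cl v)) where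
  open Extremal E
  open Moves opt
  open Blocks E P
  open Counting E
  open Certificate E uniform unique large cl
  open Facts E uniform unique large opt cl part P≡
  open Facts₂ E uniform unique large opt cl part P≡

  zeroᶠ : Feature c
  zeroᶠ t = 0ℤ

  S-zero : S zeroᶠ ≡ 0ℤ
  S-zero = trans (∑-const E 0ℤ) (ℤₚ.*-zeroʳ m)

  trade₀-holds : ∀ a b l j → (∀ v → class cl j v ≡ true → NN (+ a *ᶻ p P (part j) (single v) -ᶻ + b *ᶻ q P l (single v))) → Holds (trade a b l 0 zeroᶠ j)
  trade₀-holds a b l j h = trade-holds a b l 0 zeroᶠ j z≤n (NN+ 0 by sym S-zero)
    (λ v s → h v s by trans (sym (ℤₚ.+-identityʳ _)) (cong (λ r → + a *ᶻ p P (part j) (single v) -ᶻ + b *ᶻ q P l (single v) -ᶻ r) (sym S-zero)))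

  trade-by : ∀ a b l k γ j {g} → S γ ≡ g → k ≤ size j → Holds γ →
    (∀ v → class cl j v ≡ true → NN (+ a *ᶻ p P (part j) (single v) -ᶻ + b *ᶻ q P l (single v) -ᶻ g)) → Holds (trade a b l k γ j)
  trade-by a b l k γ j refl = trade-holds a b l k γ j

  L-mono : ∀ {U : Part {n}} {j} (G : Feature c) → (∀ e → NN (G (κ cl e))) → U ⊑ class cl j →
    NN (S (L j G) -ᶻ ∑ E (λ e → G (κ cl e) *ᶻ + ∣ U ∣ᵇ e))
  L-mono {U} {j} G G≥0 U⊑ = ∑-mono E (λ e → G (κ cl e) *ᶻ + ∣ U ∣ᵇ e) (λ e → L j G (κ cl e))
    (λ e → NN-prod (G≥0 e) (≤⇒NN (+≤+ (part-bound {U} {j} U⊑ e))) by alg (G (κ cl e)) (+ lookup (κ cl e) j) (+ ∣ U ∣ᵇ e))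
    where alg : ∀ g a b → g *ᶻ (a -ᶻ b) ≡ g *ᶻ a -ᶻ g *ᶻ b
          alg = solve-∀

  ω-NN : ∀ i e → NN (ω i (κ cl e))
  ω-NN i e = w-NN (pc i (κ cl e))

  ω₂-NN : ∀ i e → NN (ω₂ i (κ cl e))
  ω₂-NN i e = w₂-NN (pc i (κ cl e))

  pairᶠ : ℕ → ℕ → Fin c → Fin c → Fin 3 → Feature c
  pairᶠ ka kb a b i t = + 5 *ᶻ (+ ka *ᶻ L b (ω i) t +ᶻ + kb *ᶻ L a (ω i) t +ᶻ L a (L b (ω₂ i)) t) +ᶻ + ka *ᶻ + kb *ᶻ ξᶠ i t

  -- The sum runs over `ka` times `kb` chosen pairs. Its incidence terms are then enlarged to the
  -- whole classes, which is allowed because `ω` and `ω₂` are nonnegative.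
  pair-holds : ∀ ka kb a b i → ka ≤ size a → kb ≤ size b →
    (∀ u → class cl a u ≡ true → ∀ v → class cl b v ≡ true → NN (+ 5 *ᶻ p₂ i (single u) (single v) +ᶻ ξ P i)) → Holds (pairᶠ ka kb a b i)
  pair-holds ka kb a b i ka≤ kb≤ far with pick (class cl a) ka ka≤ | pick (class cl b) kb kb≤
  ... | U , U⊑ , U-size | V , V⊑ , V-size = result
    where
    idᶻ : ∀ x y → x ≡ x -ᶻ 0ℤ *ᶻ y
    idᶻ = solve-∀
    module PS = PairSum i U (λ _ → V) (λ e → + ∣ V ∣ᵇ e) 0ℤ (+ kb) (λ _ _ → cong +_ V-size) (λ u _ e → idᶻ (+ ∣ V ∣ᵇ e) (+ inc u e)) (λ u s v t → far u (U⊑ u s) v (V⊑ v t))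
    B C D B′ C′ D′ : ℤ
    B = ∑ E (λ e → ω i (κ cl e) *ᶻ + ∣ V ∣ᵇ e)
    C = ∑ E (λ e → ω i (κ cl e) *ᶻ + ∣ U ∣ᵇ e)
    D = ∑ E (λ e → ω₂ i (κ cl e) *ᶻ (+ ∣ V ∣ᵇ e -ᶻ 0ℤ) *ᶻ + ∣ U ∣ᵇ e)
    B′ = S (L b (ω i))
    C′ = S (L a (ω i))
    D′ = S (L a (L b (ω₂ i)))
    D-mono : NN (D′ -ᶻ D)
    D-mono = ∑-mono E (λ e → ω₂ i (κ cl e) *ᶻ (+ ∣ V ∣ᵇ e -ᶻ 0ℤ) *ᶻ + ∣ U ∣ᵇ e) (λ e → L a (L b (ω₂ i)) (κ cl e))
      (λ e → NN-prod (NN-prod (ω₂-NN i e) (≤⇒NN (+≤+ (part-bound {V} {b} V⊑ e)))) (NN+ (lookup (κ cl e) a))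
           ⊞ NN-prod (NN-prod (ω₂-NN i e) (NN+ (∣ V ∣ᵇ e))) (≤⇒NN (+≤+ (part-bound {U} {a} U⊑ e)))
         by alg (ω₂ i (κ cl e)) (+ lookup (κ cl e) b) (+ ∣ V ∣ᵇ e) (+ lookup (κ cl e) a) (+ ∣ U ∣ᵇ e))
      where alg : ∀ o tb v ta u → o *ᶻ (tb -ᶻ v) *ᶻ ta +ᶻ o *ᶻ v *ᶻ (ta -ᶻ u) ≡ o *ᶻ tb *ᶻ ta -ᶻ o *ᶻ (v -ᶻ 0ℤ) *ᶻ u
            alg = solve-∀
    S-pair : S (pairᶠ ka kb a b i) ≡ + 5 *ᶻ (+ ka *ᶻ B′ +ᶻ + kb *ᶻ C′ +ᶻ D′) +ᶻ + ka *ᶻ + kb *ᶻ ξ P i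
    S-pair = trans (S-+ (λ t → + 5 *ᶻ (+ ka *ᶻ L b (ω i) t +ᶻ + kb *ᶻ L a (ω i) t +ᶻ L a (L b (ω₂ i)) t)) (λ t → + ka *ᶻ + kb *ᶻ ξᶠ i t))
      (cong₂ _+ᶻ_ (trans (S-* (+ 5) (λ t → + ka *ᶻ L b (ω i) t +ᶻ + kb *ᶻ L a (ω i) t +ᶻ L a (L b (ω₂ i)) t)) (cong (+ 5 *ᶻ_)
          (trans (S-+ (λ t → + ka *ᶻ L b (ω i) t +ᶻ + kb *ᶻ L a (ω i) t) (L a (L b (ω₂ i)))) (cong (_+ᶻ D′)
             (trans (S-+ (λ t → + ka *ᶻ L b (ω i) t) (λ t → + kb *ᶻ L a (ω i) t)) (cong₂ _+ᶻ_ (S-* (+ ka) (L b (ω i))) (S-* (+ kb) (L a (ω i)))))))))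
        (trans (S-* (+ ka *ᶻ + kb) (ξᶠ i)) (cong (+ ka *ᶻ + kb *ᶻ_) (S-ξ i))))
    alg : ∀ ka kb x b c d b′ c′ d′ → ka *ᶻ (kb *ᶻ x +ᶻ + 5 *ᶻ b) +ᶻ (+ 5 *ᶻ (kb -ᶻ 0ℤ) *ᶻ c +ᶻ + 5 *ᶻ d) +ᶻ + 5 *ᶻ (ka *ᶻ (b′ -ᶻ b)) +ᶻ + 5 *ᶻ (kb *ᶻ (c′ -ᶻ c)) +ᶻ + 5 *ᶻ (d′ -ᶻ d)
      ≡ + 5 *ᶻ (ka *ᶻ b′ +ᶻ kb *ᶻ c′ +ᶻ d′) +ᶻ ka *ᶻ kb *ᶻ x
    alg = solve-∀
    base-sum : NN (+ ka *ᶻ (+ kb *ᶻ ξ P i +ᶻ + 5 *ᶻ B) +ᶻ (+ 5 *ᶻ (+ kb -ᶻ 0ℤ) *ᶻ C +ᶻ + 5 *ᶻ D))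
    base-sum = subst (λ r → NN (+ r *ᶻ (+ kb *ᶻ ξ P i +ᶻ + 5 *ᶻ B) +ᶻ (+ 5 *ᶻ (+ kb -ᶻ 0ℤ) *ᶻ C +ᶻ + 5 *ᶻ D))) U-size PS.pair-sum
    result : Holds (pairᶠ ka kb a b i)
    result = subst NN (trans (alg (+ ka) (+ kb) (ξ P i) B C D B′ C′ D′) (sym S-pair)) (base-sum ⊞ 5 ⊡ ka ⊡ B-mono ⊞ 5 ⊡ kb ⊡ C-mono ⊞ 5 ⊡ D-mono)
      where
      B-mono : NN (B′ -ᶻ B)
      B-mono = L-mono {V} {b} (ω i) (ω-NN i) V⊑
      C-mono : NN (C′ -ᶻ C)
      C-mono = L-mono {U} {a} (ω i) (ω-NN i) U⊑

  -- The analogue of `pairᶠ` for ordered pairs of distinct vertices of one class: there are k(k - 1)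
  -- of them, each vertex occurs k - 1 times in either position (hence 10 = 5 + 5), and an edge with
  -- t vertices in the class contains t(t - 1).
  twinᶠ : ℕ → Fin c → Fin 3 → Feature c
  twinᶠ k a i t = + k *ᶻ + (k ∸ 1) *ᶻ ξᶠ i t +ᶻ (+ 10 *ᶻ + (k ∸ 1) *ᶻ L a (ω i) t +ᶻ + 5 *ᶻ (ω₂ i t *ᶻ + (lookup t a * (lookup t a ∸ 1))))

  S-twin : ∀ k a i → S (twinᶠ k a i) ≡ + k *ᶻ + (k ∸ 1) *ᶻ ξ P i +ᶻ (+ 10 *ᶻ + (k ∸ 1) *ᶻ S (L a (ω i)) +ᶻ + 5 *ᶻ S (λ t → ω₂ i t *ᶻ + (lookup t a * (lookup t a ∸ 1))))
  S-twin k a i = trans (S-+ (λ t → + k *ᶻ + (k ∸ 1) *ᶻ ξᶠ i t) (λ t → + 10 *ᶻ + (k ∸ 1) *ᶻ L a (ω i) t +ᶻ + 5 *ᶻ (ω₂ i t *ᶻ + (lookup t a * (lookup t a ∸ 1)))))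
    (cong₂ _+ᶻ_ (trans (S-* (+ k *ᶻ + (k ∸ 1)) (ξᶠ i)) (cong (+ k *ᶻ + (k ∸ 1) *ᶻ_) (S-ξ i)))
      (trans (S-+ (λ t → + 10 *ᶻ + (k ∸ 1) *ᶻ L a (ω i) t) (λ t → + 5 *ᶻ (ω₂ i t *ᶻ + (lookup t a * (lookup t a ∸ 1)))))
        (cong₂ _+ᶻ_ (S-* (+ 10 *ᶻ + (k ∸ 1)) (L a (ω i))) (S-* (+ 5) (λ t → ω₂ i t *ᶻ + (lookup t a * (lookup t a ∸ 1)))))))

  twin-holds : ∀ k a i → k ≤ size a →
    (∀ u → class cl a u ≡ true → ∀ v → class cl a v ≡ true → single u v ≡ false → NN (+ 5 *ᶻ p₂ i (single u) (single v) +ᶻ ξ P i)) → Holds (twinᶠ k a i)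
  twin-holds zero a i _ far = 5 ⊡ ∑-NN E (λ e → ω₂ i (κ cl e) *ᶻ + (lookup (κ cl e) a * (lookup (κ cl e) a ∸ 1))) (λ e → NN-prod (ω₂-NN i e) (NN+ (lookup (κ cl e) a * (lookup (κ cl e) a ∸ 1))))
    by trans (alg (ξ P i) (S (L a (ω i))) (S (λ t → ω₂ i t *ᶻ + (lookup t a * (lookup t a ∸ 1))))) (sym (S-twin 0 a i))
    where alg : ∀ x y d → + 5 *ᶻ d ≡ + 0 *ᶻ + 0 *ᶻ x +ᶻ (+ 10 *ᶻ + 0 *ᶻ y +ᶻ + 5 *ᶻ d)
          alg = solve-∀
  twin-holds (suc k) a i k≤ far with pick (class cl a) (suc k) k≤
  ... | U , U⊑ , U-size = result
    where
    inside-U : ∀ u → U u ≡ true → ∀ v → single u v ≡ true → U v ≡ true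
    inside-U u s v t = subst (λ x → U x ≡ true) (single-≡ {u = u} {v} t) s
    less : ∀ u → U u ≡ true → ∀ e → ∣ U ∣ᵇ e ≡ inc u e + ∣ U ∖ single u ∣ᵇ e
    less u s e = trans (wt-cong e (∖-bit {U} {single u} (inside-U u s))) (trans (wt-+ (bit ∘ single u) (bit ∘ (U ∖ single u)) e) (cong (λ r → r + ∣ U ∖ single u ∣ᵇ e) (single-wt u e)))
    lessᶻ : ∀ u → U u ≡ true → ∀ e → + ∣ U ∖ single u ∣ᵇ e ≡ + ∣ U ∣ᵇ e -ᶻ 1ℤ *ᶻ + inc u e
    lessᶻ u s e = trans (alg (+ inc u e) (+ ∣ U ∖ single u ∣ᵇ e)) (cong (λ r → r -ᶻ 1ℤ *ᶻ + inc u e) (trans (sym (ℤₚ.pos-+ (inc u e) (∣ U ∖ single u ∣ᵇ e))) (cong +_ (sym (less u s e)))))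
      where alg : ∀ i r → r ≡ i +ᶻ r -ᶻ 1ℤ *ᶻ i
            alg = solve-∀
    size-less : ∀ u → U u ≡ true → + ∣ U ∖ single u ∣ᵇ full ≡ + k
    size-less u s = cong +_ (ℕₚ.suc-injective (trans (cong (λ r → r + ∣ U ∖ single u ∣ᵇ full) (sym (cong (λ b → if b then 1 else 0) (Vecₚ.lookup-replicate u true)))) (trans (sym (less u s full)) U-size)))
    module PS = PairSum i U (λ u → U ∖ single u) (λ e → + ∣ U ∣ᵇ e) 1ℤ (+ k) size-less lessᶻ
      (λ u s v t → far u (U⊑ u s) v (U⊑ v (∖⊑ U (single u) v t)) (∖-disj U (single u) v t))
    C D C′ D′ : ℤ
    C = ∑ E (λ e → ω i (κ cl e) *ᶻ + ∣ U ∣ᵇ e)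
    D = ∑ E (λ e → ω₂ i (κ cl e) *ᶻ (+ ∣ U ∣ᵇ e -ᶻ 1ℤ) *ᶻ + ∣ U ∣ᵇ e)
    C′ = S (L a (ω i))
    D′ = S (λ t → ω₂ i t *ᶻ + (lookup t a * (lookup t a ∸ 1)))
    square : ∀ u {t} → u ≤ t → NN (+ (t * (t ∸ 1)) -ᶻ (+ u -ᶻ 1ℤ) *ᶻ + u)
    square zero h = NN+ _ by alg _
      where alg : ∀ x → x ≡ x -ᶻ (0ℤ -ᶻ 1ℤ) *ᶻ 0ℤ
            alg = solve-∀
    square (suc u) {suc t} (s≤s h) = ≤⇒NN (+≤+ (ℕₚ.*-mono-≤ (s≤s h) h)) by cong (λ r → + (suc t * t) -ᶻ r) (trans (ℤₚ.pos-* (suc u) u) (alg (+ suc u) (+ u) refl))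
      where alg : ∀ s u → s ≡ 1ℤ +ᶻ u → s *ᶻ u ≡ (s -ᶻ 1ℤ) *ᶻ s
            alg s u refl = alg₀ u
              where alg₀ : ∀ u → (1ℤ +ᶻ u) *ᶻ u ≡ (1ℤ +ᶻ u -ᶻ 1ℤ) *ᶻ (1ℤ +ᶻ u)
                    alg₀ = solve-∀
    D-mono : NN (D′ -ᶻ D)
    D-mono = ∑-mono E (λ e → ω₂ i (κ cl e) *ᶻ (+ ∣ U ∣ᵇ e -ᶻ 1ℤ) *ᶻ + ∣ U ∣ᵇ e) (λ e → ω₂ i (κ cl e) *ᶻ + (lookup (κ cl e) a * (lookup (κ cl e) a ∸ 1)))
      (λ e → NN-prod (ω₂-NN i e) (square (∣ U ∣ᵇ e) (part-bound {U} {a} U⊑ e)) by alg (ω₂ i (κ cl e)) (+ (lookup (κ cl e) a * (lookup (κ cl e) a ∸ 1))) (+ ∣ U ∣ᵇ e -ᶻ 1ℤ) (+ ∣ U ∣ᵇ e))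
      where alg : ∀ o x y u → o *ᶻ (x -ᶻ y *ᶻ u) ≡ o *ᶻ x -ᶻ o *ᶻ y *ᶻ u
            alg = solve-∀
    alg : ∀ s k x c d c′ d′ → s ≡ 1ℤ +ᶻ k → s *ᶻ (k *ᶻ x +ᶻ + 5 *ᶻ c) +ᶻ (+ 5 *ᶻ (k -ᶻ 1ℤ) *ᶻ c +ᶻ + 5 *ᶻ d) +ᶻ + 10 *ᶻ (k *ᶻ (c′ -ᶻ c)) +ᶻ + 5 *ᶻ (d′ -ᶻ d)
      ≡ s *ᶻ k *ᶻ x +ᶻ (+ 10 *ᶻ k *ᶻ c′ +ᶻ + 5 *ᶻ d′)
    alg s k x c d c′ d′ refl = alg₀ k x c d c′ d′
      where
      alg₀ : ∀ k x c d c′ d′ → (1ℤ +ᶻ k) *ᶻ (k *ᶻ x +ᶻ + 5 *ᶻ c) +ᶻ (+ 5 *ᶻ (k -ᶻ 1ℤ) *ᶻ c +ᶻ + 5 *ᶻ d) +ᶻ + 10 *ᶻ (k *ᶻ (c′ -ᶻ c)) +ᶻ + 5 *ᶻ (d′ -ᶻ d)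
        ≡ (1ℤ +ᶻ k) *ᶻ k *ᶻ x +ᶻ (+ 10 *ᶻ k *ᶻ c′ +ᶻ + 5 *ᶻ d′)
      alg₀ = solve-∀
    base-sum : NN (+ suc k *ᶻ (+ k *ᶻ ξ P i +ᶻ + 5 *ᶻ C) +ᶻ (+ 5 *ᶻ (+ k -ᶻ 1ℤ) *ᶻ C +ᶻ + 5 *ᶻ D))
    base-sum = subst (λ r → NN (+ r *ᶻ (+ k *ᶻ ξ P i +ᶻ + 5 *ᶻ C) +ᶻ (+ 5 *ᶻ (+ k -ᶻ 1ℤ) *ᶻ C +ᶻ + 5 *ᶻ D))) U-size PS.pair-sum
    result : Holds (twinᶠ (suc k) a i)
    result = subst NN (trans (alg (+ suc k) (+ k) (ξ P i) C D C′ D′ refl) (sym (S-twin (suc k) a i))) (base-sum ⊞ 10 ⊡ k ⊡ C-mono ⊞ 5 ⊡ D-mono)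
      where
      C-mono : NN (C′ -ᶻ C)
      C-mono = L-mono {U} {a} (ω i) (ω-NN i) U⊑

  W : Vec Bool c → Part {n}
  W f v = lookup f (cl v)

  dot-W : ∀ f e → dot (bit ∘ lookup f) (κ cl e) ≡ ∣ W f ∣ᵇ e
  dot-W f e = dot-κ cl (bit ∘ lookup f) e

  touchᶠ clearᶠ : Vec Bool c → Fin 3 → Feature c
  touchᶠ f j t = z (pc j t) -ᶻ z (pc j t + dot (bit ∘ lookup f) t)
  clearᶠ f i t = z (pc i t ∸ dot (bit ∘ lookup f) t) -ᶻ z (pc i t)

  S-touch : ∀ f j → S (touchᶠ f j) ≡ q P j (W f)
  S-touch f j = ∑-cong E (λ e → cong₂ (λ a b → z a -ᶻ z (a + b)) (pc-κ j e) (dot-W f e))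

  S-clear : ∀ f i → S (clearᶠ f i) ≡ p P i (W f)
  S-clear f i = ∑-cong E (λ e → cong₂ (λ a b → z (a ∸ b) -ᶻ z a) (pc-κ i e) (dot-W f e))

  sparseᶠ : ℕ → Vec Bool c → Fin 3 → Feature c
  sparseᶠ k f j t = + k *ᶻ ξᶠ j t -ᶻ + 5 *ᶻ touchᶠ f j t

  sparse-holds : ∀ k f j → NN (+ k *ᶻ ξ P j -ᶻ + 5 *ᶻ q P j (W f)) → Holds (sparseᶠ k f j)
  sparse-holds k f j h = h by sym (trans (S-- (λ t → + k *ᶻ ξᶠ j t) (λ t → + 5 *ᶻ touchᶠ f j t))
    (cong₂ _-ᶻ_ (trans (S-* (+ k) (ξᶠ j)) (cong (+ k *ᶻ_) (S-ξ j))) (trans (S-* (+ 5) (touchᶠ f j)) (cong (+ 5 *ᶻ_) (S-touch f j)))))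

  denseᶠ : ℕ → Vec Bool c → Fin 3 → Feature c
  denseᶠ k f i t = + k *ᶻ ξᶠ i t +ᶻ + 5 *ᶻ clearᶠ f i t

  S-dense : ∀ k f i → S (denseᶠ k f i) ≡ + k *ᶻ ξ P i +ᶻ + 5 *ᶻ p P i (W f)
  S-dense k f i = trans (S-+ (λ t → + k *ᶻ ξᶠ i t) (λ t → + 5 *ᶻ clearᶠ f i t))
    (cong₂ _+ᶻ_ (trans (S-* (+ k) (ξᶠ i)) (cong (+ k *ᶻ_) (S-ξ i))) (trans (S-* (+ 5) (clearᶠ f i)) (cong (+ 5 *ᶻ_) (S-clear f i))))

  dense₂ᶠ : ℕ → Vec Bool c → Fin 3 → Fin c → Feature c
  dense₂ᶠ k f i a t = + k *ᶻ denseᶠ 2 f i t +ᶻ + 5 *ᶻ L a (ω i) t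

  module _ {i j k} (d : Distinct i j k) (f : Vec Bool c) (W⊂ : W f ⊂[ P , i ]) (ξ≥0 : NN (ξ P j))
    (near : ∀ v → W f v ≡ true → NN (ξ P j -ᶻ + 5 *ᶻ q P j (single v))) where

    -- If the first alternative fails, `W f` contains l + 1 disjoint blocks that each repair `j`. As
    -- `k` is good, moving any one of them must make `i` bad, and `blocks-sum` adds these facts. The
    -- second set in the pair inequalities is taken empty, since nothing moves to `k`.
    alternative : ∀ l → NN (neg (ξ P k)) → Holds (sparseᶠ (1 + 2 * l) f j) ⊎ Holds (denseᶠ (suc l) f i)
    alternative l ξk≤0 = go (dichotomy (+ 5 *ᶻ q P j (W f)) (+ (1 + 2 * l) *ᶻ ξ P j))
      where
      ∅ : Part {n}
      ∅ _ = false
      q-none : q P k ∅ ≡ 0ℤ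
      q-none = trans (∑-cong E (λ e → trans (cong (λ r → z (ct P k e) -ᶻ z (ct P k e + r)) (wt-zero e)) (trans (cong (λ r → z (ct P k e) -ᶻ z r) (ℕₚ.+-identityʳ (ct P k e))) (ℤₚ.+-inverseʳ (z (ct P k e)))))) (trans (∑-const E 0ℤ) (ℤₚ.*-zeroʳ m))
      p-none : p P i ∅ ≡ 0ℤ
      p-none = trans (∑-cong E (λ e → trans (cong (λ r → z (ct P i e ∸ r) -ᶻ z (ct P i e)) (wt-zero e)) (ℤₚ.+-inverseʳ (z (ct P i e))))) (trans (∑-const E 0ℤ) (ℤₚ.*-zeroʳ m))
      p₂-none : p₂ i (W f) ∅ ≡ p P i (W f)
      p₂-none = ∑-cong E (λ e → cong (λ r → z (ct P i e ∸ r) -ᶻ z (ct P i e)) (trans (cong (λ r → ∣ W f ∣ᵇ e + r) (wt-zero e)) (ℕₚ.+-identityʳ (∣ W f ∣ᵇ e))))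
      alg₀ : ∀ x → neg x ≡ + 5 *ᶻ 0ℤ -ᶻ x
      alg₀ = solve-∀
      alg : ∀ a x y → x -ᶻ y -ᶻ 1ℤ +ᶻ 1ℤ ≡ x -ᶻ y
      alg = solve-∀
      each : ∀ B → B ⊑ W f → NN (+ 5 *ᶻ q P j B -ᶻ ξ P j) → NN (+ 5 *ᶻ p₂ i B ∅ +ᶻ ξ P i)
      each B B⊑ big = pair-balanced d {B} {∅} (λ v s → W⊂ v (B⊑ v s)) (λ v ()) (λ v ()) big (ξk≤0 by trans (alg₀ (ξ P k)) (cong (λ r → + 5 *ᶻ r -ᶻ ξ P k) (sym q-none)))
        ⊞ NN+ 1 by alg′ (+ 5 *ᶻ p₂ i B ∅ +ᶻ ξ P i)
        where alg′ : ∀ x → x -ᶻ 1ℤ +ᶻ 1ℤ ≡ x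
              alg′ = solve-∀
      fits : ∀ e → ∣ W f ∣ᵇ e + ∣ ∅ ∣ᵇ e ≤ ct P i e
      fits e = subst (_≤ ct P i e) (sym (trans (cong (λ r → ∣ W f ∣ᵇ e + r) (wt-zero e)) (ℕₚ.+-identityʳ (∣ W f ∣ᵇ e)))) (part≤ct (W f) W⊂ e)
      alg₂ : ∀ a x k → a +ᶻ x +ᶻ + 5 *ᶻ (k *ᶻ 0ℤ) ≡ a +ᶻ x
      alg₂ = solve-∀
      go : NN (+ (1 + 2 * l) *ᶻ ξ P j -ᶻ + 5 *ᶻ q P j (W f)) ⊎ NN (+ 5 *ᶻ q P j (W f) -ᶻ + (1 + 2 * l) *ᶻ ξ P j -ᶻ 1ℤ) → Holds (sparseᶠ (1 + 2 * l) f j) ⊎ Holds (denseᶠ (suc l) f i)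
      go (inj₁ h) = inj₁ (sparse-holds (1 + 2 * l) f j h)
      go (inj₂ h) = inj₂ (blocks-sum i j ∅ (blocks l j ξ≥0 near (weaken1 {+ 5 *ᶻ q P j (W f)} {+ (1 + 2 * l) *ᶻ ξ P j} h)) fits each
        by trans (cong₂ (λ r s → + suc l *ᶻ ξ P i +ᶻ + 5 *ᶻ r +ᶻ + 5 *ᶻ ((+ suc l -ᶻ 1ℤ) *ᶻ s)) p₂-none p-none)
           (trans (alg₂ (+ suc l *ᶻ ξ P i) (+ 5 *ᶻ p P i (W f)) (+ suc l -ᶻ 1ℤ)) (sym (S-dense (suc l) f i))))

    -- Here `k` may be bad, and one vertex `u` of the class `a` is sent there to repair it. If `W f`
    -- is rich, two blocks avoiding `u` each repair `j`, so either of them together with `u` spoils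
    -- `i`; the result is then summed over `k′` choices of `u`.
    alternative₂ : ∀ k′ a → k′ ≤ size a → lookup f a ≡ true → (∀ u → class cl a u ≡ true → NN (+ 5 *ᶻ q P k (single u) -ᶻ ξ P k)) →
      Holds (sparseᶠ 4 f j) ⊎ Holds (dense₂ᶠ k′ f i a)
    alternative₂ k′ a k′≤ fa far = go (dichotomy (+ 5 *ᶻ q P j (W f)) (+ 4 *ᶻ ξ P j))
      where
      inW : ∀ u → class cl a u ≡ true → W f u ≡ true
      inW u s = trans (cong (lookup f) (class-≡ s)) fa
      module One (big : NN (+ 5 *ᶻ q P j (W f) -ᶻ + 4 *ᶻ ξ P j)) where
        at : ∀ u → class cl a u ≡ true → NN (+ 2 *ᶻ ξ P i +ᶻ + 5 *ᶻ p P i (W f) +ᶻ + 5 *ᶻ p P i (single u))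
        at u s = blocks-sum i j (single u) (blocks 1 j {W f ∖ single u} ξ≥0 (λ v t → near v (∖⊑ (W f) (single u) v t)) rest) fits each
          by alg (+ 2 *ᶻ ξ P i) (p₂ i (W f ∖ single u) (single u)) (p P i (W f)) (p P i (single u)) p₂-all
          where
          R = W f ∖ single u
          u⊑ : single u ⊑ W f
          u⊑ v t = subst (λ x → W f x ≡ true) (single-≡ {u = u} {v} t) (inW u s)
          sum-count : ∀ e → ∣ R ∣ᵇ e + ∣ single u ∣ᵇ e ≡ ∣ W f ∣ᵇ e
          sum-count e = trans (ℕₚ.+-comm (∣ R ∣ᵇ e) (∣ single u ∣ᵇ e)) (sym (trans (wt-cong e (∖-bit {W f} {single u} u⊑)) (wt-+ (bit ∘ single u) (bit ∘ R) e)))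
          p₂-all : p₂ i R (single u) ≡ p P i (W f)
          p₂-all = ∑-cong E (λ e → cong (λ r → z (ct P i e ∸ r) -ᶻ z (ct P i e)) (sum-count e))
          fits : ∀ e → ∣ R ∣ᵇ e + ∣ single u ∣ᵇ e ≤ ct P i e
          fits e = subst (_≤ ct P i e) (sym (sum-count e)) (part≤ct (W f) W⊂ e)
          alg₁ : ∀ w r u x → + 5 *ᶻ w -ᶻ + 4 *ᶻ x +ᶻ (x -ᶻ + 5 *ᶻ u) +ᶻ + 5 *ᶻ (u +ᶻ r -ᶻ w) ≡ + 5 *ᶻ r -ᶻ + 3 *ᶻ x
          alg₁ = solve-∀
          -- Taking the near vertex `u` out costs at most ξ, so 4ξ leaves the 3ξ that two blocks
          -- require.
          rest : NN (+ 5 *ᶻ q P j R -ᶻ + 3 *ᶻ ξ P j)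
          rest = subst NN (alg₁ (q P j (W f)) (q P j R) (q P j (single u)) (ξ P j)) (big ⊞ near u (inW u s) ⊞ 5 ⊡ sub)
            where
            sub : NN (q P j (single u) +ᶻ q P j R -ᶻ q P j (W f))
            sub = q-sub j {single u} {R} {W f} (∖-≤ (W f) (single u))
          each : ∀ B → B ⊑ R → NN (+ 5 *ᶻ q P j B -ᶻ ξ P j) → NN (+ 5 *ᶻ p₂ i B (single u) +ᶻ ξ P i)
          each B B⊑ b = pair-balanced d {B} {single u} (λ v t → W⊂ v (∖⊑ (W f) (single u) v (B⊑ v t))) (λ v t → W⊂ v (u⊑ v t)) disj b (far u s) ⊞ NN+ 1 by alg′ (+ 5 *ᶻ p₂ i B (single u) +ᶻ ξ P i)
            where
            alg′ : ∀ x → x -ᶻ 1ℤ +ᶻ 1ℤ ≡ x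
            alg′ = solve-∀
            disj : ∀ v → single u v ≡ true → B v ≡ false
            disj v t = lem (B v) refl
              where lem : ∀ b → B v ≡ b → b ≡ false
                    lem false _ = refl
                    lem true h = contradiction (trans (sym t) (∖-disj (W f) (single u) v (B⊑ v h))) λ ()
          alg : ∀ x a b y → a ≡ b → x +ᶻ + 5 *ᶻ a +ᶻ + 5 *ᶻ ((+ 2 -ᶻ 1ℤ) *ᶻ y) ≡ x +ᶻ + 5 *ᶻ b +ᶻ + 5 *ᶻ y
          alg x a b y refl = alg₀ x a y
            where alg₀ : ∀ x a y → x +ᶻ + 5 *ᶻ a +ᶻ + 5 *ᶻ ((+ 2 -ᶻ 1ℤ) *ᶻ y) ≡ x +ᶻ + 5 *ᶻ a +ᶻ + 5 *ᶻ y
                  alg₀ = solve-∀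
        α : ℤ
        α = + 2 *ᶻ ξ P i +ᶻ + 5 *ᶻ p P i (W f)
        both : Holds (dense₂ᶠ k′ f i a)
        both = sumUp (pick (class cl a) k′ k′≤)
          where
          sumUp : (∃ λ (U : Part {n}) → U ⊑ class cl a × ∣ U ∣ᵇ full ≡ k′) → Holds (dense₂ᶠ k′ f i a)
          sumUp (U , U⊑ , U-size) = csum U (λ e → + 5 *ᶻ ω i (κ cl e)) α
              (λ u t → at u (U⊑ u t) by cong (α +ᶻ_) (trans (cong (+ 5 *ᶻ_) (p-inc i u)) (sym (I-* u (+ 5) (ω i)))))
              ⊞ 5 ⊡ L-mono {U} {a} (ω i) (ω-NN i) U⊑
            by trans (cong₂ (λ r s → + r *ᶻ α +ᶻ s +ᶻ + 5 *ᶻ (S (L a (ω i)) -ᶻ C)) U-size (trans (∑-cong E (λ e → ℤₚ.*-assoc (+ 5) (ω i (κ cl e)) (+ ∣ U ∣ᵇ e))) (∑-* E (+ 5) (λ e → ω i (κ cl e) *ᶻ + ∣ U ∣ᵇ e))))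
              (trans (alg (+ k′ *ᶻ α) C (S (L a (ω i)))) (sym (trans (S-+ (λ t → + k′ *ᶻ denseᶠ 2 f i t) (λ t → + 5 *ᶻ L a (ω i) t))
                (cong₂ _+ᶻ_ (trans (S-* (+ k′) (denseᶠ 2 f i)) (cong (+ k′ *ᶻ_) (S-dense 2 f i))) (S-* (+ 5) (L a (ω i)))))))
            where
            C : ℤ
            C = ∑ E (λ e → ω i (κ cl e) *ᶻ + ∣ U ∣ᵇ e)
            alg : ∀ x c c′ → x +ᶻ + 5 *ᶻ c +ᶻ + 5 *ᶻ (c′ -ᶻ c) ≡ x +ᶻ + 5 *ᶻ c′
            alg = solve-∀
      go : NN (+ 4 *ᶻ ξ P j -ᶻ + 5 *ᶻ q P j (W f)) ⊎ NN (+ 5 *ᶻ q P j (W f) -ᶻ + 4 *ᶻ ξ P j -ᶻ 1ℤ) → Holds (sparseᶠ 4 f j) ⊎ Holds (dense₂ᶠ k′ f i a)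
      go (inj₁ h) = inj₁ (sparse-holds 4 f j h)
      go (inj₂ h) = inj₂ (One.both (weaken1 {+ 5 *ᶻ q P j (W f)} {+ 4 *ᶻ ξ P j} h))

pattern f0 = Fin.zero
pattern f1 = Fin.suc f0
pattern f2 = Fin.suc f1
pattern f3 = Fin.suc f2
pattern f4 = Fin.suc f3
pattern f5 = Fin.suc f4
pattern f6 = Fin.suc f5
pattern f7 = Fin.suc f6
pattern f8 = Fin.suc f7

start : ∀ {c} → State c
start {c} = Vec.replicate c (0 , false)

-- Recolouring a single vertex

module Local {n} (E : List (Subset n)) {P : Colouring {n}} (opt : Extremal.Optimal E P) where
  open Extremal E
  open Moves opt

  q-NN : ∀ j B → NN (q P j B)
  q-NN j B = ∑-NN E _ (λ e → z-anti (ℕₚ.m≤m+n (ct P j e) (∣ B ∣ᵇ e)))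

  module _ {i j k} (d : Distinct i j k) {v} (Pv : P v ≡ i) where
    private
      B⊂ = single⊂ {P = P} Pv
      x≥0 = p-NN P i (single v)
      y≥0 = q-NN j (single v)

    -- Each edge lost by a bad part costs 10 + 5; each edge won by `j` saves at least 10, whatever
    -- its hinge does.
    from-bad : NN (ξ P i) → NN (+ 3 *ᶻ (p P i (single v)) -ᶻ + 2 *ᶻ (q P j (single v)))
    from-bad a≥0 = NN-cancel 4 (move d B⊂ {U = (ξ P i) +ᶻ + 5 *ᶻ (p P i (single v))} {W = pos (ξ P j)} {X = (ξ P i)} {Y = pos (ξ P j)} (a≥0 ⊞ 5 ⊡ x≥0) (NN+ 0 by s₀ ((ξ P i) +ᶻ + 5 *ᶻ (p P i (single v)))) (pos-NN (ξ P j))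
        (pos-≥ (ξ P j) ⊞ 5 ⊡ y≥0 by s₁ (pos (ξ P j)) (ξ P j) (q P j (single v))) (pos-≥ (ξ P i)) (NN+ 0 by s₀ (pos (ξ P j))) by s₂ (p P i (single v)) (q P j (single v)) (ξ P i) (pos (ξ P j)))
      where
      s₀ : ∀ u → 0ℤ ≡ u -ᶻ u
      s₀ = solve-∀
      s₁ : ∀ w b y → w -ᶻ b +ᶻ + 5 *ᶻ y ≡ w -ᶻ (b -ᶻ + 5 *ᶻ y)
      s₁ = solve-∀
      s₂ : ∀ x y a w → + 10 *ᶻ x -ᶻ + 10 *ᶻ y +ᶻ (a +ᶻ + 5 *ᶻ x -ᶻ a) +ᶻ (w -ᶻ w) ≡ + 5 *ᶻ (+ 3 *ᶻ x -ᶻ + 2 *ᶻ y)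
      s₂ = solve-∀

    -- The receiving part does not drop below its threshold, so its hinge falls by the full `5q` and
    -- both sides have slope 15.
    bad-near : NN (ξ P i) → NN ((ξ P j) -ᶻ + 5 *ᶻ (q P j (single v))) → NN (+ 1 *ᶻ (p P i (single v)) -ᶻ + 1 *ᶻ (q P j (single v)))
    bad-near a≥0 near = NN-cancel 14 (move d B⊂ {U = (ξ P i) +ᶻ + 5 *ᶻ (p P i (single v))} {W = (ξ P j) -ᶻ + 5 *ᶻ (q P j (single v))} {X = (ξ P i)} {Y = (ξ P j)} (a≥0 ⊞ 5 ⊡ x≥0) (NN+ 0 by s₀ ((ξ P i) +ᶻ + 5 *ᶻ (p P i (single v)))) near
        (NN+ 0 by s₀ ((ξ P j) -ᶻ + 5 *ᶻ (q P j (single v)))) (pos-≥ (ξ P i)) (pos-≥ (ξ P j)) by s₂ (p P i (single v)) (q P j (single v)) (ξ P i) (ξ P j))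
      where
      s₀ : ∀ u → 0ℤ ≡ u -ᶻ u
      s₀ = solve-∀
      s₂ : ∀ x y a b → + 10 *ᶻ x -ᶻ + 10 *ᶻ y +ᶻ (a +ᶻ + 5 *ᶻ x -ᶻ a) +ᶻ (b -ᶻ + 5 *ᶻ y -ᶻ b) ≡ + 15 *ᶻ (+ 1 *ᶻ x -ᶻ + 1 *ᶻ y)
      s₂ = solve-∀

    -- The vertex alone repairs `j`, so the hinge of `j` saves all of ξ and no more.
    bad-far : NN (ξ P i) → NN (+ 5 *ᶻ (q P j (single v)) -ᶻ (ξ P j)) → NN (+ 15 *ᶻ (p P i (single v)) -ᶻ + 10 *ᶻ (q P j (single v)) -ᶻ (ξ P j))
    bad-far a≥0 far = move d B⊂ {U = (ξ P i) +ᶻ + 5 *ᶻ (p P i (single v))} {W = 0ℤ} {X = (ξ P i)} {Y = (ξ P j)} (a≥0 ⊞ 5 ⊡ x≥0) (NN+ 0 by s₀ ((ξ P i) +ᶻ + 5 *ᶻ (p P i (single v)))) (NN+ 0)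
        (far by s₁ (ξ P j) (q P j (single v))) (pos-≥ (ξ P i)) (pos-≥ (ξ P j)) by s₂ (p P i (single v)) (q P j (single v)) (ξ P i) (ξ P j)
      where
      s₀ : ∀ u → 0ℤ ≡ u -ᶻ u
      s₀ = solve-∀
      s₁ : ∀ b y → + 5 *ᶻ y -ᶻ b ≡ 0ℤ -ᶻ (b -ᶻ + 5 *ᶻ y)
      s₁ = solve-∀
      s₂ : ∀ x y a b → + 10 *ᶻ x -ᶻ + 10 *ᶻ y +ᶻ (a +ᶻ + 5 *ᶻ x -ᶻ a) +ᶻ (0ℤ -ᶻ b) ≡ + 15 *ᶻ x -ᶻ + 10 *ᶻ y -ᶻ b
      s₂ = solve-∀

    -- The part left behind stays good and pays no hinge, while every edge won at `j` saves 15.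
    low-near : NN (neg ((ξ P i) +ᶻ + 5 *ᶻ (p P i (single v)))) → NN ((ξ P j) -ᶻ + 5 *ᶻ (q P j (single v))) → NN (+ 2 *ᶻ (p P i (single v)) -ᶻ + 3 *ᶻ (q P j (single v)))
    low-near low near = NN-cancel 4 (move d B⊂ {U = 0ℤ} {W = (ξ P j) -ᶻ + 5 *ᶻ (q P j (single v))} {X = 0ℤ} {Y = (ξ P j)} (NN+ 0) (low by s₁ ((ξ P i) +ᶻ + 5 *ᶻ (p P i (single v)))) near
        (NN+ 0 by s₀ ((ξ P j) -ᶻ + 5 *ᶻ (q P j (single v)))) (pos-NN (ξ P i) by sym (ℤₚ.+-identityʳ (pos (ξ P i)))) (pos-≥ (ξ P j)) by s₂ (p P i (single v)) (q P j (single v)) (ξ P j))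
      where
      s₀ : ∀ u → 0ℤ ≡ u -ᶻ u
      s₀ = solve-∀
      s₁ : ∀ u → neg u ≡ 0ℤ -ᶻ u
      s₁ = solve-∀
      s₂ : ∀ x y b → + 10 *ᶻ x -ᶻ + 10 *ᶻ y +ᶻ (0ℤ -ᶻ 0ℤ) +ᶻ (b -ᶻ + 5 *ᶻ y -ᶻ b) ≡ + 5 *ᶻ (+ 2 *ᶻ x -ᶻ + 3 *ᶻ y)
      s₂ = solve-∀

    low-far : NN (neg ((ξ P i) +ᶻ + 5 *ᶻ (p P i (single v)))) → NN (+ 5 *ᶻ (q P j (single v)) -ᶻ (ξ P j)) → NN (+ 10 *ᶻ (p P i (single v)) -ᶻ + 10 *ᶻ (q P j (single v)) -ᶻ (ξ P j))
    low-far low far = move d B⊂ {U = 0ℤ} {W = 0ℤ} {X = 0ℤ} {Y = (ξ P j)} (NN+ 0) (low by s₁ ((ξ P i) +ᶻ + 5 *ᶻ (p P i (single v)))) (NN+ 0)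
        (far by s₃ (ξ P j) (q P j (single v))) (pos-NN (ξ P i) by sym (ℤₚ.+-identityʳ (pos (ξ P i)))) (pos-≥ (ξ P j)) by s₂ (p P i (single v)) (q P j (single v)) (ξ P j)
      where
      s₁ : ∀ u → neg u ≡ 0ℤ -ᶻ u
      s₁ = solve-∀
      s₃ : ∀ b y → + 5 *ᶻ y -ᶻ b ≡ 0ℤ -ᶻ (b -ᶻ + 5 *ᶻ y)
      s₃ = solve-∀
      s₂ : ∀ x y b → + 10 *ᶻ x -ᶻ + 10 *ᶻ y +ᶻ (0ℤ -ᶻ 0ℤ) +ᶻ (0ℤ -ᶻ b) ≡ + 10 *ᶻ x -ᶻ + 10 *ᶻ y -ᶻ b
      s₂ = solve-∀

    -- The departure takes `i` to its threshold or above, so the new hinge is ξ + 5p; the old one is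
    -- bounded below by 0.
    high : NN ((ξ P i) +ᶻ + 5 *ᶻ (p P i (single v))) → NN (+ 15 *ᶻ (p P i (single v)) -ᶻ + 10 *ᶻ (q P j (single v)) -ᶻ neg (ξ P i))
    high hi = move d B⊂ {U = (ξ P i) +ᶻ + 5 *ᶻ (p P i (single v))} {W = pos (ξ P j)} {X = 0ℤ} {Y = pos (ξ P j)} hi (NN+ 0 by s₀ ((ξ P i) +ᶻ + 5 *ᶻ (p P i (single v)))) (pos-NN (ξ P j))
        (pos-≥ (ξ P j) ⊞ 5 ⊡ y≥0 by s₁ (pos (ξ P j)) (ξ P j) (q P j (single v))) (pos-NN (ξ P i) by sym (ℤₚ.+-identityʳ (pos (ξ P i)))) (NN+ 0 by s₀ (pos (ξ P j))) by s₂ (p P i (single v)) (q P j (single v)) (ξ P i) (pos (ξ P j))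
      where
      s₀ : ∀ u → 0ℤ ≡ u -ᶻ u
      s₀ = solve-∀
      s₁ : ∀ w b y → w -ᶻ b +ᶻ + 5 *ᶻ y ≡ w -ᶻ (b -ᶻ + 5 *ᶻ y)
      s₁ = solve-∀
      s₂ : ∀ x y a w → + 10 *ᶻ x -ᶻ + 10 *ᶻ y +ᶻ (a +ᶻ + 5 *ᶻ x -ᶻ 0ℤ) +ᶻ (w -ᶻ w) ≡ + 15 *ᶻ x -ᶻ + 10 *ᶻ y -ᶻ neg a
      s₂ = solve-∀

    high-near : NN ((ξ P i) +ᶻ + 5 *ᶻ (p P i (single v))) → NN ((ξ P j) -ᶻ + 5 *ᶻ (q P j (single v))) → NN (+ 15 *ᶻ (p P i (single v)) -ᶻ + 15 *ᶻ (q P j (single v)) +ᶻ (ξ P i))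
    high-near hi near = move d B⊂ {U = (ξ P i) +ᶻ + 5 *ᶻ (p P i (single v))} {W = (ξ P j) -ᶻ + 5 *ᶻ (q P j (single v))} {X = 0ℤ} {Y = (ξ P j)} hi (NN+ 0 by s₀ ((ξ P i) +ᶻ + 5 *ᶻ (p P i (single v)))) near
        (NN+ 0 by s₀ ((ξ P j) -ᶻ + 5 *ᶻ (q P j (single v)))) (pos-NN (ξ P i) by sym (ℤₚ.+-identityʳ (pos (ξ P i)))) (pos-≥ (ξ P j)) by s₂ (p P i (single v)) (q P j (single v)) (ξ P i) (ξ P j)
      where
      s₀ : ∀ u → 0ℤ ≡ u -ᶻ u
      s₀ = solve-∀
      s₂ : ∀ x y a b → + 10 *ᶻ x -ᶻ + 10 *ᶻ y +ᶻ (a +ᶻ + 5 *ᶻ x -ᶻ 0ℤ) +ᶻ (b -ᶻ + 5 *ᶻ y -ᶻ b) ≡ + 15 *ᶻ x -ᶻ + 15 *ᶻ y +ᶻ a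
      s₂ = solve-∀

    high-far : NN ((ξ P i) +ᶻ + 5 *ᶻ (p P i (single v))) → NN (+ 5 *ᶻ (q P j (single v)) -ᶻ (ξ P j)) → NN (+ 15 *ᶻ (p P i (single v)) -ᶻ + 10 *ᶻ (q P j (single v)) -ᶻ ((ξ P j) -ᶻ (ξ P i)))
    high-far hi far = move d B⊂ {U = (ξ P i) +ᶻ + 5 *ᶻ (p P i (single v))} {W = 0ℤ} {X = 0ℤ} {Y = (ξ P j)} hi (NN+ 0 by s₀ ((ξ P i) +ᶻ + 5 *ᶻ (p P i (single v)))) (NN+ 0)
        (far by s₃ (ξ P j) (q P j (single v))) (pos-NN (ξ P i) by sym (ℤₚ.+-identityʳ (pos (ξ P i)))) (pos-≥ (ξ P j)) by s₂ (p P i (single v)) (q P j (single v)) (ξ P i) (ξ P j)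
      where
      s₀ : ∀ u → 0ℤ ≡ u -ᶻ u
      s₀ = solve-∀
      s₃ : ∀ b y → + 5 *ᶻ y -ᶻ b ≡ 0ℤ -ᶻ (b -ᶻ + 5 *ᶻ y)
      s₃ = solve-∀
      s₂ : ∀ x y a b → + 10 *ᶻ x -ᶻ + 10 *ᶻ y +ᶻ (a +ᶻ + 5 *ᶻ x -ᶻ 0ℤ) +ᶻ (0ℤ -ᶻ b) ≡ + 15 *ᶻ x -ᶻ + 10 *ᶻ y -ᶻ (b -ᶻ a)
      s₂ = solve-∀

-- Case trees with their multipliers

tree₁ : Tree 5
tree₁ =
  (branch f0
   (branch f2
    (dich 2
     (dich 0
      (leaf (6 ∷ 0 ∷ 1 ∷ 0 ∷ 0 ∷ 0 ∷ 14 ∷ 0 ∷ 0 ∷ 0 ∷ 0 ∷ 7 ∷ []) ([]))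
      (leaf (1 ∷ 0 ∷ 0 ∷ 0 ∷ 10 ∷ 10 ∷ 0 ∷ 0 ∷ 0 ∷ 0 ∷ 4 ∷ []) ([])))
     (dich 0
      (dich 1
       (leaf (1 ∷ 0 ∷ 1 ∷ 0 ∷ 0 ∷ 0 ∷ 0 ∷ 0 ∷ 0 ∷ 0 ∷ 0 ∷ 0 ∷ 0 ∷ 1 ∷ []) ([]))
       (leaf (1 ∷ 20 ∷ 0 ∷ 3 ∷ 0 ∷ 0 ∷ 0 ∷ 50 ∷ 0 ∷ 0 ∷ 0 ∷ 0 ∷ 38 ∷ []) ([])))
      (leaf (1 ∷ 0 ∷ 0 ∷ 0 ∷ 10 ∷ 10 ∷ 0 ∷ 0 ∷ 0 ∷ 0 ∷ 4 ∷ []) ([]))))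
    (branch f2
     (dich 2
      (dich 0
       (leaf (12 ∷ 0 ∷ 2 ∷ 0 ∷ 2 ∷ 0 ∷ 29 ∷ 0 ∷ 0 ∷ 0 ∷ 0 ∷ 16 ∷ []) ([]))
       (leaf (3 ∷ 0 ∷ 0 ∷ 2 ∷ 30 ∷ 30 ∷ 0 ∷ 0 ∷ 0 ∷ 0 ∷ 14 ∷ []) ([])))
      (dich 0
       (dich 1
        (leaf (11 ∷ 0 ∷ 10 ∷ 0 ∷ 2 ∷ 0 ∷ 1 ∷ 0 ∷ 0 ∷ 0 ∷ 0 ∷ 0 ∷ 0 ∷ 19 ∷ []) ([]))
        (leaf (1 ∷ 5 ∷ 0 ∷ 0 ∷ 0 ∷ 1 ∷ 0 ∷ 11 ∷ 0 ∷ 0 ∷ 0 ∷ 0 ∷ 7 ∷ []) ([])))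
       (leaf (3 ∷ 0 ∷ 0 ∷ 2 ∷ 30 ∷ 30 ∷ 0 ∷ 0 ∷ 0 ∷ 0 ∷ 14 ∷ []) ([]))))
     (branch f2
      (dich 2
       (leaf (9 ∷ 0 ∷ 4 ∷ 50 ∷ 45 ∷ 0 ∷ 0 ∷ 0 ∷ 0 ∷ 9 ∷ []) ([]))
       (dich 0
        (leaf (5 ∷ 0 ∷ 1 ∷ 0 ∷ 1 ∷ 0 ∷ 15 ∷ 0 ∷ 0 ∷ 0 ∷ 0 ∷ 11 ∷ []) ([]))
        (leaf (7 ∷ 0 ∷ 0 ∷ 6 ∷ 70 ∷ 60 ∷ 0 ∷ 0 ∷ 0 ∷ 0 ∷ 44 ∷ []) ([]))))
      (dich 2
       (leaf (3 ∷ 0 ∷ 2 ∷ 20 ∷ 15 ∷ 0 ∷ 0 ∷ 0 ∷ 0 ∷ 9 ∷ []) ([]))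
       (dich 0
        (leaf (22 ∷ 0 ∷ 4 ∷ 0 ∷ 6 ∷ 0 ∷ 48 ∷ 0 ∷ 0 ∷ 0 ∷ 0 ∷ 64 ∷ []) ([]))
        (leaf (3 ∷ 0 ∷ 0 ∷ 4 ∷ 40 ∷ 30 ∷ 0 ∷ 0 ∷ 0 ∷ 0 ∷ 34 ∷ []) ([])))))))
   (branch f0
    (branch f2
     (dich 3
      (dich 0
       (leaf (60 ∷ 0 ∷ 21 ∷ 8 ∷ 0 ∷ 0 ∷ 150 ∷ 0 ∷ 0 ∷ 0 ∷ 0 ∷ 29 ∷ []) ([]))
       (leaf (1 ∷ 1 ∷ 1 ∷ 0 ∷ 15 ∷ 15 ∷ 0 ∷ 0 ∷ 0 ∷ 0 ∷ 4 ∷ []) ([])))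
      (dich 0
       (dich 1
        (leaf (10 ∷ 0 ∷ 11 ∷ 0 ∷ 2 ∷ 1 ∷ 0 ∷ 0 ∷ 0 ∷ 0 ∷ 0 ∷ 0 ∷ 0 ∷ 19 ∷ []) ([]))
        (leaf (3 ∷ 10 ∷ 0 ∷ 0 ∷ 2 ∷ 0 ∷ 0 ∷ 30 ∷ 0 ∷ 0 ∷ 0 ∷ 0 ∷ 14 ∷ []) ([])))
       (leaf (27 ∷ 30 ∷ 20 ∷ 0 ∷ 300 ∷ 300 ∷ 10 ∷ 0 ∷ 0 ∷ 0 ∷ 164 ∷ []) ([]))))
     (branch f2
      (dich 4
       (dich 5
        (dich 0
         (leaf (45 ∷ 0 ∷ 21 ∷ 0 ∷ 6 ∷ 4 ∷ 0 ∷ 60 ∷ 0 ∷ 0 ∷ 0 ∷ 0 ∷ 11 ∷ []) ([]))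
         (leaf (9 ∷ 12 ∷ 0 ∷ 9 ∷ 7 ∷ 135 ∷ 105 ∷ 0 ∷ 0 ∷ 0 ∷ 0 ∷ 38 ∷ []) ([])))
        (leaf (6 ∷ 27 ∷ 4 ∷ 9 ∷ 60 ∷ 120 ∷ 0 ∷ 0 ∷ 0 ∷ 0 ∷ 11 ∷ []) ([])))
       (dich 5
        (leaf (51 ∷ 9 ∷ 18 ∷ 8 ∷ 225 ∷ 120 ∷ 0 ∷ 0 ∷ 0 ∷ 0 ∷ 23 ∷ []) ([]))
        (dich 0
         (dich 1
          (leaf (6 ∷ 0 ∷ 5 ∷ 0 ∷ 1 ∷ 1 ∷ 1 ∷ 1 ∷ 0 ∷ 0 ∷ 0 ∷ 0 ∷ 0 ∷ 0 ∷ 11 ∷ []) ([]))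
          (leaf (11 ∷ 65 ∷ 0 ∷ 0 ∷ 1 ∷ 9 ∷ 11 ∷ 0 ∷ 165 ∷ 0 ∷ 0 ∷ 0 ∷ 0 ∷ 92 ∷ []) ([])))
         (leaf (27 ∷ 30 ∷ 0 ∷ 20 ∷ 30 ∷ 300 ∷ 300 ∷ 10 ∷ 0 ∷ 0 ∷ 0 ∷ 194 ∷ []) ([])))))
      (branch f2
       (dich 2
        (dich 0
         (leaf (2625 ∷ 0 ∷ 1173 ∷ 350 ∷ 633 ∷ 0 ∷ 9495 ∷ 0 ∷ 0 ∷ 0 ∷ 0 ∷ 1514 ∷ []) ((15 , (true ∷ false ∷ true ∷ false ∷ false ∷ [])) ∷ []))
         (leaf (3 ∷ 7 ∷ 3 ∷ 5 ∷ 45 ∷ 50 ∷ 0 ∷ 0 ∷ 0 ∷ 0 ∷ 9 ∷ []) ([])))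
        (dich 0
         (leaf (86520 ∷ 0 ∷ 15300 ∷ 16636 ∷ 18465 ∷ 0 ∷ 276975 ∷ 9020 ∷ 0 ∷ 0 ∷ 0 ∷ 230999 ∷ []) ((225 , (true ∷ false ∷ true ∷ false ∷ false ∷ [])) ∷ []))
         (dich 1
          (leaf (330 ∷ 0 ∷ 99 ∷ 0 ∷ 50 ∷ 60 ∷ 750 ∷ 0 ∷ 70 ∷ 0 ∷ 0 ∷ 0 ∷ 434 ∷ []) ([]))
          (leaf (3 ∷ 0 ∷ 5 ∷ 5 ∷ 6 ∷ 75 ∷ 75 ∷ 0 ∷ 0 ∷ 0 ∷ 0 ∷ 64 ∷ []) ([])))))
       (dich 2
        (leaf (18 ∷ 5 ∷ 9 ∷ 75 ∷ 90 ∷ 0 ∷ 0 ∷ 0 ∷ 0 ∷ 14 ∷ []) ([]))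
        (leaf (2 ∷ 3 ∷ 3 ∷ 35 ∷ 30 ∷ 0 ∷ 0 ∷ 0 ∷ 0 ∷ 38 ∷ []) ([]))))))
    (branch f0
     (branch f2
      (dich 3
       (leaf (9 ∷ 4 ∷ 0 ∷ 45 ∷ 50 ∷ 0 ∷ 0 ∷ 0 ∷ 0 ∷ 9 ∷ []) ([]))
       (dich 0
        (dich 1
         (leaf (5 ∷ 0 ∷ 5 ∷ 0 ∷ 1 ∷ 1 ∷ 0 ∷ 0 ∷ 0 ∷ 0 ∷ 0 ∷ 0 ∷ 0 ∷ 11 ∷ []) ([]))
         (leaf (7 ∷ 21 ∷ 0 ∷ 0 ∷ 6 ∷ 0 ∷ 0 ∷ 70 ∷ 0 ∷ 0 ∷ 0 ∷ 0 ∷ 44 ∷ []) ([])))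
        (dich 1
         (leaf (5 ∷ 0 ∷ 0 ∷ 1 ∷ 1 ∷ 0 ∷ 15 ∷ 0 ∷ 0 ∷ 0 ∷ 0 ∷ 0 ∷ 11 ∷ []) ([]))
         (leaf (13 ∷ 0 ∷ 2 ∷ 12 ∷ 0 ∷ 150 ∷ 150 ∷ 0 ∷ 0 ∷ 0 ∷ 0 ∷ 98 ∷ []) ([])))))
      (branch f2
       (dich 3
        (dich 0
         (leaf (9495 ∷ 0 ∷ 2793 ∷ 1266 ∷ 1117 ∷ 0 ∷ 16755 ∷ 0 ∷ 0 ∷ 0 ∷ 0 ∷ 3944 ∷ []) ((75 , (true ∷ false ∷ true ∷ false ∷ false ∷ [])) ∷ []))
         (leaf (1899 ∷ 3888 ∷ 2562 ∷ 2120 ∷ 44610 ∷ 31800 ∷ 0 ∷ 0 ∷ 0 ∷ 0 ∷ 9314 ∷ []) ((90 , (true ∷ false ∷ true ∷ false ∷ false ∷ [])) ∷ [])))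
        (dich 0
         (dich 1
          (leaf (34840 ∷ 0 ∷ 52425 ∷ 0 ∷ 9430 ∷ 6990 ∷ 5737 ∷ 0 ∷ 0 ∷ 0 ∷ 7615 ∷ 0 ∷ 0 ∷ 94009 ∷ []) ((75 , (true ∷ false ∷ true ∷ false ∷ false ∷ [])) ∷ []))
          (leaf (99 ∷ 330 ∷ 0 ∷ 0 ∷ 60 ∷ 50 ∷ 0 ∷ 750 ∷ 0 ∷ 70 ∷ 0 ∷ 0 ∷ 434 ∷ []) ([])))
         (leaf (3 ∷ 5 ∷ 6 ∷ 5 ∷ 75 ∷ 75 ∷ 0 ∷ 0 ∷ 0 ∷ 0 ∷ 64 ∷ []) ([]))))
       (branch f2
        (dich 2
         (dich 0
          (dich 1
           (leaf (90 ∷ 0 ∷ 86 ∷ 0 ∷ 0 ∷ 11 ∷ 12 ∷ 0 ∷ 0 ∷ 0 ∷ 0 ∷ 0 ∷ 0 ∷ 177 ∷ []) ((1 , (true ∷ false ∷ true ∷ false ∷ false ∷ [])) ∷ []))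
           (leaf (19 ∷ 75 ∷ 0 ∷ 3 ∷ 10 ∷ 10 ∷ 0 ∷ 100 ∷ 0 ∷ 20 ∷ 0 ∷ 0 ∷ 69 ∷ []) ([])))
          (dich 1
           (leaf (26385 ∷ 0 ∷ 5840 ∷ 0 ∷ 3518 ∷ 3518 ∷ 38345 ∷ 0 ∷ 5830 ∷ 0 ∷ 0 ∷ 0 ∷ 32344 ∷ []) ((15 , (true ∷ false ∷ true ∷ false ∷ false ∷ [])) ∷ []))
           (leaf (1 ∷ 1 ∷ 0 ∷ 2 ∷ 2 ∷ 20 ∷ 20 ∷ 0 ∷ 0 ∷ 0 ∷ 0 ∷ 19 ∷ []) ([]))))
         (dich 0
          (dich 1
           (leaf (211080 ∷ 0 ∷ 126295 ∷ 4151 ∷ 33914 ∷ 28144 ∷ 28144 ∷ 0 ∷ 0 ∷ 46640 ∷ 0 ∷ 0 ∷ 0 ∷ 411372 ∷ []) ((120 , (true ∷ false ∷ true ∷ false ∷ false ∷ [])) ∷ []))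
           (leaf (3 ∷ 22 ∷ 0 ∷ 2 ∷ 6 ∷ 6 ∷ 0 ∷ 60 ∷ 0 ∷ 0 ∷ 0 ∷ 0 ∷ 68 ∷ []) ([])))
          (dich 1
           (leaf (158310 ∷ 0 ∷ 15831 ∷ 12806 ∷ 21108 ∷ 21108 ∷ 252590 ∷ 0 ∷ 34980 ∷ 0 ∷ 0 ∷ 0 ∷ 251696 ∷ []) ((90 , (true ∷ false ∷ true ∷ false ∷ false ∷ [])) ∷ []))
           (leaf (3 ∷ 0 ∷ 2 ∷ 6 ∷ 6 ∷ 65 ∷ 60 ∷ 0 ∷ 0 ∷ 0 ∷ 0 ∷ 68 ∷ []) ([])))))
        (branch f2
         (dich 2
          (dich 0
           (dich 1
            (leaf (2915 ∷ 0 ∷ 2915 ∷ 0 ∷ 0 ∷ 558 ∷ 558 ∷ 0 ∷ 0 ∷ 0 ∷ 0 ∷ 0 ∷ 0 ∷ 8444 ∷ []) ((15 , (true ∷ false ∷ true ∷ false ∷ false ∷ [])) ∷ []))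
            (leaf (14 ∷ 75 ∷ 0 ∷ 3 ∷ 10 ∷ 10 ∷ 0 ∷ 100 ∷ 0 ∷ 20 ∷ 0 ∷ 0 ∷ 94 ∷ []) ([])))
           (leaf (1 ∷ 0 ∷ 2 ∷ 2 ∷ 20 ∷ 20 ∷ 0 ∷ 0 ∷ 0 ∷ 0 ∷ 24 ∷ []) ([])))
          (leaf (1 ∷ 3 ∷ 3 ∷ 33 ∷ 30 ∷ 0 ∷ 0 ∷ 0 ∷ 0 ∷ 41 ∷ []) ([])))
         (branch f2
          (dich 2
           (leaf (1899 ∷ 2254 ∷ 2254 ∷ 33810 ∷ 32035 ∷ 0 ∷ 1610 ∷ 0 ∷ 0 ∷ 27179 ∷ []) ((45 , (true ∷ false ∷ true ∷ false ∷ false ∷ [])) ∷ []))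
           (leaf (22 ∷ 33 ∷ 34 ∷ 384 ∷ 340 ∷ 25 ∷ 11 ∷ 0 ∷ 0 ∷ 499 ∷ []) ([])))
          (branch f2
           (dich 2
            (leaf (2573 ∷ 1729 ∷ 1729 ∷ 25935 ∷ 21510 ∷ 0 ∷ 2470 ∷ 0 ∷ 0 ∷ 17124 ∷ []) ((20 , (true ∷ false ∷ true ∷ false ∷ false ∷ [])) ∷ []))
            (leaf (11 ∷ 16 ∷ 15 ∷ 186 ∷ 150 ∷ 8 ∷ 17 ∷ 0 ∷ 0 ∷ 241 ∷ []) ([])))
           (dich 2
            (leaf (90 ∷ 50 ∷ 49 ∷ 750 ∷ 490 ∷ 0 ∷ 105 ∷ 0 ∷ 0 ∷ 449 ∷ []) ([]))
            (leaf (14 ∷ 21 ∷ 18 ∷ 244 ∷ 180 ∷ 7 ∷ 34 ∷ 0 ∷ 0 ∷ 317 ∷ []) ([])))))))))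
     (branch f2
      (dich 3
       (leaf (5 ∷ 4 ∷ 0 ∷ 40 ∷ 50 ∷ 0 ∷ 0 ∷ 0 ∷ 0 ∷ 29 ∷ []) ([]))
       (dich 0
        (dich 1
         (leaf (12 ∷ 0 ∷ 7 ∷ 0 ∷ 0 ∷ 2 ∷ 0 ∷ 0 ∷ 0 ∷ 0 ∷ 0 ∷ 0 ∷ 0 ∷ 26 ∷ []) ([]))
         (leaf (1 ∷ 3 ∷ 0 ∷ 0 ∷ 1 ∷ 0 ∷ 0 ∷ 10 ∷ 0 ∷ 0 ∷ 0 ∷ 0 ∷ 7 ∷ []) ([])))
        (dich 1
         (leaf (12 ∷ 0 ∷ 0 ∷ 1 ∷ 3 ∷ 0 ∷ 22 ∷ 0 ∷ 0 ∷ 0 ∷ 0 ∷ 0 ∷ 33 ∷ []) ([]))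
         (leaf (1 ∷ 0 ∷ 1 ∷ 2 ∷ 0 ∷ 20 ∷ 25 ∷ 0 ∷ 0 ∷ 0 ∷ 0 ∷ 21 ∷ []) ([])))))
      (branch f2
       (dich 3
        (leaf (18 ∷ 9 ∷ 5 ∷ 90 ∷ 75 ∷ 0 ∷ 0 ∷ 0 ∷ 0 ∷ 14 ∷ []) ([]))
        (leaf (2 ∷ 3 ∷ 3 ∷ 30 ∷ 35 ∷ 0 ∷ 0 ∷ 0 ∷ 0 ∷ 38 ∷ []) ([])))
       (branch f2
        (branch f0
         (dich 3
          (dich 0
           (leaf (2915 ∷ 0 ∷ 75 ∷ 558 ∷ 558 ∷ 0 ∷ 8370 ∷ 0 ∷ 0 ∷ 0 ∷ 0 ∷ 8069 ∷ []) ((15 , (true ∷ false ∷ true ∷ false ∷ false ∷ [])) ∷ []))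
           (leaf (7 ∷ 9 ∷ 5 ∷ 5 ∷ 50 ∷ 75 ∷ 10 ∷ 0 ∷ 0 ∷ 0 ∷ 9 ∷ []) ([])))
          (leaf (1 ∷ 3 ∷ 3 ∷ 30 ∷ 33 ∷ 0 ∷ 0 ∷ 0 ∷ 0 ∷ 41 ∷ []) ([])))
         (branch f0
          (dich 3
           (leaf (1899 ∷ 2254 ∷ 2254 ∷ 32035 ∷ 33810 ∷ 1610 ∷ 0 ∷ 0 ∷ 0 ∷ 27179 ∷ []) ((45 , (true ∷ false ∷ true ∷ false ∷ false ∷ [])) ∷ []))
           (leaf (78 ∷ 192 ∷ 196 ∷ 1920 ∷ 2550 ∷ 95 ∷ 0 ∷ 0 ∷ 0 ∷ 2965 ∷ []) ([])))
          (branch f0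
           (dich 3
            (leaf (2573 ∷ 1729 ∷ 1729 ∷ 21510 ∷ 25935 ∷ 2470 ∷ 0 ∷ 0 ∷ 0 ∷ 17124 ∷ []) ((20 , (true ∷ false ∷ true ∷ false ∷ false ∷ [])) ∷ []))
            (leaf (102 ∷ 192 ∷ 212 ∷ 1920 ∷ 2670 ∷ 235 ∷ 0 ∷ 0 ∷ 0 ∷ 3213 ∷ []) ([])))
           (dich 3
            (leaf (90 ∷ 49 ∷ 50 ∷ 490 ∷ 750 ∷ 105 ∷ 0 ∷ 0 ∷ 0 ∷ 449 ∷ []) ([]))
            (leaf (10 ∷ 15 ∷ 18 ∷ 150 ∷ 218 ∷ 30 ∷ 0 ∷ 0 ∷ 0 ∷ 269 ∷ []) ([]))))))
        (leaf (1 ∷ 1 ∷ 10 ∷ 10 ∷ 0 ∷ 0 ∷ 0 ∷ 0 ∷ 14 ∷ []) ([]))))))))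

-- Branching concerns only the heavy classes `f1`, `f2`, `f3`, `f4`, `f6` and `f8`; the sizes of the
-- other three classes stay unrestricted.
tree₂ : Tree 9
tree₂ =
  (branch f4
   (branch f6
    (leaf (0 ∷ 4 ∷ 0 ∷ 4 ∷ 0 ∷ 1 ∷ 0 ∷ 1 ∷ 0 ∷ 0 ∷ 0 ∷ 10 ∷ 0 ∷ 0 ∷ 0 ∷ 0 ∷ 0 ∷ 0 ∷ 0 ∷ 0 ∷ 1 ∷ 7 ∷ []) ([]))
    (branch f8
     (leaf (4 ∷ 0 ∷ 1 ∷ 0 ∷ 4 ∷ 0 ∷ 1 ∷ 0 ∷ 0 ∷ 0 ∷ 0 ∷ 0 ∷ 0 ∷ 10 ∷ 0 ∷ 0 ∷ 0 ∷ 0 ∷ 0 ∷ 0 ∷ 7 ∷ 1 ∷ []) ([]))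
     (branch f3
      (branch f1
       (leaf (94 ∷ 50 ∷ 0 ∷ 0 ∷ 100 ∷ 15 ∷ 0 ∷ 0 ∷ 0 ∷ 0 ∷ 0 ∷ 200 ∷ 20 ∷ 140 ∷ 14 ∷ 0 ∷ 0 ∷ 0 ∷ 0 ∷ 0 ∷ 231 ∷ 231 ∷ []) ([]))
       (branch f1
        (leaf (25 ∷ 0 ∷ 5 ∷ 0 ∷ 25 ∷ 0 ∷ 0 ∷ 0 ∷ 0 ∷ 0 ∷ 0 ∷ 10 ∷ 1 ∷ 40 ∷ 4 ∷ 0 ∷ 0 ∷ 0 ∷ 0 ∷ 0 ∷ 54 ∷ 24 ∷ 0 ∷ 0 ∷ 0 ∷ 0 ∷ 5 ∷ []) ([]))
        (dich 1
         (leaf (30 ∷ 117 ∷ 0 ∷ 35 ∷ 0 ∷ 100 ∷ 10 ∷ 0 ∷ 0 ∷ 0 ∷ 0 ∷ 0 ∷ 140 ∷ 14 ∷ 240 ∷ 16 ∷ 0 ∷ 0 ∷ 0 ∷ 0 ∷ 0 ∷ 309 ∷ 69 ∷ []) ([]))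
         (branch f8
          (leaf (0 ∷ 1490 ∷ 1350 ∷ 438 ∷ 1380 ∷ 1490 ∷ 405 ∷ 0 ∷ 0 ∷ 0 ∷ 0 ∷ 0 ∷ 4440 ∷ 444 ∷ 3240 ∷ 216 ∷ 0 ∷ 0 ∷ 0 ∷ 0 ∷ 0 ∷ 5027 ∷ 5027 ∷ []) ([]))
          (branch f1
           (leaf (30 ∷ 150 ∷ 500 ∷ 15 ∷ 500 ∷ 50 ∷ 150 ∷ 0 ∷ 0 ∷ 0 ∷ 0 ∷ 0 ∷ 820 ∷ 82 ∷ 580 ∷ 58 ∷ 0 ∷ 0 ∷ 0 ∷ 0 ∷ 0 ∷ 827 ∷ 1129 ∷ []) ([]))
           (dich 1
            (leaf (5922 ∷ 1350 ∷ 0 ∷ 12970 ∷ 936 ∷ 12015 ∷ 0 ∷ 4428 ∷ 0 ∷ 0 ∷ 0 ∷ 0 ∷ 0 ∷ 35280 ∷ 3528 ∷ 0 ∷ 0 ∷ 0 ∷ 0 ∷ 0 ∷ 0 ∷ 0 ∷ 15263 ∷ 15263 ∷ []) ([]))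
            (leaf (180 ∷ 0 ∷ 500 ∷ 3700 ∷ 45 ∷ 4050 ∷ 0 ∷ 1170 ∷ 0 ∷ 0 ∷ 0 ∷ 0 ∷ 0 ∷ 5940 ∷ 594 ∷ 3960 ∷ 396 ∷ 0 ∷ 0 ∷ 0 ∷ 0 ∷ 0 ∷ 5570 ∷ 8369 ∷ []) ([]))))))))
      (branch f3
       (branch f8
        (leaf (13 ∷ 7 ∷ 3 ∷ 10 ∷ 10 ∷ 3 ∷ 3 ∷ 2 ∷ 0 ∷ 0 ∷ 0 ∷ 20 ∷ 2 ∷ 40 ∷ 2 ∷ 0 ∷ 0 ∷ 0 ∷ 0 ∷ 0 ∷ 36 ∷ 29 ∷ 0 ∷ 0 ∷ 0 ∷ 0 ∷ 0 ∷ 0 ∷ 0 ∷ 2 ∷ []) ([]))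
        (branch f2
         (leaf (0 ∷ 50 ∷ 0 ∷ 50 ∷ 0 ∷ 0 ∷ 0 ∷ 4 ∷ 0 ∷ 0 ∷ 0 ∷ 90 ∷ 6 ∷ 70 ∷ 3 ∷ 0 ∷ 0 ∷ 0 ∷ 0 ∷ 0 ∷ 49 ∷ 85 ∷ 0 ∷ 0 ∷ 0 ∷ 0 ∷ 0 ∷ 0 ∷ 0 ∷ 5 ∷ []) ([]))
         (branch f2
          (leaf (0 ∷ 10 ∷ 0 ∷ 10 ∷ 0 ∷ 2 ∷ 0 ∷ 2 ∷ 0 ∷ 0 ∷ 0 ∷ 20 ∷ 2 ∷ 0 ∷ 0 ∷ 0 ∷ 0 ∷ 0 ∷ 0 ∷ 0 ∷ 7 ∷ 23 ∷ 0 ∷ 0 ∷ 0 ∷ 0 ∷ 0 ∷ 0 ∷ 1 ∷ 1 ∷ []) ([]))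
          (dich 0
           (leaf (105 ∷ 225 ∷ 50 ∷ 55 ∷ 150 ∷ 125 ∷ 45 ∷ 55 ∷ 0 ∷ 0 ∷ 0 ∷ 0 ∷ 280 ∷ 28 ∷ 470 ∷ 47 ∷ 0 ∷ 0 ∷ 0 ∷ 0 ∷ 0 ∷ 296 ∷ 499 ∷ 0 ∷ 0 ∷ 30 ∷ 0 ∷ 0 ∷ 0 ∷ 0 ∷ 45 ∷ []) ([]))
           (branch f2
            (leaf (12 ∷ 187 ∷ 33 ∷ 56 ∷ 0 ∷ 190 ∷ 0 ∷ 56 ∷ 0 ∷ 0 ∷ 0 ∷ 0 ∷ 80 ∷ 8 ∷ 400 ∷ 40 ∷ 0 ∷ 0 ∷ 0 ∷ 0 ∷ 0 ∷ 551 ∷ 183 ∷ []) ([]))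
            (branch f1
             (leaf (0 ∷ 25 ∷ 0 ∷ 0 ∷ 0 ∷ 25 ∷ 0 ∷ 5 ∷ 0 ∷ 0 ∷ 0 ∷ 0 ∷ 10 ∷ 1 ∷ 40 ∷ 4 ∷ 0 ∷ 0 ∷ 0 ∷ 0 ∷ 0 ∷ 58 ∷ 24 ∷ 0 ∷ 0 ∷ 0 ∷ 0 ∷ 0 ∷ 5 ∷ []) ([]))
             (leaf (36 ∷ 630 ∷ 0 ∷ 171 ∷ 60 ∷ 570 ∷ 18 ∷ 153 ∷ 0 ∷ 0 ∷ 0 ∷ 0 ∷ 600 ∷ 60 ∷ 1440 ∷ 96 ∷ 0 ∷ 0 ∷ 0 ∷ 0 ∷ 0 ∷ 1709 ∷ 857 ∷ 14 ∷ 0 ∷ 22 ∷ []) ([]))))))))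
       (branch f3
        (branch f8
         (branch f6
          (leaf (270 ∷ 300 ∷ 81 ∷ 300 ∷ 300 ∷ 81 ∷ 48 ∷ 90 ∷ 0 ∷ 0 ∷ 0 ∷ 900 ∷ 16 ∷ 1110 ∷ 74 ∷ 0 ∷ 0 ∷ 0 ∷ 0 ∷ 0 ∷ 971 ∷ 971 ∷ 0 ∷ 0 ∷ 0 ∷ 0 ∷ 0 ∷ 66 ∷ []) ([]))
          (branch f2
           (leaf (13 ∷ 27 ∷ 3 ∷ 30 ∷ 0 ∷ 0 ∷ 0 ∷ 9 ∷ 0 ∷ 0 ∷ 0 ∷ 40 ∷ 4 ∷ 60 ∷ 4 ∷ 0 ∷ 0 ∷ 0 ∷ 0 ∷ 0 ∷ 47 ∷ 89 ∷ 0 ∷ 0 ∷ 0 ∷ 0 ∷ 0 ∷ 3 ∷ []) ([]))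
           (leaf (33600 ∷ 0 ∷ 8319 ∷ 5870 ∷ 27730 ∷ 1761 ∷ 2542 ∷ 1761 ∷ 0 ∷ 0 ∷ 0 ∷ 5520 ∷ 552 ∷ 82290 ∷ 5486 ∷ 0 ∷ 0 ∷ 0 ∷ 0 ∷ 0 ∷ 61197 ∷ 41784 ∷ 0 ∷ 0 ∷ 2186 ∷ 4097 ∷ 0 ∷ 5777 ∷ []) ((130 , (false ∷ false ∷ false ∷ true ∷ false ∷ false ∷ false ∷ false ∷ true ∷ [])) ∷ []))))
         (branch f2
          (leaf (0 ∷ 50 ∷ 0 ∷ 50 ∷ 0 ∷ 0 ∷ 0 ∷ 10 ∷ 0 ∷ 0 ∷ 0 ∷ 80 ∷ 8 ∷ 20 ∷ 2 ∷ 0 ∷ 0 ∷ 0 ∷ 0 ∷ 0 ∷ 51 ∷ 109 ∷ 0 ∷ 0 ∷ 0 ∷ 0 ∷ 0 ∷ 0 ∷ 0 ∷ 5 ∷ []) ([]))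
          (branch f2
           (branch f8
            (leaf (150400800 ∷ 59898680 ∷ 33840180 ∷ 97498880 ∷ 23606680 ∷ 25584594 ∷ 9985364 ∷ 9277459 ∷ 0 ∷ 0 ∷ 0 ∷ 240118000 ∷ 24011800 ∷ 337616880 ∷ 7003512 ∷ 0 ∷ 0 ∷ 0 ∷ 0 ∷ 0 ∷ 269230935 ∷ 269230935 ∷ 0 ∷ 0 ∷ 23034026 ∷ 22560120 ∷ 0 ∷ 0 ∷ 6568430 ∷ 19972205 ∷ []) ((385770 , (false ∷ false ∷ true ∷ true ∷ false ∷ false ∷ false ∷ false ∷ false ∷ [])) ∷ (523370 , (false ∷ false ∷ true ∷ false ∷ false ∷ false ∷ false ∷ false ∷ true ∷ [])) ∷ (385770 , (false ∷ false ∷ false ∷ true ∷ false ∷ false ∷ false ∷ false ∷ true ∷ [])) ∷ (744790 , (false ∷ false ∷ true ∷ true ∷ false ∷ false ∷ false ∷ false ∷ true ∷ [])) ∷ []))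
            (leaf (0 ∷ 15 ∷ 0 ∷ 15 ∷ 0 ∷ 3 ∷ 0 ∷ 3 ∷ 0 ∷ 0 ∷ 0 ∷ 30 ∷ 3 ∷ 0 ∷ 0 ∷ 0 ∷ 0 ∷ 0 ∷ 0 ∷ 0 ∷ 11 ∷ 35 ∷ 0 ∷ 0 ∷ 0 ∷ 0 ∷ 0 ∷ 0 ∷ 1 ∷ 1 ∷ []) ([])))
           (dich 0
            (leaf (280 ∷ 300 ∷ 0 ∷ 50 ∷ 600 ∷ 250 ∷ 15 ∷ 50 ∷ 40 ∷ 0 ∷ 0 ∷ 0 ∷ 520 ∷ 52 ∷ 1320 ∷ 88 ∷ 0 ∷ 0 ∷ 0 ∷ 0 ∷ 0 ∷ 27 ∷ 869 ∷ 0 ∷ 0 ∷ 80 ∷ []) ([]))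
            (branch f2
             (leaf (30 ∷ 550 ∷ 0 ∷ 140 ∷ 0 ∷ 475 ∷ 0 ∷ 140 ∷ 0 ∷ 0 ∷ 0 ∷ 0 ∷ 440 ∷ 44 ∷ 760 ∷ 76 ∷ 0 ∷ 0 ∷ 0 ∷ 0 ∷ 0 ∷ 1375 ∷ 579 ∷ []) ([]))
             (leaf (354 ∷ 6230 ∷ 0 ∷ 1851 ∷ 0 ∷ 6230 ∷ 0 ∷ 1701 ∷ 0 ∷ 0 ∷ 0 ∷ 0 ∷ 6300 ∷ 630 ∷ 9360 ∷ 936 ∷ 0 ∷ 0 ∷ 0 ∷ 0 ∷ 0 ∷ 17117 ∷ 7847 ∷ 0 ∷ 0 ∷ 152 ∷ []) ([])))))))
        (branch f3
         (branch f6
          (branch f8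
           (leaf (250 ∷ 230 ∷ 72 ∷ 240 ∷ 240 ∷ 72 ∷ 41 ∷ 67 ∷ 0 ∷ 0 ∷ 0 ∷ 930 ∷ 0 ∷ 870 ∷ 48 ∷ 0 ∷ 0 ∷ 0 ∷ 0 ∷ 0 ∷ 758 ∷ 860 ∷ 0 ∷ 0 ∷ 0 ∷ 6 ∷ 0 ∷ 62 ∷ 0 ∷ 10 ∷ []) ([]))
           (branch f8
            (leaf (228610 ∷ 795110 ∷ 170352 ∷ 455880 ∷ 567840 ∷ 136764 ∷ 0 ∷ 30526 ∷ 0 ∷ 0 ∷ 0 ∷ 2057490 ∷ 0 ∷ 2277390 ∷ 45588 ∷ 0 ∷ 0 ∷ 0 ∷ 0 ∷ 0 ∷ 979739 ∷ 979739 ∷ 0 ∷ 0 ∷ 0 ∷ 114573 ∷ 0 ∷ 137166 ∷ 0 ∷ 106238 ∷ []) ((5430 , (false ∷ false ∷ false ∷ true ∷ false ∷ false ∷ true ∷ false ∷ false ∷ [])) ∷ (5430 , (false ∷ false ∷ false ∷ true ∷ false ∷ false ∷ false ∷ false ∷ true ∷ [])) ∷ []))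
            (leaf (1030 ∷ 3930 ∷ 309 ∷ 3930 ∷ 300 ∷ 1398 ∷ 327 ∷ 219 ∷ 0 ∷ 0 ∷ 0 ∷ 12420 ∷ 828 ∷ 0 ∷ 0 ∷ 0 ∷ 0 ∷ 0 ∷ 0 ∷ 0 ∷ 6020 ∷ 6020 ∷ 0 ∷ 0 ∷ 0 ∷ 456 ∷ 0 ∷ 0 ∷ 0 ∷ 792 ∷ []) ([]))))
          (branch f6
           (leaf (1471480 ∷ 3689600 ∷ 746163 ∷ 2673870 ∷ 2393880 ∷ 830160 ∷ 331704 ∷ 190408 ∷ 0 ∷ 0 ∷ 0 ∷ 7778280 ∷ 138076 ∷ 5894640 ∷ 589464 ∷ 0 ∷ 0 ∷ 0 ∷ 0 ∷ 0 ∷ 6401999 ∷ 6401999 ∷ 0 ∷ 0 ∷ 0 ∷ 393412 ∷ 0 ∷ 386460 ∷ []) ((30320 , (false ∷ false ∷ false ∷ true ∷ false ∷ false ∷ true ∷ false ∷ false ∷ [])) ∷ []))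
           (leaf (172 ∷ 19 ∷ 42 ∷ 50 ∷ 172 ∷ 6 ∷ 9 ∷ 15 ∷ 0 ∷ 0 ∷ 0 ∷ 420 ∷ 6 ∷ 480 ∷ 32 ∷ 0 ∷ 0 ∷ 0 ∷ 0 ∷ 0 ∷ 252 ∷ 296 ∷ 0 ∷ 0 ∷ 0 ∷ 14 ∷ 0 ∷ 22 ∷ []) ([]))))
         (branch f3
          (leaf (3287690 ∷ 238270 ∷ 54387 ∷ 3344670 ∷ 3287690 ∷ 71481 ∷ 170934 ∷ 153840 ∷ 0 ∷ 0 ∷ 0 ∷ 4848300 ∷ 323220 ∷ 4701780 ∷ 313452 ∷ 0 ∷ 0 ∷ 0 ∷ 0 ∷ 0 ∷ 4449155 ∷ 4449155 ∷ 0 ∷ 0 ∷ 0 ∷ 164718 ∷ []) ((34740 , (false ∷ false ∷ false ∷ true ∷ false ∷ false ∷ false ∷ false ∷ false ∷ [])) ∷ []))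
          (branch f3
           (leaf (2191170 ∷ 162010 ∷ 505164 ∷ 669300 ∷ 2191170 ∷ 48603 ∷ 162600 ∷ 215460 ∷ 0 ∷ 0 ∷ 0 ∷ 2141760 ∷ 214176 ∷ 2823120 ∷ 282312 ∷ 0 ∷ 0 ∷ 0 ∷ 0 ∷ 0 ∷ 4039223 ∷ 4039223 ∷ 0 ∷ 0 ∷ 0 ∷ 65241 ∷ []) ((15540 , (false ∷ false ∷ false ∷ true ∷ false ∷ false ∷ false ∷ false ∷ false ∷ [])) ∷ []))
           (leaf (30 ∷ 5 ∷ 2 ∷ 30 ∷ 30 ∷ 2 ∷ 5 ∷ 5 ∷ 0 ∷ 0 ∷ 0 ∷ 75 ∷ 5 ∷ 75 ∷ 5 ∷ 0 ∷ 0 ∷ 0 ∷ 0 ∷ 0 ∷ 94 ∷ 94 ∷ 0 ∷ 0 ∷ 0 ∷ 1 ∷ []) ([]))))))))))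
   (branch f4
    (branch f6
     (leaf (0 ∷ 4 ∷ 0 ∷ 4 ∷ 0 ∷ 1 ∷ 0 ∷ 1 ∷ 0 ∷ 0 ∷ 2 ∷ 10 ∷ 0 ∷ 0 ∷ 0 ∷ 0 ∷ 0 ∷ 0 ∷ 0 ∷ 0 ∷ 1 ∷ 5 ∷ []) ([]))
     (branch f8
      (leaf (4 ∷ 0 ∷ 1 ∷ 0 ∷ 4 ∷ 0 ∷ 1 ∷ 0 ∷ 0 ∷ 0 ∷ 2 ∷ 0 ∷ 0 ∷ 10 ∷ 0 ∷ 0 ∷ 0 ∷ 0 ∷ 0 ∷ 0 ∷ 5 ∷ 1 ∷ []) ([]))
      (branch f3
       (branch f8
        (leaf (825 ∷ 400 ∷ 120 ∷ 825 ∷ 825 ∷ 120 ∷ 0 ∷ 0 ∷ 0 ∷ 0 ∷ 330 ∷ 1140 ∷ 114 ∷ 1440 ∷ 96 ∷ 0 ∷ 0 ∷ 0 ∷ 0 ∷ 0 ∷ 1439 ∷ 1439 ∷ []) ([]))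
        (branch f6
         (leaf (15 ∷ 10 ∷ 3 ∷ 15 ∷ 15 ∷ 3 ∷ 0 ∷ 0 ∷ 0 ∷ 0 ∷ 6 ∷ 30 ∷ 2 ∷ 30 ∷ 2 ∷ 0 ∷ 0 ∷ 0 ∷ 0 ∷ 0 ∷ 29 ∷ 29 ∷ []) ([]))
         (branch f8
          (branch f1
           (leaf (63750 ∷ 28030 ∷ 0 ∷ 0 ∷ 63750 ∷ 8409 ∷ 0 ∷ 0 ∷ 0 ∷ 0 ∷ 27492 ∷ 88620 ∷ 8862 ∷ 113940 ∷ 7596 ∷ 0 ∷ 0 ∷ 0 ∷ 0 ∷ 0 ∷ 117371 ∷ 117371 ∷ []) ((180 , (false ∷ false ∷ false ∷ false ∷ true ∷ false ∷ false ∷ false ∷ true ∷ [])) ∷ []))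
           (dich 1
            (leaf (3798 ∷ 43635 ∷ 8140 ∷ 6240 ∷ 30975 ∷ 40470 ∷ 4341 ∷ 0 ∷ 0 ∷ 0 ∷ 0 ∷ 16188 ∷ 49740 ∷ 4974 ∷ 74610 ∷ 4974 ∷ 0 ∷ 0 ∷ 0 ∷ 0 ∷ 0 ∷ 78407 ∷ 53177 ∷ []) ((90 , (false ∷ false ∷ false ∷ false ∷ true ∷ false ∷ false ∷ false ∷ true ∷ [])) ∷ []))
            (branch f1
             (leaf (436 ∷ 3200 ∷ 790 ∷ 422 ∷ 790 ∷ 3200 ∷ 237 ∷ 0 ∷ 0 ∷ 204 ∷ 19 ∷ 927 ∷ 4140 ∷ 414 ∷ 4230 ∷ 282 ∷ 0 ∷ 0 ∷ 0 ∷ 0 ∷ 0 ∷ 5045 ∷ 5045 ∷ []) ([]))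
             (dich 1
              (leaf (89 ∷ 40 ∷ 15 ∷ 110 ∷ 0 ∷ 124 ∷ 0 ∷ 65 ∷ 0 ∷ 0 ∷ 0 ∷ 25 ∷ 25 ∷ 460 ∷ 46 ∷ 0 ∷ 0 ∷ 0 ∷ 0 ∷ 0 ∷ 0 ∷ 0 ∷ 137 ∷ 137 ∷ []) ([]))
              (leaf (120 ∷ 0 ∷ 1580 ∷ 340 ∷ 72 ∷ 1680 ∷ 150 ∷ 531 ∷ 0 ∷ 0 ∷ 0 ∷ 0 ∷ 1032 ∷ 3600 ∷ 240 ∷ 3240 ∷ 216 ∷ 0 ∷ 0 ∷ 0 ∷ 0 ∷ 0 ∷ 2951 ∷ 2951 ∷ []) ([]))))))
          (branch f2
           (branch f6
            (leaf (2210 ∷ 9570 ∷ 663 ∷ 9570 ∷ 0 ∷ 0 ∷ 0 ∷ 0 ∷ 0 ∷ 0 ∷ 5004 ∷ 18990 ∷ 1266 ∷ 18990 ∷ 1266 ∷ 0 ∷ 0 ∷ 0 ∷ 0 ∷ 0 ∷ 16607 ∷ 16607 ∷ []) ((30 , (false ∷ false ∷ false ∷ false ∷ true ∷ false ∷ true ∷ false ∷ false ∷ [])) ∷ []))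
            (branch f6
             (leaf (11490 ∷ 25675 ∷ 3660 ∷ 24965 ∷ 0 ∷ 0 ∷ 0 ∷ 0 ∷ 0 ∷ 0 ∷ 9986 ∷ 44310 ∷ 2954 ∷ 33760 ∷ 3376 ∷ 0 ∷ 0 ∷ 0 ∷ 0 ∷ 0 ∷ 49941 ∷ 49941 ∷ []) ((70 , (false ∷ false ∷ false ∷ false ∷ true ∷ false ∷ true ∷ false ∷ false ∷ [])) ∷ []))
             (branch f6
              (leaf (37420 ∷ 22100 ∷ 5013 ∷ 42810 ∷ 0 ∷ 0 ∷ 0 ∷ 0 ∷ 0 ∷ 0 ∷ 17124 ∷ 75960 ∷ 5064 ∷ 54300 ∷ 5430 ∷ 0 ∷ 0 ∷ 0 ∷ 0 ∷ 0 ∷ 79517 ∷ 87083 ∷ []) ((120 , (false ∷ false ∷ false ∷ false ∷ true ∷ false ∷ true ∷ false ∷ false ∷ [])) ∷ []))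
              (branch f6
               (leaf (35525 ∷ 54400 ∷ 0 ∷ 89925 ∷ 0 ∷ 0 ∷ 0 ∷ 0 ∷ 0 ∷ 0 ∷ 35970 ∷ 156210 ∷ 12456 ∷ 107910 ∷ 7194 ∷ 0 ∷ 0 ∷ 0 ∷ 0 ∷ 0 ∷ 109307 ∷ 177383 ∷ []) ((150 , (false ∷ false ∷ false ∷ false ∷ true ∷ false ∷ true ∷ false ∷ false ∷ [])) ∷ []))
               (branch f6
                (leaf (9325 ∷ 15950 ∷ 0 ∷ 25275 ∷ 0 ∷ 0 ∷ 0 ∷ 0 ∷ 0 ∷ 0 ∷ 10110 ∷ 48855 ∷ 3303 ∷ 30330 ∷ 2022 ∷ 0 ∷ 0 ∷ 0 ∷ 0 ∷ 0 ∷ 30128 ∷ 52169 ∷ []) ((75 , (false ∷ false ∷ false ∷ false ∷ true ∷ false ∷ true ∷ false ∷ false ∷ [])) ∷ []))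
                (branch f1
                 (leaf (830 ∷ 625 ∷ 0 ∷ 0 ∷ 0 ∷ 0 ∷ 0 ∷ 0 ∷ 0 ∷ 0 ∷ 207 ∷ 735 ∷ 99 ∷ 2115 ∷ 141 ∷ 0 ∷ 0 ∷ 0 ∷ 0 ∷ 0 ∷ 2081 ∷ 2081 ∷ []) ([]))
                 (dich 1
                  (leaf (112 ∷ 58 ∷ 37 ∷ 0 ∷ 95 ∷ 0 ∷ 0 ∷ 0 ∷ 0 ∷ 0 ∷ 0 ∷ 38 ∷ 315 ∷ 46 ∷ 0 ∷ 0 ∷ 0 ∷ 0 ∷ 0 ∷ 0 ∷ 0 ∷ 137 ∷ 137 ∷ []) ([]))
                  (branch f1
                   (leaf (48 ∷ 1540 ∷ 2465 ∷ 462 ∷ 1575 ∷ 0 ∷ 0 ∷ 0 ∷ 0 ∷ 0 ∷ 0 ∷ 726 ∷ 3780 ∷ 252 ∷ 4950 ∷ 330 ∷ 0 ∷ 0 ∷ 0 ∷ 0 ∷ 0 ∷ 5441 ∷ 5441 ∷ []) ([]))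
                   (dich 1
                    (leaf (112 ∷ 34 ∷ 0 ∷ 75 ∷ 0 ∷ 75 ∷ 0 ∷ 0 ∷ 0 ∷ 0 ∷ 0 ∷ 0 ∷ 30 ∷ 340 ∷ 34 ∷ 0 ∷ 0 ∷ 0 ∷ 0 ∷ 0 ∷ 0 ∷ 0 ∷ 95 ∷ 95 ∷ []) ([]))
                    (leaf (5 ∷ 0 ∷ 58 ∷ 42 ∷ 0 ∷ 100 ∷ 0 ∷ 0 ∷ 0 ∷ 0 ∷ 0 ∷ 1 ∷ 52 ∷ 240 ∷ 16 ∷ 135 ∷ 9 ∷ 0 ∷ 0 ∷ 0 ∷ 0 ∷ 0 ∷ 137 ∷ 252 ∷ []) ([])))))))))))
           (dich 0
            (branch f1
             (leaf (294 ∷ 1160 ∷ 1715 ∷ 0 ∷ 0 ∷ 2475 ∷ 120 ∷ 0 ∷ 0 ∷ 0 ∷ 0 ∷ 990 ∷ 3690 ∷ 246 ∷ 3960 ∷ 396 ∷ 0 ∷ 0 ∷ 0 ∷ 0 ∷ 0 ∷ 3761 ∷ 3761 ∷ []) ([]))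
             (branch f1
              (leaf (21 ∷ 75 ∷ 0 ∷ 15 ∷ 0 ∷ 75 ∷ 0 ∷ 0 ∷ 0 ∷ 10 ∷ 0 ∷ 0 ∷ 60 ∷ 6 ∷ 120 ∷ 12 ∷ 0 ∷ 0 ∷ 0 ∷ 0 ∷ 0 ∷ 88 ∷ 89 ∷ []) ([]))
              (leaf (6 ∷ 0 ∷ 35 ∷ 3 ∷ 30 ∷ 25 ∷ 3 ∷ 0 ∷ 0 ∷ 0 ∷ 0 ∷ 14 ∷ 60 ∷ 4 ∷ 60 ∷ 4 ∷ 0 ∷ 0 ∷ 0 ∷ 0 ∷ 0 ∷ 39 ∷ 56 ∷ 2 ∷ []) ([]))))
            (branch f2
             (leaf (411 ∷ 515 ∷ 3850 ∷ 738 ∷ 1905 ∷ 2565 ∷ 195 ∷ 0 ∷ 0 ∷ 0 ∷ 0 ∷ 1848 ∷ 6705 ∷ 447 ∷ 6165 ∷ 411 ∷ 0 ∷ 0 ∷ 0 ∷ 0 ∷ 0 ∷ 5840 ∷ 5840 ∷ []) ([]))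
             (dich 0
              (leaf (286 ∷ 176 ∷ 1725 ∷ 0 ∷ 259 ∷ 1100 ∷ 1725 ∷ 0 ∷ 0 ∷ 0 ∷ 0 ∷ 0 ∷ 1042 ∷ 1740 ∷ 174 ∷ 4680 ∷ 312 ∷ 0 ∷ 0 ∷ 0 ∷ 0 ∷ 0 ∷ 2497 ∷ 2497 ∷ []) ([]))
              (leaf (120 ∷ 0 ∷ 380 ∷ 1540 ∷ 531 ∷ 150 ∷ 1680 ∷ 72 ∷ 0 ∷ 0 ∷ 24 ∷ 0 ∷ 960 ∷ 3240 ∷ 216 ∷ 2400 ∷ 240 ∷ 0 ∷ 0 ∷ 0 ∷ 0 ∷ 0 ∷ 3239 ∷ 2951 ∷ []) ([])))))))))
       (branch f3
        (branch f6
         (branch f8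
          (leaf (20 ∷ 7 ∷ 2 ∷ 20 ∷ 20 ∷ 2 ∷ 3 ∷ 3 ∷ 0 ∷ 0 ∷ 8 ∷ 30 ∷ 2 ∷ 30 ∷ 2 ∷ 0 ∷ 0 ∷ 0 ∷ 0 ∷ 0 ∷ 30 ∷ 30 ∷ []) ([]))
          (branch f8
           (leaf (525760 ∷ 1132910 ∷ 236592 ∷ 870030 ∷ 870030 ∷ 236592 ∷ 261009 ∷ 149589 ∷ 0 ∷ 0 ∷ 522720 ∷ 2489760 ∷ 165984 ∷ 1774440 ∷ 89295 ∷ 0 ∷ 0 ∷ 0 ∷ 0 ∷ 0 ∷ 2122802 ∷ 2122802 ∷ 0 ∷ 0 ∷ 0 ∷ 0 ∷ 0 ∷ 0 ∷ 0 ∷ 87003 ∷ []) ((4140 , (false ∷ false ∷ false ∷ false ∷ true ∷ false ∷ false ∷ false ∷ true ∷ [])) ∷ []))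
           (branch f8
            (leaf (139485 ∷ 65850 ∷ 19755 ∷ 139485 ∷ 139485 ∷ 19755 ∷ 19755 ∷ 27897 ∷ 0 ∷ 8862 ∷ 46932 ∷ 282570 ∷ 18838 ∷ 304510 ∷ 17201 ∷ 0 ∷ 0 ∷ 0 ∷ 0 ∷ 0 ∷ 297087 ∷ 269953 ∷ 0 ∷ 0 ∷ 0 ∷ 0 ∷ 0 ∷ 0 ∷ 0 ∷ 9299 ∷ []) ((420 , (false ∷ false ∷ false ∷ false ∷ true ∷ false ∷ false ∷ false ∷ true ∷ [])) ∷ []))
            (branch f8
             (leaf (464340 ∷ 218510 ∷ 65553 ∷ 464340 ∷ 464340 ∷ 65553 ∷ 65553 ∷ 92868 ∷ 0 ∷ 25953 ∷ 159783 ∷ 921870 ∷ 61458 ∷ 996960 ∷ 58725 ∷ 0 ∷ 0 ∷ 0 ∷ 0 ∷ 0 ∷ 1050224 ∷ 883619 ∷ 0 ∷ 0 ∷ 0 ∷ 0 ∷ 0 ∷ 0 ∷ 0 ∷ 23217 ∷ []) ((1230 , (false ∷ false ∷ false ∷ false ∷ true ∷ false ∷ false ∷ false ∷ true ∷ [])) ∷ []))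
             (branch f8
              (leaf (385425 ∷ 177470 ∷ 53241 ∷ 385425 ∷ 385425 ∷ 53241 ∷ 53241 ∷ 77085 ∷ 0 ∷ 25320 ∷ 128850 ∷ 778230 ∷ 51882 ∷ 743670 ∷ 49047 ∷ 0 ∷ 0 ∷ 0 ∷ 0 ∷ 0 ∷ 919349 ∷ 735977 ∷ 0 ∷ 0 ∷ 0 ∷ 0 ∷ 0 ∷ 0 ∷ 0 ∷ 15417 ∷ []) ((1200 , (false ∷ false ∷ false ∷ false ∷ true ∷ false ∷ false ∷ false ∷ true ∷ [])) ∷ []))
              (branch f2
               (leaf (0 ∷ 390 ∷ 0 ∷ 390 ∷ 0 ∷ 0 ∷ 0 ∷ 78 ∷ 0 ∷ 0 ∷ 114 ∷ 870 ∷ 58 ∷ 150 ∷ 15 ∷ 0 ∷ 0 ∷ 0 ∷ 0 ∷ 0 ∷ 381 ∷ 621 ∷ 0 ∷ 0 ∷ 0 ∷ 0 ∷ 0 ∷ 0 ∷ 0 ∷ 13 ∷ []) ([]))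
               (branch f2
                (leaf (245 ∷ 100 ∷ 0 ∷ 345 ∷ 245 ∷ 0 ∷ 0 ∷ 52 ∷ 0 ∷ 30 ∷ 48 ∷ 495 ∷ 33 ∷ 425 ∷ 25 ∷ 0 ∷ 0 ∷ 0 ∷ 0 ∷ 0 ∷ 433 ∷ 433 ∷ 0 ∷ 0 ∷ 34 ∷ 0 ∷ 0 ∷ 0 ∷ 10 ∷ []) ([]))
                (leaf (0 ∷ 770 ∷ 123 ∷ 360 ∷ 740 ∷ 9 ∷ 0 ∷ 119 ∷ 0 ∷ 9 ∷ 363 ∷ 1020 ∷ 68 ∷ 1170 ∷ 78 ∷ 0 ∷ 0 ∷ 0 ∷ 0 ∷ 0 ∷ 1217 ∷ 1000 ∷ 0 ∷ 0 ∷ 76 ∷ []) ([])))))))))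
         (branch f6
          (branch f1
           (branch f8
            (leaf (92220 ∷ 43010 ∷ 0 ∷ 0 ∷ 92220 ∷ 12903 ∷ 27306 ∷ 0 ∷ 18204 ∷ 0 ∷ 0 ∷ 133230 ∷ 4461 ∷ 274860 ∷ 18324 ∷ 0 ∷ 0 ∷ 0 ∷ 0 ∷ 0 ∷ 236831 ∷ 134189 ∷ 0 ∷ 0 ∷ 0 ∷ 0 ∷ 0 ∷ 13263 ∷ []) ((420 , (false ∷ false ∷ false ∷ true ∷ false ∷ false ∷ true ∷ false ∷ false ∷ [])) ∷ (420 , (false ∷ false ∷ false ∷ false ∷ true ∷ false ∷ true ∷ false ∷ false ∷ [])) ∷ []))
            (branch f2
             (leaf (29622290 ∷ 36367960 ∷ 0 ∷ 0 ∷ 0 ∷ 0 ∷ 5983116 ∷ 7214934 ∷ 0 ∷ 0 ∷ 8314666 ∷ 65990250 ∷ 2903571 ∷ 52792200 ∷ 5279220 ∷ 0 ∷ 0 ∷ 0 ∷ 0 ∷ 0 ∷ 75492845 ∷ 75492845 ∷ 0 ∷ 0 ∷ 0 ∷ 0 ∷ 0 ∷ 4487337 ∷ []) ((175140 , (false ∷ false ∷ false ∷ true ∷ false ∷ false ∷ true ∷ false ∷ false ∷ [])) ∷ (88610 , (false ∷ false ∷ false ∷ false ∷ true ∷ false ∷ true ∷ false ∷ false ∷ [])) ∷ []))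
             (branch f2
              (leaf (16880 ∷ 21100 ∷ 0 ∷ 0 ∷ 16880 ∷ 1688 ∷ 0 ∷ 5064 ∷ 2321 ∷ 0 ∷ 2743 ∷ 37980 ∷ 0 ∷ 61190 ∷ 3798 ∷ 0 ∷ 0 ∷ 0 ∷ 0 ∷ 0 ∷ 37557 ∷ 37557 ∷ 0 ∷ 0 ∷ 5064 ∷ 0 ∷ 0 ∷ 7596 ∷ 844 ∷ []) ((180 , (false ∷ false ∷ true ∷ false ∷ false ∷ false ∷ true ∷ false ∷ false ∷ [])) ∷ (60 , (false ∷ false ∷ false ∷ true ∷ false ∷ false ∷ true ∷ false ∷ false ∷ [])) ∷ (182 , (false ∷ false ∷ false ∷ false ∷ true ∷ false ∷ true ∷ false ∷ false ∷ [])) ∷ []))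
              (leaf (170 ∷ 0 ∷ 0 ∷ 0 ∷ 120 ∷ 15 ∷ 21 ∷ 0 ∷ 36 ∷ 0 ∷ 0 ∷ 150 ∷ 0 ∷ 540 ∷ 36 ∷ 0 ∷ 0 ∷ 0 ∷ 0 ∷ 0 ∷ 386 ∷ 197 ∷ 0 ∷ 0 ∷ 30 ∷ 0 ∷ 0 ∷ 30 ∷ []) ((1 , (false ∷ false ∷ false ∷ true ∷ false ∷ false ∷ true ∷ false ∷ false ∷ [])) ∷ (5 , (false ∷ false ∷ false ∷ false ∷ true ∷ false ∷ true ∷ false ∷ false ∷ [])) ∷ [])))))
           (leaf (5630 ∷ 6680 ∷ 0 ∷ 12310 ∷ 5630 ∷ 2004 ∷ 0 ∷ 2462 ∷ 0 ∷ 738 ∷ 4046 ∷ 25670 ∷ 1301 ∷ 17490 ∷ 1166 ∷ 0 ∷ 0 ∷ 0 ∷ 0 ∷ 0 ∷ 11999 ∷ 22907 ∷ 0 ∷ 1336 ∷ 0 ∷ 0 ∷ 0 ∷ 1231 ∷ []) ((60 , (false ∷ false ∷ false ∷ false ∷ true ∷ false ∷ true ∷ false ∷ false ∷ [])) ∷ [])))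
          (branch f6
           (branch f1
            (branch f2
             (leaf (150 ∷ 150 ∷ 0 ∷ 0 ∷ 0 ∷ 0 ∷ 15 ∷ 45 ∷ 0 ∷ 0 ∷ 30 ∷ 160 ∷ 16 ∷ 360 ∷ 24 ∷ 0 ∷ 0 ∷ 0 ∷ 0 ∷ 0 ∷ 304 ∷ 386 ∷ 0 ∷ 0 ∷ 0 ∷ 0 ∷ 0 ∷ 20 ∷ []) ([]))
             (branch f2
              (leaf (295400 ∷ 122380 ∷ 0 ∷ 0 ∷ 141370 ∷ 0 ∷ 0 ∷ 41778 ∷ 52328 ∷ 0 ∷ 0 ∷ 392460 ∷ 7596 ∷ 670980 ∷ 44732 ∷ 0 ∷ 0 ∷ 0 ∷ 0 ∷ 0 ∷ 381065 ∷ 381065 ∷ 0 ∷ 0 ∷ 83556 ∷ 0 ∷ 0 ∷ 55704 ∷ []) ((1100 , (false ∷ false ∷ true ∷ false ∷ false ∷ false ∷ true ∷ false ∷ false ∷ [])) ∷ (2065 , (false ∷ false ∷ false ∷ false ∷ true ∷ false ∷ true ∷ false ∷ false ∷ [])) ∷ []))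
              (leaf (12040 ∷ 0 ∷ 0 ∷ 0 ∷ 9570 ∷ 741 ∷ 819 ∷ 741 ∷ 1878 ∷ 384 ∷ 0 ∷ 9300 ∷ 930 ∷ 27090 ∷ 1806 ∷ 0 ∷ 0 ∷ 0 ∷ 0 ∷ 0 ∷ 19790 ∷ 19790 ∷ 0 ∷ 0 ∷ 2190 ∷ 0 ∷ 0 ∷ 1368 ∷ []) ([]))))
            (leaf (64760 ∷ 49180 ∷ 0 ∷ 113940 ∷ 40170 ∷ 22131 ∷ 0 ∷ 22788 ∷ 0 ∷ 12660 ∷ 23664 ∷ 227880 ∷ 12660 ∷ 175500 ∷ 11700 ∷ 0 ∷ 0 ∷ 0 ∷ 0 ∷ 0 ∷ 116387 ∷ 237659 ∷ 0 ∷ 16068 ∷ 0 ∷ 0 ∷ 0 ∷ 7596 ∷ []) ((480 , (false ∷ false ∷ false ∷ false ∷ true ∷ false ∷ true ∷ false ∷ false ∷ [])) ∷ [])))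
           (branch f1
            (branch f2
             (leaf (70 ∷ 50 ∷ 0 ∷ 0 ∷ 0 ∷ 0 ∷ 9 ∷ 15 ∷ 6 ∷ 0 ∷ 0 ∷ 60 ∷ 6 ∷ 180 ∷ 12 ∷ 0 ∷ 0 ∷ 0 ∷ 0 ∷ 0 ∷ 146 ∷ 152 ∷ 0 ∷ 0 ∷ 0 ∷ 0 ∷ 0 ∷ 6 ∷ []) ([]))
             (branch f2
              (leaf (135870 ∷ 5660 ∷ 0 ∷ 0 ∷ 60360 ∷ 1698 ∷ 0 ∷ 13770 ∷ 16410 ∷ 0 ∷ 3986 ∷ 87590 ∷ 8759 ∷ 145360 ∷ 14536 ∷ 0 ∷ 0 ∷ 0 ∷ 0 ∷ 0 ∷ 144925 ∷ 170105 ∷ 0 ∷ 0 ∷ 29072 ∷ 0 ∷ 0 ∷ 11285 ∷ []) ((290 , (false ∷ false ∷ true ∷ true ∷ true ∷ false ∷ false ∷ false ∷ false ∷ [])) ∷ []))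
              (leaf (80 ∷ 83 ∷ 0 ∷ 0 ∷ 119 ∷ 13 ∷ 0 ∷ 21 ∷ 24 ∷ 7 ∷ 0 ∷ 203 ∷ 9 ∷ 436 ∷ 29 ∷ 0 ∷ 0 ∷ 0 ∷ 0 ∷ 0 ∷ 272 ∷ 272 ∷ 0 ∷ 0 ∷ 31 ∷ 0 ∷ 0 ∷ 14 ∷ []) ([]))))
            (branch f1
             (leaf (27 ∷ 30 ∷ 3 ∷ 20 ∷ 57 ∷ 0 ∷ 4 ∷ 3 ∷ 8 ∷ 0 ∷ 0 ∷ 90 ∷ 3 ∷ 120 ∷ 8 ∷ 0 ∷ 0 ∷ 0 ∷ 0 ∷ 0 ∷ 74 ∷ 74 ∷ 0 ∷ 16 ∷ 0 ∷ 0 ∷ 4 ∷ 5 ∷ []) ([]))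
             (leaf (217 ∷ 84 ∷ 9 ∷ 270 ∷ 217 ∷ 25 ∷ 12 ∷ 34 ∷ 0 ∷ 25 ∷ 67 ∷ 340 ∷ 34 ∷ 320 ∷ 32 ∷ 0 ∷ 0 ∷ 0 ∷ 0 ∷ 0 ∷ 339 ∷ 593 ∷ 0 ∷ 34 ∷ 0 ∷ 0 ∷ 0 ∷ 22 ∷ []) ([])))))))
        (branch f3
         (leaf (468700 ∷ 16040 ∷ 8694 ∷ 455760 ∷ 468700 ∷ 4812 ∷ 27135 ∷ 27135 ∷ 0 ∷ 3882 ∷ 188046 ∷ 643860 ∷ 42924 ∷ 651240 ∷ 43416 ∷ 0 ∷ 0 ∷ 0 ∷ 0 ∷ 0 ∷ 530369 ∷ 530369 ∷ 0 ∷ 0 ∷ 0 ∷ 45576 ∷ []) ((4320 , (false ∷ false ∷ false ∷ true ∷ true ∷ false ∷ false ∷ false ∷ false ∷ [])) ∷ []))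
         (branch f3
          (leaf (31760 ∷ 309200 ∷ 9528 ∷ 309200 ∷ 48510 ∷ 87735 ∷ 33420 ∷ 33420 ∷ 33420 ∷ 33420 ∷ 32088 ∷ 407760 ∷ 40776 ∷ 407760 ∷ 40776 ∷ 0 ∷ 0 ∷ 0 ∷ 0 ∷ 0 ∷ 615635 ∷ 615635 ∷ 0 ∷ 0 ∷ 0 ∷ 24732 ∷ []) ((1680 , (false ∷ false ∷ false ∷ true ∷ true ∷ false ∷ false ∷ false ∷ false ∷ [])) ∷ []))
          (leaf (0 ∷ 140 ∷ 0 ∷ 140 ∷ 0 ∷ 42 ∷ 18 ∷ 24 ∷ 18 ∷ 24 ∷ 0 ∷ 360 ∷ 24 ∷ 270 ∷ 18 ∷ 0 ∷ 0 ∷ 0 ∷ 0 ∷ 0 ∷ 323 ∷ 389 ∷ 0 ∷ 0 ∷ 0 ∷ 7 ∷ []) ([]))))))))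
    (branch f4
     (branch f3
      (leaf (1980 ∷ 40 ∷ 12 ∷ 1980 ∷ 1980 ∷ 12 ∷ 0 ∷ 0 ∷ 93 ∷ 12 ∷ 501 ∷ 1800 ∷ 180 ∷ 1800 ∷ 180 ∷ 0 ∷ 0 ∷ 0 ∷ 0 ∷ 0 ∷ 1763 ∷ 1763 ∷ []) ([]))
      (branch f3
       (leaf (578800 ∷ 0 ∷ 76281 ∷ 324530 ∷ 578800 ∷ 0 ∷ 13668 ∷ 102580 ∷ 38607 ∷ 25427 ∷ 90272 ∷ 463040 ∷ 46304 ∷ 929130 ∷ 61942 ∷ 0 ∷ 0 ∷ 0 ∷ 0 ∷ 0 ∷ 663387 ∷ 663387 ∷ []) ((2720 , (false ∷ false ∷ false ∷ true ∷ true ∷ false ∷ false ∷ false ∷ false ∷ [])) ∷ []))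
       (leaf (6 ∷ 1 ∷ 1 ∷ 6 ∷ 6 ∷ 1 ∷ 1 ∷ 1 ∷ 1 ∷ 1 ∷ 0 ∷ 10 ∷ 1 ∷ 15 ∷ 1 ∷ 0 ∷ 0 ∷ 0 ∷ 0 ∷ 0 ∷ 13 ∷ 13 ∷ 0 ∷ 0 ∷ 0 ∷ 1 ∷ []) ([]))))
     (leaf (6 ∷ 1 ∷ 2 ∷ 1 ∷ 6 ∷ 1 ∷ 2 ∷ 1 ∷ 1 ∷ 1 ∷ 0 ∷ 10 ∷ 1 ∷ 10 ∷ 1 ∷ 0 ∷ 0 ∷ 0 ∷ 0 ∷ 0 ∷ 11 ∷ 11 ∷ []) ([])))))

-- With three bad parts all moves obey the same ratio 3:2 and no class size enters, so a single
-- combination settles the case.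
tree₃ : Tree 3
tree₃ =
  (leaf (3 ∷ 1 ∷ 3 ∷ 1 ∷ 4 ∷ 0 ∷ 5 ∷ 5 ∷ 5 ∷ []) ([]))

d₀₁₂ : Distinct f0 f1 f2
d₀₁₂ = distinct₃ (λ ()) (λ ()) (λ ())

d₀₂₁ = rot d₀₁₂
d₁₂₀ = turn d₀₁₂
d₁₀₂ = rot d₁₂₀
d₂₀₁ = turn d₁₂₀
d₂₁₀ = rot d₂₀₁

drop0 : ∀ {x} → NN (x -ᶻ 1ℤ) → NN x
drop0 {x} h = subst NN (alg x) (h ⊞ NN+ 1)
  where alg : ∀ x → x -ᶻ 1ℤ +ᶻ 1ℤ ≡ x
        alg = solve-∀

-- Three bad parts

module ThreeBad {n} (E : List (Subset n)) (uniform : All (λ e → ∣ e ∣ ≡ 3) E) (unique : Unique E) (large : 211 ≤ length E)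
  {P : Colouring {n}} (opt : Extremal.Optimal E P)
  (bad : ∀ i → NN (Extremal.ξ E P i -ᶻ 1ℤ)) where
  open Extremal E
  open Local E opt
  open Certificate E uniform unique large (P)
  open Facts E uniform unique large opt (P) (id) (λ v → refl)
  open Facts₃ E uniform unique large opt (P) (id) (λ v → refl)

  base : State 3 → List (Feature 3)
  base st = trade 3 2 f1 0 zeroᶠ f0 ∷ trade 3 2 f2 0 zeroᶠ f0 ∷ trade 3 2 f0 0 zeroᶠ f1 ∷ trade 3 2 f2 0 zeroᶠ f1
    ∷ trade 3 2 f0 0 zeroᶠ f2 ∷ trade 3 2 f1 0 zeroᶠ f2 ∷ ξᶠ f0 ∷ ξᶠ f1 ∷ ξᶠ f2 ∷ []

  move-holds : ∀ {i j k} → Distinct i j k → Holds (trade 3 2 j 0 zeroᶠ i)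
  move-holds {i} {j} d = trade₀-holds 3 2 j i (λ v s → from-bad d (class-≡ s) (drop0 (bad i)))

  ξ-holds : ∀ i → Holds (ξᶠ i)
  ξ-holds i = subst NN (sym (S-ξ i)) (drop0 (bad i))

  base-holds : ∀ st → Sat st → All Holds (base st)
  base-holds st _ = move-holds d₀₁₂ ∷ move-holds d₀₂₁ ∷ move-holds d₁₀₂ ∷ move-holds d₁₂₀ ∷ move-holds d₂₀₁ ∷ move-holds d₂₁₀
    ∷ ξ-holds f0 ∷ ξ-holds f1 ∷ ξ-holds f2 ∷ []

  goal : Feature 3
  goal t = ξᶠ f0 t +ᶻ ξᶠ f1 t +ᶻ ξᶠ f2 t

  goal-holds : NN (S goal -ᶻ 1ℤ)
  goal-holds = subst NN (trans (alg (ξ P f0) (ξ P f1) (ξ P f2)) (cong (_-ᶻ 1ℤ) (sym (trans (S-+ (λ t → ξᶠ f0 t +ᶻ ξᶠ f1 t) (ξᶠ f2))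
      (cong₂ _+ᶻ_ (trans (S-+ (ξᶠ f0) (ξᶠ f1)) (cong₂ _+ᶻ_ (S-ξ f0) (S-ξ f1))) (S-ξ f2)))))) (bad f0 ⊞ drop0 (bad f1) ⊞ drop0 (bad f2))
    where alg : ∀ x y w → x -ᶻ 1ℤ +ᶻ y +ᶻ w ≡ x +ᶻ y +ᶻ w -ᶻ 1ℤ
          alg = solve-∀

  open Search base base-holds (λ _ _ → [] , []) (λ _ _ _ → inj₁ []) goal goal-holds

  impossible : ⊥
  impossible = sound start [] tree₃ refl (start-sat) []

-- Two bad parts

module TwoBad {n} (E : List (Subset n)) (uniform : All (λ e → ∣ e ∣ ≡ 3) E) (unique : Unique E) (large : 211 ≤ length E)
  {P : Colouring {n}} (opt : Extremal.Optimal E P)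
  (good : NN (neg (Extremal.ξ E P f0))) (bad₁ : NN (Extremal.ξ E P f1 -ᶻ 1ℤ)) (bad₂ : NN (Extremal.ξ E P f2 -ᶻ 1ℤ)) where
  open Extremal E
  open Moves opt
  open Local E opt

  -- Whether the good part remains good without `v`. The two overlap at the threshold, where either
  -- class would do.
  Low High : Fin n → Set
  Low v = NN (neg (ξ P f0 +ᶻ + 5 *ᶻ p P f0 (single v)))
  High v = NN (ξ P f0 +ᶻ + 5 *ᶻ p P f0 (single v))

  -- A far vertex repairs the part `j` by joining it; a near one removes at most the present excess.
  Near Far : Fin 3 → Fin n → Set
  Near j v = NN (ξ P j -ᶻ + 5 *ᶻ q P j (single v))
  Far j v = NN (+ 5 *ᶻ q P j (single v) -ᶻ ξ P j)

  parts : Vec (Fin 3) 9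
  parts = f0 ∷ f0 ∷ f0 ∷ f0 ∷ f0 ∷ f1 ∷ f1 ∷ f2 ∷ f2 ∷ []

  -- f0 … f4 lie in the good part: f0 … f3 may leave it, according to the bad parts they repair, and f4 may not.
  Spec : Fin 9 → Fin n → Set
  Spec f0 v = Low v × Near f1 v × Near f2 v
  Spec f1 v = Low v × Far f1 v × Near f2 v
  Spec f2 v = Low v × Near f1 v × Far f2 v
  Spec f3 v = Low v × Far f1 v × Far f2 v
  Spec f4 v = High v
  Spec f5 v = Near f2 v
  Spec f6 v = Far f2 v
  Spec f7 v = Near f1 v
  Spec f8 v = Far f1 v

  near? : ∀ j v → Near j v ⊎ Far j v
  near? j v with dichotomy (+ 5 *ᶻ q P j (single v)) (ξ P j)
  ... | inj₁ h = inj₁ h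
  ... | inj₂ h = inj₂ (weaken1 {+ 5 *ᶻ q P j (single v)} {ξ P j} h)

  low? : ∀ v → Low v ⊎ High v
  low? v with dichotomy (ξ P f0 +ᶻ + 5 *ᶻ p P f0 (single v)) 0ℤ
  ... | inj₁ h = inj₁ (subst NN (ℤₚ.+-identityˡ (neg (ξ P f0 +ᶻ + 5 *ᶻ p P f0 (single v)))) h)
  ... | inj₂ h = inj₂ (drop0 (subst NN (cong (_-ᶻ 1ℤ) (ℤₚ.+-identityʳ (ξ P f0 +ᶻ + 5 *ᶻ p P f0 (single v)))) h))

  classify : ∀ v i → P v ≡ i → Σ (Fin 9) λ j → P v ≡ lookup parts j × Spec j v
  classify v f0 e with low? v | near? f1 v | near? f2 v
  ... | inj₂ h | _ | _ = f4 , e , h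
  ... | inj₁ l | inj₁ a | inj₁ b = f0 , e , l , a , b
  ... | inj₁ l | inj₂ a | inj₁ b = f1 , e , l , a , b
  ... | inj₁ l | inj₁ a | inj₂ b = f2 , e , l , a , b
  ... | inj₁ l | inj₂ a | inj₂ b = f3 , e , l , a , b
  classify v f1 e with near? f2 v
  ... | inj₁ h = f5 , e , h
  ... | inj₂ h = f6 , e , h
  classify v f2 e with near? f1 v
  ... | inj₁ h = f7 , e , h
  ... | inj₂ h = f8 , e , h

  cl : Fin n → Fin 9
  cl v = proj₁ (classify v (P v) refl)

  part : Fin 9 → Fin 3
  part = lookup parts

  P≡ : ∀ v → P v ≡ part (cl v)
  P≡ v = proj₁ (proj₂ (classify v (P v) refl))

  open Certificate E uniform unique large (cl)
  open Facts E uniform unique large opt (cl) (part) (P≡)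
  open Facts₃ E uniform unique large opt (cl) (part) (P≡)

  spec : ∀ j v → class cl j v ≡ true → Spec j v
  spec j v s = subst (λ j → Spec j v) (class-≡ s) (proj₂ (proj₂ (classify v (P v) refl)))

  in-part : ∀ j v → class cl j v ≡ true → P v ≡ part j
  in-part j v s = class-P s

  goodᶠ : Feature 9
  goodᶠ t = -[1+ 0 ] *ᶻ ξᶠ f0 t

  S-good : S goodᶠ ≡ neg (ξ P f0)
  S-good = trans (S-* -[1+ 0 ] (ξᶠ f0)) (trans (cong (-[1+ 0 ] *ᶻ_) (S-ξ f0)) (ℤₚ.-1*i≡-i (ξ P f0)))

  good-holds : Holds goodᶠ
  good-holds = subst NN (sym S-good) good

  ξ-holds : ∀ i → NN (ξ P i -ᶻ 1ℤ) → Holds (ξᶠ i)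
  ξ-holds i h = subst NN (sym (S-ξ i)) (drop0 h)

  -- For a vertex `v` of the class `l`, the chain inequalities added over the class `u` say that 5k
  -- times the loss of `v` is at least the gain of `u`. The size of `u` occurs on both sides, so it
  -- has to be known exactly.
  chainᶠ : ℕ × Bool → Fin 3 → Fin 9 → ℕ → Fin 9 → Feature 9
  -- With coefficient 0 in second place, the target `f0` is a mere placeholder.
  chainᶠ (k , true) j u kl l = trade (5 * k) 0 f0 kl (gain k j u) l
  chainᶠ (k , false) j u kl l = zeroᶠ

  base : State 9 → List (Feature 9)
  base st = trade 2 3 f1 0 zeroᶠ f0 ∷ trade 2 3 f2 0 zeroᶠ f0
    ∷ trade 10 10 f1 (k f1) (ξᶠ f1) f1 ∷ trade 2 3 f2 0 zeroᶠ f1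
    ∷ trade 2 3 f1 0 zeroᶠ f2 ∷ trade 10 10 f2 (k f2) (ξᶠ f2) f2
    ∷ trade 10 10 f1 (k f3) (ξᶠ f1) f3 ∷ trade 10 10 f2 (k f3) (ξᶠ f2) f3
    -- The last of these three entries, with coefficients 5 and 0, is the defining inequality of
    -- `High` itself.
    ∷ trade 15 10 f1 (k f4) goodᶠ f4 ∷ trade 15 10 f2 (k f4) goodᶠ f4 ∷ trade 5 0 f0 (k f4) goodᶠ f4
    ∷ trade 1 1 f2 0 zeroᶠ f5 ∷ trade 15 10 f2 (k f6) (ξᶠ f2) f6 ∷ trade 1 1 f1 0 zeroᶠ f7 ∷ trade 15 10 f1 (k f8) (ξᶠ f1) f8
    ∷ trade 3 2 f0 0 zeroᶠ f5 ∷ trade 3 2 f0 0 zeroᶠ f6 ∷ trade 3 2 f0 0 zeroᶠ f7 ∷ trade 3 2 f0 0 zeroᶠ f8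
    ∷ goodᶠ ∷ ξᶠ f1 ∷ ξᶠ f2
    ∷ pairᶠ (k f1) (k f2) f1 f2 f0 ∷ pairᶠ (k f1) (k f3) f1 f3 f0 ∷ pairᶠ (k f3) (k f2) f3 f2 f0 ∷ twinᶠ (k f3) f3 f0
    ∷ chainᶠ (lookup st f1) f1 f1 (k f6) f6 ∷ chainᶠ (lookup st f3) f1 f3 (k f6) f6
    ∷ chainᶠ (lookup st f2) f2 f2 (k f8) f8 ∷ chainᶠ (lookup st f3) f2 f3 (k f8) f8 ∷ []
    where
    k : Fin 9 → ℕ
    k j = proj₁ (lookup st j)

  apart : ∀ {a b} → ¬ a ≡ b → ∀ u → class cl a u ≡ true → ∀ v → class cl b v ≡ true → single u v ≡ false
  apart a≢b u s v t with single u v in eq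
  ... | false = refl
  ... | true = contradiction (trans (sym (class-≡ s)) (trans (cong cl (single-≡ {u = u} {v} eq)) (class-≡ t))) a≢b

  -- Sending `u` to one bad part and `v` to the other repairs both, so the good part cannot spare
  -- the two together.
  far-pair : ∀ a b → part a ≡ f0 → part b ≡ f0 → (∀ u → class cl a u ≡ true → Far f1 u) → (∀ v → class cl b v ≡ true → Far f2 v) →
    ∀ u → class cl a u ≡ true → ∀ v → class cl b v ≡ true → single u v ≡ false → NN (+ 5 *ᶻ p₂ f0 (single u) (single v) +ᶻ ξ P f0)
  far-pair a b pa pb fa fb u s v t ne = drop0 (pair-balanced d₀₁₂ {single u} {single v} (single⊂ {P = P} (trans (in-part a u s) pa)) (single⊂ {P = P} (trans (in-part b v t) pb))
    (λ x r → subst (λ x → single u x ≡ false) (single-≡ {u = v} {x} r) ne) (fa u s) (fb v t))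

  far₁ : ∀ u → class cl f1 u ≡ true → Far f1 u
  far₁ u s = proj₁ (proj₂ (spec f1 u s))
  far₂ : ∀ u → class cl f2 u ≡ true → Far f2 u
  far₂ u s = proj₂ (proj₂ (spec f2 u s))
  far₃₁ : ∀ u → class cl f3 u ≡ true → Far f1 u
  far₃₁ u s = proj₁ (proj₂ (spec f3 u s))
  far₃₂ : ∀ u → class cl f3 u ≡ true → Far f2 u
  far₃₂ u s = proj₂ (proj₂ (spec f3 u s))

  chain-holds : ∀ {j l} (d : Distinct f0 j l) u w → part u ≡ f0 → part w ≡ j → ∀ kx kl → SatAt kx (size u) → kl ≤ size w →
    (∀ x → class cl u x ≡ true → Low x) → (∀ x → class cl u x ≡ true → Far j x) → (∀ y → class cl w y ≡ true → Far l y) →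
    Holds (chainᶠ kx j u kl w)
  chain-holds d u w pu refl (k , false) kl _ kl≤ low far farw = subst NN (sym S-zero) (NN+ 0)
  chain-holds {j} {l} d u w pu refl (.(size u) , true) kl refl kl≤ low far farw =
    trade-holds (5 * size u) 0 f0 kl (gain (size u) j u) w kl≤ (gain-holds j u far) step
    where
    step : ∀ v → class cl w v ≡ true → NN (+ (5 * size u) *ᶻ p P j (single v) -ᶻ + 0 *ᶻ q P f0 (single v) -ᶻ S (gain (size u) j u))
    step v t = subst (λ r → NN (r -ᶻ S (gain (size u) j u))) (trans (alg (+ size u) (p P j (single v)) (q P f0 (single v))) (cong (λ r → r *ᶻ p P j (single v) -ᶻ + 0 *ᶻ q P f0 (single v)) (sym (ℤₚ.pos-* 5 (size u)))))
        (gain-bounds j u (+ 5 *ᶻ p P j (single v)) (λ x s → drop0 (chain-balanced d {single x} {single v} (single⊂ {P = P} (trans (in-part u x s) pu)) (single⊂ {P = P} (in-part w v t)) (low x s) (farw v t))))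
      where alg : ∀ s p q → s *ᶻ (+ 5 *ᶻ p) ≡ + 5 *ᶻ s *ᶻ p -ᶻ + 0 *ᶻ q
            alg = solve-∀

  base-holds : ∀ st → Sat st → All Holds (base st)
  base-holds st sat = trade₀-holds 2 3 f1 f0 (λ v s → low-near d₀₁₂ (in-part f0 v s) (proj₁ (spec f0 v s)) (proj₁ (proj₂ (spec f0 v s))))
    ∷ trade₀-holds 2 3 f2 f0 (λ v s → low-near d₀₂₁ (in-part f0 v s) (proj₁ (spec f0 v s)) (proj₂ (proj₂ (spec f0 v s))))
    ∷ trade-by 10 10 f1 (k f1) (ξᶠ f1) f1 (S-ξ f1) (k≤ f1) (ξ-holds f1 bad₁) (λ v s → low-far d₀₁₂ (in-part f1 v s) (proj₁ (spec f1 v s)) (far₁ v s))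
    ∷ trade₀-holds 2 3 f2 f1 (λ v s → low-near d₀₂₁ (in-part f1 v s) (proj₁ (spec f1 v s)) (proj₂ (proj₂ (spec f1 v s))))
    ∷ trade₀-holds 2 3 f1 f2 (λ v s → low-near d₀₁₂ (in-part f2 v s) (proj₁ (spec f2 v s)) (proj₁ (proj₂ (spec f2 v s))))
    ∷ trade-by 10 10 f2 (k f2) (ξᶠ f2) f2 (S-ξ f2) (k≤ f2) (ξ-holds f2 bad₂) (λ v s → low-far d₀₂₁ (in-part f2 v s) (proj₁ (spec f2 v s)) (far₂ v s))
    ∷ trade-by 10 10 f1 (k f3) (ξᶠ f1) f3 (S-ξ f1) (k≤ f3) (ξ-holds f1 bad₁) (λ v s → low-far d₀₁₂ (in-part f3 v s) (proj₁ (spec f3 v s)) (far₃₁ v s))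
    ∷ trade-by 10 10 f2 (k f3) (ξᶠ f2) f3 (S-ξ f2) (k≤ f3) (ξ-holds f2 bad₂) (λ v s → low-far d₀₂₁ (in-part f3 v s) (proj₁ (spec f3 v s)) (far₃₂ v s))
    ∷ trade-by 15 10 f1 (k f4) goodᶠ f4 S-good (k≤ f4) good-holds (λ v s → high d₀₁₂ (in-part f4 v s) (spec f4 v s))
    ∷ trade-by 15 10 f2 (k f4) goodᶠ f4 S-good (k≤ f4) good-holds (λ v s → high d₀₂₁ (in-part f4 v s) (spec f4 v s))
    ∷ trade-by 5 0 f0 (k f4) goodᶠ f4 S-good (k≤ f4) good-holds (λ v s → subst NN (alg (ξ P f0) (p P f0 (single v)) (q P f0 (single v))) (spec f4 v s))
    ∷ trade₀-holds 1 1 f2 f5 (λ v s → bad-near d₁₂₀ (in-part f5 v s) (drop0 bad₁) (spec f5 v s))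
    ∷ trade-by 15 10 f2 (k f6) (ξᶠ f2) f6 (S-ξ f2) (k≤ f6) (ξ-holds f2 bad₂) (λ v s → bad-far d₁₂₀ (in-part f6 v s) (drop0 bad₁) (spec f6 v s))
    ∷ trade₀-holds 1 1 f1 f7 (λ v s → bad-near d₂₁₀ (in-part f7 v s) (drop0 bad₂) (spec f7 v s))
    ∷ trade-by 15 10 f1 (k f8) (ξᶠ f1) f8 (S-ξ f1) (k≤ f8) (ξ-holds f1 bad₁) (λ v s → bad-far d₂₁₀ (in-part f8 v s) (drop0 bad₂) (spec f8 v s))
    ∷ trade₀-holds 3 2 f0 f5 (λ v s → from-bad d₁₀₂ (in-part f5 v s) (drop0 bad₁))
    ∷ trade₀-holds 3 2 f0 f6 (λ v s → from-bad d₁₀₂ (in-part f6 v s) (drop0 bad₁))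
    ∷ trade₀-holds 3 2 f0 f7 (λ v s → from-bad d₂₀₁ (in-part f7 v s) (drop0 bad₂))
    ∷ trade₀-holds 3 2 f0 f8 (λ v s → from-bad d₂₀₁ (in-part f8 v s) (drop0 bad₂))
    ∷ good-holds ∷ ξ-holds f1 bad₁ ∷ ξ-holds f2 bad₂
    ∷ pair-holds (k f1) (k f2) f1 f2 f0 (k≤ f1) (k≤ f2) (λ u s v t → far-pair f1 f2 refl refl far₁ far₂ u s v t (apart {f1} {f2} (λ ()) u s v t))
    ∷ pair-holds (k f1) (k f3) f1 f3 f0 (k≤ f1) (k≤ f3) (λ u s v t → far-pair f1 f3 refl refl far₁ far₃₂ u s v t (apart {f1} {f3} (λ ()) u s v t))
    ∷ pair-holds (k f3) (k f2) f3 f2 f0 (k≤ f3) (k≤ f2) (λ u s v t → far-pair f3 f2 refl refl far₃₁ far₂ u s v t (apart {f3} {f2} (λ ()) u s v t))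
    ∷ twin-holds (k f3) f3 f0 (k≤ f3) (λ u s v t → far-pair f3 f3 refl refl far₃₁ far₃₂ u s v t)
    ∷ chain-holds d₀₁₂ f1 f6 refl refl (lookup st f1) (k f6) (sat f1) (k≤ f6) (λ x s → proj₁ (spec f1 x s)) far₁ (λ y s → spec f6 y s)
    ∷ chain-holds d₀₁₂ f3 f6 refl refl (lookup st f3) (k f6) (sat f3) (k≤ f6) (λ x s → proj₁ (spec f3 x s)) far₃₁ (λ y s → spec f6 y s)
    ∷ chain-holds d₀₂₁ f2 f8 refl refl (lookup st f2) (k f8) (sat f2) (k≤ f8) (λ x s → proj₁ (spec f2 x s)) far₂ (λ y s → spec f8 y s)
    ∷ chain-holds d₀₂₁ f3 f8 refl refl (lookup st f3) (k f8) (sat f3) (k≤ f8) (λ x s → proj₁ (spec f3 x s)) far₃₂ (λ y s → spec f8 y s) ∷ []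
    where
    k : Fin 9 → ℕ
    k j = proj₁ (lookup st j)
    k≤ : ∀ j → k j ≤ size j
    k≤ j = SatAt-≤ (lookup st j) (sat j)
    alg : ∀ a x y → a +ᶻ + 5 *ᶻ x ≡ + 5 *ᶻ x -ᶻ + 0 *ᶻ y -ᶻ neg a
    alg = solve-∀

  -- The low vertices of the good part that are near one bad part. Each union contains a class that
  -- is far for the other bad part, which supplies the extra vertex in `alternative₂`.
  w₁ w₂′ : Vec Bool 9
  w₁ = true ∷ false ∷ true ∷ false ∷ false ∷ false ∷ false ∷ false ∷ false ∷ []
  w₂′ = true ∷ true ∷ false ∷ false ∷ false ∷ false ∷ false ∷ false ∷ false ∷ []

  alt : ℕ → State 9 → List (Feature 9) × List (Feature 9)
  alt 0 st = sparseᶠ 4 w₁ f1 ∷ [] , dense₂ᶠ (proj₁ (lookup st f2)) w₁ f0 f2 ∷ []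
  alt 1 st = sparseᶠ 4 w₂′ f2 ∷ [] , dense₂ᶠ (proj₁ (lookup st f1)) w₂′ f0 f1 ∷ []
  alt _ st = [] , []

  wrap : ∀ {F G : Feature 9} → Holds F ⊎ Holds G → All Holds (F ∷ []) ⊎ All Holds (G ∷ [])
  wrap (inj₁ h) = inj₁ (h ∷ [])
  wrap (inj₂ h) = inj₂ (h ∷ [])

  alt-holds : ∀ i st → Sat st → All Holds (proj₁ (alt i st)) ⊎ All Holds (proj₂ (alt i st))
  alt-holds 0 st sat = wrap (alternative₂ d₀₁₂ w₁ (λ v s → trans (P≡ v) (sub (cl v) s)) (drop0 bad₁) (λ v s → nr (cl v) v refl s)
      (proj₁ (lookup st f2)) f2 (SatAt-≤ (lookup st f2) (sat f2)) refl far₂)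
    where
    sub : ∀ j → lookup w₁ j ≡ true → part j ≡ f0
    sub f0 s = refl
    sub f2 s = refl
    sub f1 ()
    sub f3 ()
    sub f4 ()
    sub f5 ()
    sub f6 ()
    sub f7 ()
    sub f8 ()
    nr : ∀ j v → cl v ≡ j → lookup w₁ j ≡ true → Near f1 v
    nr f0 v e s = proj₁ (proj₂ (subst (λ j → Spec j v) e (proj₂ (proj₂ (classify v (P v) refl)))))
    nr f2 v e s = proj₁ (proj₂ (subst (λ j → Spec j v) e (proj₂ (proj₂ (classify v (P v) refl)))))
    nr f1 v e ()
    nr f3 v e ()
    nr f4 v e ()
    nr f5 v e ()
    nr f6 v e ()
    nr f7 v e ()
    nr f8 v e ()
  alt-holds 1 st sat = wrap (alternative₂ d₀₂₁ w₂′ (λ v s → trans (P≡ v) (sub (cl v) s)) (drop0 bad₂) (λ v s → nr (cl v) v refl s)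
      (proj₁ (lookup st f1)) f1 (SatAt-≤ (lookup st f1) (sat f1)) refl far₁)
    where
    sub : ∀ j → lookup w₂′ j ≡ true → part j ≡ f0
    sub f0 s = refl
    sub f1 s = refl
    sub f2 ()
    sub f3 ()
    sub f4 ()
    sub f5 ()
    sub f6 ()
    sub f7 ()
    sub f8 ()
    nr : ∀ j v → cl v ≡ j → lookup w₂′ j ≡ true → Near f2 v
    nr f0 v e s = proj₂ (proj₂ (subst (λ j → Spec j v) e (proj₂ (proj₂ (classify v (P v) refl)))))
    nr f1 v e s = proj₂ (proj₂ (subst (λ j → Spec j v) e (proj₂ (proj₂ (classify v (P v) refl)))))
    nr f2 v e ()
    nr f3 v e ()
    nr f4 v e ()
    nr f5 v e ()
    nr f6 v e ()
    nr f7 v e ()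
    nr f8 v e ()
  alt-holds (suc (suc i)) st sat = inj₁ []

  goal : Feature 9
  goal t = ξᶠ f1 t +ᶻ ξᶠ f2 t

  goal-holds : NN (S goal -ᶻ 1ℤ)
  goal-holds = subst NN (trans (alg (ξ P f1) (ξ P f2)) (cong (_-ᶻ 1ℤ) (sym (trans (S-+ (ξᶠ f1) (ξᶠ f2)) (cong₂ _+ᶻ_ (S-ξ f1) (S-ξ f2)))))) (bad₁ ⊞ drop0 bad₂)
    where alg : ∀ x y → x -ᶻ 1ℤ +ᶻ y ≡ x +ᶻ y -ᶻ 1ℤ
          alg = solve-∀

  open Search base base-holds alt alt-holds goal goal-holds

  impossible : ⊥
  impossible = sound start [] tree₂ refl start-sat []

-- One bad part

module OneBad {n} (E : List (Subset n)) (uniform : All (λ e → ∣ e ∣ ≡ 3) E) (unique : Unique E) (large : 211 ≤ length E)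
  {P : Colouring {n}} (opt : Extremal.Optimal E P)
  (good₀ : NN (neg (Extremal.ξ E P f0))) (good₁ : NN (neg (Extremal.ξ E P f1))) (bad : NN (Extremal.ξ E P f2 -ᶻ 1ℤ)) where
  open Extremal E
  open Moves opt
  open Local E opt

  Near Far : Fin n → Set
  Near v = NN (ξ P f2 -ᶻ + 5 *ᶻ q P f2 (single v))
  Far v = NN (+ 5 *ᶻ q P f2 (single v) -ᶻ ξ P f2)

  parts : Vec (Fin 3) 5
  parts = f0 ∷ f0 ∷ f1 ∷ f1 ∷ f2 ∷ []

  Spec : Fin 5 → Fin n → Set
  Spec f0 v = Far v
  Spec f1 v = Near v
  Spec f2 v = Far v
  Spec f3 v = Near v
  -- The bad part is not subdivided; `Fin 1` serves as the trivially true condition.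
  Spec f4 v = Fin 1

  near? : ∀ v → Near v ⊎ Far v
  near? v with dichotomy (+ 5 *ᶻ q P f2 (single v)) (ξ P f2)
  ... | inj₁ h = inj₁ h
  ... | inj₂ h = inj₂ (weaken1 {+ 5 *ᶻ q P f2 (single v)} {ξ P f2} h)

  classify : ∀ v i → P v ≡ i → Σ (Fin 5) λ j → P v ≡ lookup parts j × Spec j v
  classify v f0 e with near? v
  ... | inj₁ h = f1 , e , h
  ... | inj₂ h = f0 , e , h
  classify v f1 e with near? v
  ... | inj₁ h = f3 , e , h
  ... | inj₂ h = f2 , e , h
  classify v f2 e = f4 , e , f0

  cl : Fin n → Fin 5
  cl v = proj₁ (classify v (P v) refl)

  part : Fin 5 → Fin 3
  part = lookup parts

  P≡ : ∀ v → P v ≡ part (cl v)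
  P≡ v = proj₁ (proj₂ (classify v (P v) refl))

  open Certificate E uniform unique large cl
  open Facts E uniform unique large opt cl part P≡
  open Facts₃ E uniform unique large opt cl part P≡

  at : ∀ j v → cl v ≡ j → Spec j v
  at j v e = subst (λ j → Spec j v) e (proj₂ (proj₂ (classify v (P v) refl)))

  excessᶠ goodᶠ zoneᶠ unzoneᶠ : Fin 3 → Feature 5
  excessᶠ i t = ξᶠ f2 t -ᶻ ξᶠ i t
  goodᶠ i t = -[1+ 0 ] *ᶻ ξᶠ i t
  zoneᶠ i t = + 2 *ᶻ ξᶠ i t +ᶻ + 3 *ᶻ ξᶠ f2 t
  unzoneᶠ i t = -[1+ 0 ] *ᶻ zoneᶠ i t

  S-good : ∀ i → S (goodᶠ i) ≡ neg (ξ P i)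
  S-good i = trans (S-* -[1+ 0 ] (ξᶠ i)) (trans (cong (-[1+ 0 ] *ᶻ_) (S-ξ i)) (ℤₚ.-1*i≡-i (ξ P i)))

  S-excess : ∀ i → S (excessᶠ i) ≡ ξ P f2 -ᶻ ξ P i
  S-excess i = trans (S-- (ξᶠ f2) (ξᶠ i)) (cong₂ _-ᶻ_ (S-ξ f2) (S-ξ i))

  zone : Fin 3 → ℤ
  zone i = + 2 *ᶻ ξ P i +ᶻ + 3 *ᶻ ξ P f2

  S-zone : ∀ i → S (zoneᶠ i) ≡ zone i
  S-zone i = trans (S-+ (λ t → + 2 *ᶻ ξᶠ i t) (λ t → + 3 *ᶻ ξᶠ f2 t)) (cong₂ _+ᶻ_ (trans (S-* (+ 2) (ξᶠ i)) (cong (+ 2 *ᶻ_) (S-ξ i))) (trans (S-* (+ 3) (ξᶠ f2)) (cong (+ 3 *ᶻ_) (S-ξ f2))))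

  S-unzone : ∀ i → S (unzoneᶠ i) ≡ neg (zone i)
  S-unzone i = trans (S-* -[1+ 0 ] (zoneᶠ i)) (trans (cong (-[1+ 0 ] *ᶻ_) (S-zone i)) (ℤₚ.-1*i≡-i (zone i)))

  module Side {i k} (d : Distinct i f2 k) (gi : NN (neg (ξ P i))) (gk : NN (neg (ξ P k))) where

    x : Fin n → ℤ
    x v = p P i (single v)

    hi? : ∀ v → NN (neg (ξ P i +ᶻ + 5 *ᶻ p P i (single v))) ⊎ NN (ξ P i +ᶻ + 5 *ᶻ p P i (single v) -ᶻ 1ℤ)
    hi? v with dichotomy (ξ P i +ᶻ + 5 *ᶻ p P i (single v)) 0ℤ
    ... | inj₁ h = inj₁ (subst NN (ℤₚ.+-identityˡ (neg (ξ P i +ᶻ + 5 *ᶻ p P i (single v)))) h)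
    ... | inj₂ h = inj₂ (subst NN (cong (_-ᶻ 1ℤ) (ℤₚ.+-identityʳ (ξ P i +ᶻ + 5 *ᶻ p P i (single v)))) h)

    -- The vertex alone repairs the only bad part, so its departure must make `i` bad; this puts it
    -- in the situation of `high-far`.
    big : ∀ v → P v ≡ i → Far v → NN (+ 15 *ᶻ p P i (single v) -ᶻ + 10 *ᶻ q P f2 (single v) -ᶻ (ξ P f2 -ᶻ ξ P i))
    big v e far = high-far d e (drop0 {ξ P i +ᶻ + 5 *ᶻ p P i (single v)} (subst NN (alg (p P i (single v)) (ξ P i)) (move-balanced d {single v} (single⊂ {P = P} e) far gk))) far
      where alg : ∀ p x → + 5 *ᶻ p +ᶻ x -ᶻ 1ℤ ≡ x +ᶻ + 5 *ᶻ p -ᶻ 1ℤ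
            alg = solve-∀

    -- If `i` survives the loss of `v`, the ratio is even 2:3. Otherwise the hinge of `i` starts to
    -- pay only above the threshold, and ξ ≤ 0 before the move brings the inequality down to 1:1.
    small : ∀ v → P v ≡ i → Near v → NN (+ 1 *ᶻ p P i (single v) -ᶻ + 1 *ᶻ q P f2 (single v))
    small v e near with hi? v
    ... | inj₁ lo = NN-cancel 1 (subst NN (alg (p P i (single v)) (q P f2 (single v))) (low-near d e lo near ⊞ q-NN f2 (single v)))
      where alg : ∀ p q → + 2 *ᶻ p -ᶻ + 3 *ᶻ q +ᶻ q ≡ + 2 *ᶻ (+ 1 *ᶻ p -ᶻ + 1 *ᶻ q)
            alg = solve-∀
    ... | inj₂ hi = NN-cancel 14 (subst NN (alg (p P i (single v)) (q P f2 (single v)) (ξ P i)) (high-near d e (drop0 hi) near ⊞ gi))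
      where alg : ∀ p q a → + 15 *ᶻ p -ᶻ + 15 *ᶻ q +ᶻ a +ᶻ neg a ≡ + 15 *ᶻ (+ 1 *ᶻ p -ᶻ + 1 *ᶻ q)
            alg = solve-∀

    -- The better ratio 2:3 extends to vertices whose departure spoils `i`: then 10p exceeds -2ξ of
    -- `i`, which is at least 3ξ of the bad part by the sign of `zone`, and that is at least 15q
    -- because `v` is near.
    small-zone : NN (neg (zone i)) → ∀ v → P v ≡ i → Near v → NN (+ 2 *ᶻ p P i (single v) -ᶻ + 3 *ᶻ q P f2 (single v))
    small-zone u v e near with hi? v
    ... | inj₁ lo = low-near d e lo near
    ... | inj₂ hi = NN-cancel 4 (subst NN (alg (p P i (single v)) (q P f2 (single v)) (ξ P i) (ξ P f2)) (2 ⊡ drop0 {ξ P i +ᶻ + 5 *ᶻ p P i (single v)} hi ⊞ 3 ⊡ near ⊞ u))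
      where alg : ∀ p q a b → + 2 *ᶻ (a +ᶻ + 5 *ᶻ p) +ᶻ + 3 *ᶻ (b -ᶻ + 5 *ᶻ q) +ᶻ neg (+ 2 *ᶻ a +ᶻ + 3 *ᶻ b) ≡ + 5 *ᶻ (+ 2 *ᶻ p -ᶻ + 3 *ᶻ q)
            alg = solve-∀

  d₀ : Distinct f0 f2 f1
  d₀ = d₀₂₁
  d₁ : Distinct f1 f2 f0
  d₁ = d₁₂₀
  module A₀ = Side {f0} {f1} d₀ good₀ good₁
  module A₁ = Side {f1} {f0} d₁ good₁ good₀

  base : State 5 → List (Feature 5)
  base st = trade 15 10 f2 (proj₁ (lookup st f0)) (excessᶠ f0) f0 ∷ trade 15 10 f2 (proj₁ (lookup st f2)) (excessᶠ f1) f2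
    ∷ trade 1 1 f2 0 zeroᶠ f1 ∷ trade 1 1 f2 0 zeroᶠ f3 ∷ trade 3 2 f0 0 zeroᶠ f4 ∷ trade 3 2 f1 0 zeroᶠ f4
    ∷ goodᶠ f0 ∷ goodᶠ f1 ∷ ξᶠ f2 ∷ []

  excess-holds : ∀ i → NN (neg (ξ P i)) → Holds (excessᶠ i)
  excess-holds i g = subst NN (sym (S-excess i)) (drop0 {ξ P f2} bad ⊞ g)

  base-holds : ∀ st → Sat st → All Holds (base st)
  base-holds st sat =
      trade-by 15 10 f2 (proj₁ (lookup st f0)) (excessᶠ f0) f0 (S-excess f0) (SatAt-≤ (lookup st f0) (sat f0)) (excess-holds f0 good₀) (λ v s → A₀.big v (class-P s) (at f0 v (class-≡ s)))
    ∷ trade-by 15 10 f2 (proj₁ (lookup st f2)) (excessᶠ f1) f2 (S-excess f1) (SatAt-≤ (lookup st f2) (sat f2)) (excess-holds f1 good₁) (λ v s → A₁.big v (class-P s) (at f2 v (class-≡ s)))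
    ∷ trade₀-holds 1 1 f2 f1 (λ v s → A₀.small v (class-P s) (at f1 v (class-≡ s)))
    ∷ trade₀-holds 1 1 f2 f3 (λ v s → A₁.small v (class-P s) (at f3 v (class-≡ s)))
    ∷ trade₀-holds 3 2 f0 f4 (λ v s → from-bad d₂₀₁ (class-P s) (drop0 bad))
    ∷ trade₀-holds 3 2 f1 f4 (λ v s → from-bad d₂₁₀ (class-P s) (drop0 bad))
    ∷ subst NN (sym (S-good f0)) good₀ ∷ subst NN (sym (S-good f1)) good₁ ∷ subst NN (sym (S-ξ f2)) (drop0 bad) ∷ []

  o₁ o₂ : Vec Bool 5
  o₁ = false ∷ true ∷ false ∷ false ∷ false ∷ []
  o₂ = false ∷ false ∷ false ∷ true ∷ false ∷ []

  alt : ℕ → State 5 → List (Feature 5) × List (Feature 5)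
  alt 0 st = trade 2 3 f2 0 zeroᶠ f1 ∷ unzoneᶠ f0 ∷ [] , zoneᶠ f0 ∷ []
  alt 1 st = trade 2 3 f2 0 zeroᶠ f3 ∷ unzoneᶠ f1 ∷ [] , zoneᶠ f1 ∷ []
  -- The pairs 5, 3 and 3, 2 are 1 + 2l and l + 1 for l = 2 and l = 1: the threshold and the number
  -- of blocks obtained above it.
  alt 2 st = sparseᶠ 5 o₁ f2 ∷ [] , denseᶠ 3 o₁ f0 ∷ []
  alt 3 st = sparseᶠ 5 o₂ f2 ∷ [] , denseᶠ 3 o₂ f1 ∷ []
  alt 4 st = sparseᶠ 3 o₁ f2 ∷ [] , denseᶠ 2 o₁ f0 ∷ []
  alt 5 st = sparseᶠ 3 o₂ f2 ∷ [] , denseᶠ 2 o₂ f1 ∷ []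
  alt _ st = [] , []

  wrap : ∀ {F G : Feature 5} → Holds F ⊎ Holds G → All Holds (F ∷ []) ⊎ All Holds (G ∷ [])
  wrap (inj₁ h) = inj₁ (h ∷ [])
  wrap (inj₂ h) = inj₂ (h ∷ [])

  o₁⊂ : ∀ v → lookup o₁ (cl v) ≡ true → P v ≡ f0
  o₁⊂ v s = trans (P≡ v) (sub (cl v) s)
    where sub : ∀ j → lookup o₁ j ≡ true → part j ≡ f0
          sub f1 s = refl
          sub f0 ()
          sub f2 ()
          sub f3 ()
          sub f4 ()
  o₂⊂ : ∀ v → lookup o₂ (cl v) ≡ true → P v ≡ f1
  o₂⊂ v s = trans (P≡ v) (sub (cl v) s)
    where sub : ∀ j → lookup o₂ j ≡ true → part j ≡ f1
          sub f3 s = refl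
          sub f0 ()
          sub f1 ()
          sub f2 ()
          sub f4 ()
  near₁ : ∀ v → lookup o₁ (cl v) ≡ true → Near v
  near₁ v s = nr (cl v) refl s
    where nr : ∀ j → cl v ≡ j → lookup o₁ j ≡ true → Near v
          nr f1 e s = at f1 v e
          nr f0 e ()
          nr f2 e ()
          nr f3 e ()
          nr f4 e ()
  near₂ : ∀ v → lookup o₂ (cl v) ≡ true → Near v
  near₂ v s = nr (cl v) refl s
    where nr : ∀ j → cl v ≡ j → lookup o₂ j ≡ true → Near v
          nr f3 e s = at f3 v e
          nr f0 e ()
          nr f1 e ()
          nr f2 e ()
          nr f4 e ()

  alt-holds : ∀ i st → Sat st → All Holds (proj₁ (alt i st)) ⊎ All Holds (proj₂ (alt i st))
  alt-holds 0 st _ with dichotomy (zone f0) 0ℤ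
  ... | inj₂ h = inj₂ (subst NN (sym (S-zone f0)) (drop0 (subst NN (cong (_-ᶻ 1ℤ) (ℤₚ.+-identityʳ (zone f0))) h)) ∷ [])
  ... | inj₁ h = inj₁ (trade₀-holds 2 3 f2 f1 (λ v s → A₀.small-zone u v (class-P s) (at f1 v (class-≡ s))) ∷ subst NN (sym (S-unzone f0)) u ∷ [])
    where u = subst NN (ℤₚ.+-identityˡ (neg (zone f0))) h
  alt-holds 1 st _ with dichotomy (zone f1) 0ℤ
  ... | inj₂ h = inj₂ (subst NN (sym (S-zone f1)) (drop0 (subst NN (cong (_-ᶻ 1ℤ) (ℤₚ.+-identityʳ (zone f1))) h)) ∷ [])
  ... | inj₁ h = inj₁ (trade₀-holds 2 3 f2 f3 (λ v s → A₁.small-zone u v (class-P s) (at f3 v (class-≡ s))) ∷ subst NN (sym (S-unzone f1)) u ∷ [])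
    where u = subst NN (ℤₚ.+-identityˡ (neg (zone f1))) h
  alt-holds 2 st _ = wrap (alternative d₀ o₁ o₁⊂ (drop0 bad) near₁ 2 good₁)
  alt-holds 3 st _ = wrap (alternative d₁ o₂ o₂⊂ (drop0 bad) near₂ 2 good₀)
  alt-holds 4 st _ = wrap (alternative d₀ o₁ o₁⊂ (drop0 bad) near₁ 1 good₁)
  alt-holds 5 st _ = wrap (alternative d₁ o₂ o₂⊂ (drop0 bad) near₂ 1 good₀)
  alt-holds (suc (suc (suc (suc (suc (suc i)))))) st _ = inj₁ []

  open Search base base-holds alt alt-holds (ξᶠ f2) (subst (λ r → NN (r -ᶻ 1ℤ)) (sym (S-ξ f2)) bad)

  impossible : ⊥
  impossible = sound start [] tree₁ refl start-sat []

-- Permuting the labels and minimising over colourings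

module Relabel {n} (E : List (Subset n)) {a b c : Fin 3} (d : Distinct a b c) where
  open Extremal E

  -- A permutation of the labels and its inverse. The potential is symmetric, so optimality survives
  -- and the bad parts may be assumed in fixed positions.
  τ σ : Fin 3 → Fin 3
  τ f0 = a
  τ f1 = b
  τ f2 = c
  σ x with third d x
  ... | inj₁ _ = f0
  ... | inj₂ (inj₁ _) = f1
  ... | inj₂ (inj₂ _) = f2

  open Distinct d
  σ-τ : ∀ x i → δ (σ x) i ≡ δ x (τ i)
  σ-τ x i with third d x
  σ-τ x f0 | inj₁ refl = sym (δ-refl a)
  σ-τ x f1 | inj₁ refl = sym (δ-≢ i≢j)
  σ-τ x f2 | inj₁ refl = sym (δ-≢ i≢k)
  σ-τ x f0 | inj₂ (inj₁ refl) = sym (δ-≢ (i≢j ∘ sym))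
  σ-τ x f1 | inj₂ (inj₁ refl) = sym (δ-refl b)
  σ-τ x f2 | inj₂ (inj₁ refl) = sym (δ-≢ j≢k)
  σ-τ x f0 | inj₂ (inj₂ refl) = sym (δ-≢ (i≢k ∘ sym))
  σ-τ x f1 | inj₂ (inj₂ refl) = sym (δ-≢ (j≢k ∘ sym))
  σ-τ x f2 | inj₂ (inj₂ refl) = sym (δ-refl c)

  ξ-σ : ∀ P i → ξ (σ ∘ P) i ≡ ξ P (τ i)
  ξ-σ P i = cong (λ r → + 5 *ᶻ r -ᶻ + 2 *ᶻ m) (∑-cong E (λ e → cong z (wt-cong e (λ v → σ-τ (P v) i))))

  cost-σ : ∀ P i → cost (σ ∘ P) i ≡ cost P (τ i)
  cost-σ P i = cong (λ r → + 10 *ᶻ r +ᶻ pos (+ 5 *ᶻ r -ᶻ + 2 *ᶻ m)) (∑-cong E (λ e → cong z (wt-cong e (λ v → σ-τ (P v) i))))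

  relabel : ∀ {P} → Optimal P → Optimal (σ ∘ P)
  relabel {P} opt = record
    { minimal = λ Q → subst (_≤ᶻ Φ Q) (sym (trans (cong₂ _+ᶻ_ (cong₂ _+ᶻ_ (cost-σ P f0) (cost-σ P f1)) (cost-σ P f2)) (sym (sum₃-distinct d (cost P))))) (Optimal.minimal opt Q)
    ; unbalanced = Optimal.unbalanced opt }

-- Colourings are searched as vectors, which allows an induction on the length that compares the
-- three possible first entries.
argmin : ∀ n (f : Vec (Fin 3) n → ℤ) → ∃ λ v → ∀ u → f v ≤ᶻ f u
argmin zero f = [] , λ { [] → ℤₚ.≤-refl }
argmin (suc n) f = best (least f0 f1)
  where
  at : ∀ a → ∃ λ v → ∀ u → f (a ∷ v) ≤ᶻ f (a ∷ u)
  at a = argmin n (λ v → f (a ∷ v))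
  least : ∀ a b → ∃ λ w → (∀ u → f w ≤ᶻ f (a ∷ u)) × (∀ u → f w ≤ᶻ f (b ∷ u))
  least a b with at a | at b
  ... | v , p | w , r with ℤₚ.≤-total (f (a ∷ v)) (f (b ∷ w))
  ...   | inj₁ le = (a ∷ v) , p , λ u → ℤₚ.≤-trans le (r u)
  ...   | inj₂ le = (b ∷ w) , (λ u → ℤₚ.≤-trans le (p u)) , r
  best : (∃ λ w → (∀ u → f w ≤ᶻ f (f0 ∷ u)) × (∀ u → f w ≤ᶻ f (f1 ∷ u))) → ∃ λ v → ∀ u → f v ≤ᶻ f u
  best (w , p , r) with at f2
  ... | v , s with ℤₚ.≤-total (f w) (f (f2 ∷ v))
  ...   | inj₁ le = w , λ { (f0 ∷ u) → p u ; (f1 ∷ u) → r u ; (f2 ∷ u) → ℤₚ.≤-trans le (s u) }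
  ...   | inj₂ le = (f2 ∷ v) , λ { (f0 ∷ u) → ℤₚ.≤-trans le (p u) ; (f1 ∷ u) → ℤₚ.≤-trans le (r u) ; (f2 ∷ u) → s u }

-- Existence of a balanced colouring

module Main {n} (E : List (Subset n)) (uniform : All (λ e → ∣ e ∣ ≡ 3) E) (unique : Unique E) (large : 211 ≤ length E) where
  open Extremal E

  sign? : ∀ x → NN (neg x) ⊎ NN (x -ᶻ 1ℤ)
  sign? x with dichotomy x 0ℤ
  ... | inj₁ h = inj₁ (subst NN (ℤₚ.+-identityˡ (neg x)) h)
  ... | inj₂ h = inj₂ (subst NN (cong (_-ᶻ 1ℤ) (ℤₚ.+-identityʳ x)) h)

  no-optimal : ∀ {P} → ¬ Optimal P
  no-optimal {P} opt with sign? (ξ P f0) | sign? (ξ P f1) | sign? (ξ P f2)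
  ... | inj₁ a | inj₁ b | inj₁ c = Optimal.unbalanced opt P λ { f0 → a ; f1 → b ; f2 → c }
  ... | inj₁ a | inj₁ b | inj₂ c = OneBad.impossible E uniform unique large opt a b c
  ... | inj₁ a | inj₂ b | inj₁ c = OneBad.impossible E uniform unique large (R.relabel opt) (subst (NN ∘ neg) (sym (R.ξ-σ P f0)) a) (subst (NN ∘ neg) (sym (R.ξ-σ P f1)) c) (subst (λ r → NN (r -ᶻ 1ℤ)) (sym (R.ξ-σ P f2)) b)
    where module R = Relabel E d₀₂₁
  ... | inj₂ a | inj₁ b | inj₁ c = OneBad.impossible E uniform unique large (R.relabel opt) (subst (NN ∘ neg) (sym (R.ξ-σ P f0)) b) (subst (NN ∘ neg) (sym (R.ξ-σ P f1)) c) (subst (λ r → NN (r -ᶻ 1ℤ)) (sym (R.ξ-σ P f2)) a)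
    where module R = Relabel E d₁₂₀
  ... | inj₁ a | inj₂ b | inj₂ c = TwoBad.impossible E uniform unique large opt a b c
  ... | inj₂ a | inj₁ b | inj₂ c = TwoBad.impossible E uniform unique large (R.relabel opt) (subst (NN ∘ neg) (sym (R.ξ-σ P f0)) b) (subst (λ r → NN (r -ᶻ 1ℤ)) (sym (R.ξ-σ P f1)) a) (subst (λ r → NN (r -ᶻ 1ℤ)) (sym (R.ξ-σ P f2)) c)
    where module R = Relabel E d₁₀₂
  ... | inj₂ a | inj₂ b | inj₁ c = TwoBad.impossible E uniform unique large (R.relabel opt) (subst (NN ∘ neg) (sym (R.ξ-σ P f0)) c) (subst (λ r → NN (r -ᶻ 1ℤ)) (sym (R.ξ-σ P f1)) a) (subst (λ r → NN (r -ᶻ 1ℤ)) (sym (R.ξ-σ P f2)) b)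
    where module R = Relabel E d₂₀₁
  ... | inj₂ a | inj₂ b | inj₂ c = ThreeBad.impossible E uniform unique large opt λ { f0 → a ; f1 → b ; f2 → c }

  M-ext : ∀ {P Q : Colouring {n}} → (∀ v → P v ≡ Q v) → ∀ i → M P i ≡ M Q i
  M-ext h i = ∑-cong E (λ e → cong z (wt-cong e (λ v → cong (λ x → δ x i) (h v))))

  excess : Colouring {n} → ℤ
  excess P = sum₃ (λ i → pos (ξ P i))

  -- A colouring and the lookup function of its table agree only pointwise; `M-ext` and the
  -- hypothesis on `F` carry the minimum from tables to all colourings.
  minimiser : (F : (Fin 3 → ℤ) → ℤ) → (∀ {f g} → (∀ i → f i ≡ g i) → F f ≡ F g) → ∃ λ (P : Colouring {n}) → ∀ Q → F (M P) ≤ᶻ F (M Q)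
  minimiser F ext with argmin n (λ v → F (M (lookup v)))
  ... | v , least = lookup v , λ Q → subst (F (M (lookup v)) ≤ᶻ_) (ext (M-ext (Vecₚ.lookup∘tabulate Q))) (least (tabulate Q))

  sum₃-ext : ∀ (g : ℤ → ℤ) {f h : Fin 3 → ℤ} → (∀ i → f i ≡ h i) → sum₃ (g ∘ f) ≡ sum₃ (g ∘ h)
  sum₃-ext g e = cong₂ _+ᶻ_ (cong₂ _+ᶻ_ (cong g (e f0)) (cong g (e f1))) (cong g (e f2))

  -- Minimising the total hinge decides constructively whether a balanced colouring exists. If the
  -- minimum is 0, its colouring is balanced; if it is positive, no colouring is, and a minimiser of
  -- Φ would be `Optimal`, which `no-optimal` excludes.
  exists-balanced : ∃ λ (P : Colouring {n}) → Balanced P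
  exists-balanced with minimiser (λ f → sum₃ (λ i → pos (+ 5 *ᶻ f i -ᶻ + 2 *ᶻ m))) (sum₃-ext (λ r → pos (+ 5 *ᶻ r -ᶻ + 2 *ᶻ m)))
  ... | P , least with sign? (excess P)
  ...   | inj₁ h = P , λ i → subst NN (ℤₚ.+-identityˡ (neg (ξ P i))) (NN-pos i)
    where
    below-excess : ∀ i → NN (excess P -ᶻ pos (ξ P i))
    below-excess f0 = subst NN (alg (pos (ξ P f0)) (pos (ξ P f1)) (pos (ξ P f2))) (pos-NN (ξ P f1) ⊞ pos-NN (ξ P f2))
      where alg : ∀ a b c → b +ᶻ c ≡ a +ᶻ b +ᶻ c -ᶻ a
            alg = solve-∀
    below-excess f1 = subst NN (alg (pos (ξ P f0)) (pos (ξ P f1)) (pos (ξ P f2))) (pos-NN (ξ P f0) ⊞ pos-NN (ξ P f2))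
      where alg : ∀ a b c → a +ᶻ c ≡ a +ᶻ b +ᶻ c -ᶻ b
            alg = solve-∀
    below-excess f2 = subst NN (alg (pos (ξ P f0)) (pos (ξ P f1)) (pos (ξ P f2))) (pos-NN (ξ P f0) ⊞ pos-NN (ξ P f1))
      where alg : ∀ a b c → a +ᶻ b ≡ a +ᶻ b +ᶻ c -ᶻ c
            alg = solve-∀
    NN-pos : ∀ i → NN (0ℤ -ᶻ ξ P i)
    NN-pos i = subst NN (alg (excess P) (pos (ξ P i)) (ξ P i)) (h ⊞ below-excess i ⊞ pos-≥ (ξ P i))
      where alg : ∀ s p x → neg s +ᶻ (s -ᶻ p) +ᶻ (p -ᶻ x) ≡ 0ℤ -ᶻ x
            alg = solve-∀
  ...   | inj₂ h = ⊥-elim (no-optimal {proj₁ best} (record { minimal = proj₂ best ; unbalanced = unbalanced }))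
    where
    best = minimiser (λ f → sum₃ (λ i → + 10 *ᶻ f i +ᶻ pos (+ 5 *ᶻ f i -ᶻ + 2 *ᶻ m))) (sum₃-ext (λ r → + 10 *ᶻ r +ᶻ pos (+ 5 *ᶻ r -ᶻ + 2 *ᶻ m)))
    unbalanced : ∀ Q → ¬ Balanced Q
    unbalanced Q bal = absurd (subst NN (alg (excess P) (excess Q) (pos (ξ Q f0)) (pos (ξ Q f1)) (pos (ξ Q f2)) refl) (h ⊞ ≤⇒NN (least Q) ⊞ zero-pos f0 ⊞ zero-pos f1 ⊞ zero-pos f2))
      where
      absurd : NN -[1+ 0 ] → ⊥
      absurd ()
      zero-pos : ∀ i → NN (0ℤ -ᶻ pos (ξ Q i))
      zero-pos i = pos-≤ (ξ Q i) (NN+ 0) (subst NN (sym (ℤₚ.+-identityˡ (neg (ξ Q i)))) (bal i))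
      alg : ∀ s s′ a b c → s′ ≡ a +ᶻ b +ᶻ c → s -ᶻ 1ℤ +ᶻ (s′ -ᶻ s) +ᶻ (0ℤ -ᶻ a) +ᶻ (0ℤ -ᶻ b) +ᶻ (0ℤ -ᶻ c) ≡ -[1+ 0 ]
      alg s s′ a b c refl = alg₀ s a b c
        where alg₀ : ∀ s a b c → s -ᶻ 1ℤ +ᶻ (a +ᶻ b +ᶻ c -ᶻ s) +ᶻ (0ℤ -ᶻ a) +ᶻ (0ℤ -ᶻ b) +ᶻ (0ℤ -ᶻ c) ≡ -[1+ 0 ]
              alg₀ = solve-∀

-- Back from missed edges to met edges

wt-witness : ∀ {n} (φ : Fin n → ℕ) e {k} → wt φ e ≡ suc k → ∃ λ v → lookup e v ≡ true × ∃ λ l → φ v ≡ suc l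
wt-witness φ (false ∷ e) h with wt-witness (φ ∘ suc) e h
... | v , r = suc v , r
wt-witness φ (true ∷ e) h with φ zero in eq
... | suc l = zero , refl , l , eq
... | zero with wt-witness (φ ∘ suc) e h
...   | v , r = suc v , r

miss-count : ∀ {n} (P : Colouring {n}) i (E : List (Subset n)) → + length (filter (meets? P i) E) +ᶻ ∑ E (λ e → z (ct P i e)) ≡ + length E
miss-count P i [] = refl
miss-count {n} P i (e ∷ E) = step (meets? P i e)
  where
  swap₁ : ∀ a x → 1ℤ +ᶻ a +ᶻ (0ℤ +ᶻ x) ≡ 1ℤ +ᶻ (a +ᶻ x)
  swap₁ = solve-∀
  swap₂ : ∀ a x → a +ᶻ (1ℤ +ᶻ x) ≡ 1ℤ +ᶻ (a +ᶻ x)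
  swap₂ = solve-∀
  step : Dec (Meets P i e) → + length (filter (meets? P i) (e ∷ E)) +ᶻ (z (ct P i e) +ᶻ ∑ E (λ e → z (ct P i e))) ≡ + suc (length E)
  step (yes (v , v∈e , Pv)) = trans (cong₂ (λ k r → + length k +ᶻ (r +ᶻ ∑ E (λ e → z (ct P i e)))) (Listₚ.filter-accept (meets? P i) {x = e} {xs = E} (v , v∈e , Pv)) hit)
      (trans (swap₁ (+ length (filter (meets? P i) E)) (∑ E (λ e → z (ct P i e)))) (cong (1ℤ +ᶻ_) (miss-count P i E)))
    where
    one : 1 ≤ ct P i e
    one = ℕₚ.≤-trans (ℕₚ.≤-reflexive (sym (trans (single-wt v e) (cong (λ b → if b then 1 else 0) (Vecₚ.[]=⇒lookup v∈e))))) (part≤ct {P = P} (single v) (single⊂ {P = P} Pv) e)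
    hit : z (ct P i e) ≡ 0ℤ
    hit with ct P i e | one
    ... | suc _ | _ = refl
  step (no ¬m) = trans (cong₂ (λ k r → + length k +ᶻ (r +ᶻ ∑ E (λ e → z (ct P i e)))) (Listₚ.filter-reject (meets? P i) {x = e} {xs = E} ¬m) (miss _ refl))
      (trans (swap₂ (+ length (filter (meets? P i) E)) (∑ E (λ e → z (ct P i e)))) (cong (1ℤ +ᶻ_) (miss-count P i E)))
    where
    miss : ∀ k → ct P i e ≡ k → z (ct P i e) ≡ 1ℤ
    miss zero eq = cong z eq
    miss (suc k) eq with wt-witness (λ v → δ (P v) i) e eq
    ... | v , v∈e , l , h = contradiction (v , Vecₚ.lookup⇒[]= v e v∈e , δ-≡ h) ¬m

theorem3 : ∀ (n : ℕ) (G : Hypergraph3 n) → 211 ≤ numEdges G →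
    ∃ λ (P : Partition3 n) → ∀ (i : Fin 3) → 3 * numEdges G ≤ 5 * metCount G P i
theorem3 n G large with Main.exists-balanced (edges G) (uniform G) (distinct G) large
... | P , balanced = P , λ i → ℤₚ.drop‿+≤+ (NN⇒≤ (subst NN (bound i) (balanced i)))
  where
  open Extremal (edges G)
  alg : ∀ l a b → a +ᶻ b ≡ l → neg (+ 5 *ᶻ b -ᶻ + 2 *ᶻ l) ≡ + 5 *ᶻ a -ᶻ + 3 *ᶻ l
  alg l a b refl = alg₀ a b
    where alg₀ : ∀ a b → neg (+ 5 *ᶻ b -ᶻ + 2 *ᶻ (a +ᶻ b)) ≡ + 5 *ᶻ a -ᶻ + 3 *ᶻ (a +ᶻ b)
          alg₀ = solve-∀
  -- Met and missed edges add up to m, so 2m minus five times the missed ones equals five times the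
  -- met ones minus 3m.
  bound : ∀ i → neg (ξ P i) ≡ + (5 * metCount G P i) -ᶻ + (3 * numEdges G)
  bound i = trans (alg (+ numEdges G) (+ metCount G P i) (M P i) (miss-count P i (edges G)))
    (cong₂ _-ᶻ_ (sym (ℤₚ.pos-* 5 (metCount G P i))) (sym (ℤₚ.pos-* 3 (numEdges G))))
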